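{- Let $n$ be a positive even integer, $\lambda$ a positive integer, and $\mathcal{T}=[T_1^{\langle\beta_1\rangle},\ldots,T_s^{\langle\beta_s\rangle}]$ an admissible bipartite 2-factorization type for $\lambda K_n$, with each $T_i$ an admissible bipartite 2-factor type for $K_n$. Suppose there exists a refinement $[\alpha_1,\ldots,\alpha_k]$ of $[\beta_1,\ldots,\beta_s]$ such that one of the following holds: (i) $n\equiv 2\pmod 4$ and $|\{i:\alpha_i\text{ is odd}\}|\le\lfloor\lambda/2\rfloor$; or (ii) $n\equiv 0\pmod 4$, $|\{i:\alpha_i\text{ is odd}\}|\le\lambda+\lfloor\lambda/2\rfloor$, and $|\{i:\alpha_i\text{ is odd},\ \alpha_i\ge 3\}|\ge\lambda$. Then $\lambda K_n$ admits a 2-factorization of type $\mathcal{T}$.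
   Context: $\lambda K_n$: complete multigraph on $n$ vertices with $\lambda$ parallel edges per pair. A 2-factor has type $[c_1,\ldots,c_t]$ if it is a disjoint union of cycles of lengths $c_1,\ldots,c_t$; a type is bipartite if all entries are even; a 2-factor type is admissible for $K_n$ iff its entries are integers $\ge3$ summing to $n$, and for $\lambda K_n$ with $\lambda\ge2$ iff entries are $\ge2$ summing to $n$. A 2-factorization of an $r$-regular graph is a decomposition into $\lfloor r/2\rfloor$ 2-factors plus a single 1-factor if $r$ is odd; its type is the multiset of types of its 2-factors. A 2-factorization type for an $r$-regular graph is admissible if it consists of $\lfloor r/2\rfloor$ admissible 2-factor types, and bipartite if all of them are bipartite. $[T^{\langle a\rangle}]$ denotes $a$ copies of $T$. A multiset $[y_1,\ldots,y_t]$ of positive integers is a refinement of $[x_1,\ldots,x_s]$ if $\{1,\ldots,t\}$ can be partitioned into sets $P_1,\ldots,P_s$ with $\sum_{j\in P_i}y_j=x_i$ for all $i$. -}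

module Defs where

open import Data.Nat using (ℕ; zero; suc; _+_; _*_; _∸_; _≤_; _/_; _%_)
open import Data.Nat.Properties using (_≟_)
open import Data.Fin using (Fin)
open import Data.Fin.Properties using () renaming (_≟_ to _≟ᶠ_)
open import Data.Nat.ListAction using (sum)
open import Data.List using (List; []; _∷_; _++_; [_]; length; map; concat; concatMap; replicate; filter; zip; allFin)
open import Data.List.Relation.Unary.All using (All)
open import Data.List.Relation.Binary.Pointwise using (Pointwise)
open import Data.List.Relation.Binary.Permutation.Propositional using (_↭_)
open import Data.Product using (Σ; _×_; _,_; proj₁; proj₂)
open import Data.Sum using (_⊎_)
open import Relation.Nullary using (Dec; ¬_)
open import Relation.Nullary.Decidable using (_×-dec_; _⊎-dec_)
open import Relation.Binary.PropositionalEquality using (_≡_; _≢_)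

numOdd : List ℕ → ℕ
numOdd αs = length (filter (λ a → a % 2 ≟ 1) αs)

numOddGe3 : List ℕ → ℕ
numOddGe3 αs = numOdd (filter (λ a → Data.Nat._≤?_ 3 a) αs)

-- [y₁,…,yₜ] is a refinement of [x₁,…,xₛ]: the index set of the y's
-- can be partitioned into blocks P₁,…,Pₛ with Σ_{j∈Pᵢ} yⱼ = xᵢ.
-- Blocks are given as lists of the y-values; their concatenation is a
-- rearrangement of ys.
IsRefinement : List ℕ → List ℕ → Set
IsRefinement ys xs =
  Σ (List (List ℕ)) λ parts →
    (concat parts ↭ ys) × Pointwise (λ p x → sum p ≡ x) parts xs

-- A 2-factor type is a multiset of cycle lengths (a list up to ↭).
TwoFactorType : Set
TwoFactorType = List ℕ

Admissible2FType : ℕ → ℕ → TwoFactorType → Set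
Admissible2FType λ' n T = All (λ c → (if1 λ') ≤ c) T × sum T ≡ n
  where
  if1 : ℕ → ℕ
  if1 (suc zero) = 3
  if1 _ = 2

Bipartite2FType : TwoFactorType → Set
Bipartite2FType T = All (λ c → c % 2 ≡ 0) T

degree : ℕ → ℕ → ℕ
degree λ' n = λ' * (n ∸ 1)

AdmissibleFactorizationType : ℕ → ℕ → List TwoFactorType → Set
AdmissibleFactorizationType λ' n 𝒯 =
  (length 𝒯 ≡ degree λ' n / 2) × All (Admissible2FType λ' n) 𝒯

BipartiteFactorizationType : List TwoFactorType → Set
BipartiteFactorizationType 𝒯 = All Bipartite2FType 𝒯

expandType : List (TwoFactorType × ℕ) → List TwoFactorType
expandType = concatMap (λ p → replicate (proj₂ p) (proj₁ p))

Edge : ℕ → Set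
Edge n = Fin n × Fin n

joins? : ∀ {n} (u v : Fin n) (e : Edge n) → Dec ((proj₁ e ≡ u × proj₂ e ≡ v) ⊎ (proj₁ e ≡ v × proj₂ e ≡ u))
joins? u v (a , b) = ((a ≟ᶠ u) ×-dec (b ≟ᶠ v)) ⊎-dec ((a ≟ᶠ v) ×-dec (b ≟ᶠ u))

mult : ∀ {n} → Fin n → Fin n → List (Edge n) → ℕ
mult u v es = length (filter (joins? u v) es)

-- A cycle is given by its cyclic vertex sequence (v₀, …, v_{c-1});
-- its edges are {vᵢ, vᵢ₊₁ mod c}.  A 2-cycle (u,v) thus uses two
-- parallel edges between u and v.
Cycle : ℕ → Set
Cycle n = List (Fin n)

cycleEdges : ∀ {n} → Cycle n → List (Edge n)
cycleEdges [] = []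
cycleEdges (v ∷ vs) = zip (v ∷ vs) (vs ++ [ v ])

TwoFactor : ℕ → Set
TwoFactor n = List (Cycle n)

IsTwoFactor : ∀ {n} → TwoFactor n → Set
IsTwoFactor {n} F = All (λ C → 2 ≤ length C) F × (concat F ↭ allFin n)

twoFactorEdges : ∀ {n} → TwoFactor n → List (Edge n)
twoFactorEdges F = concatMap cycleEdges F

typeOf : ∀ {n} → TwoFactor n → TwoFactorType
typeOf F = map length F

IsOneFactor : ∀ {n} → List (Edge n) → Set
IsOneFactor {n} M = concatMap (λ e → proj₁ e ∷ proj₂ e ∷ []) M ↭ allFin n

OneFactorPart : ∀ {n} → ℕ → List (Edge n) → Set
OneFactorPart r M with r % 2
... | 0 = M ≡ []
... | _ = IsOneFactor M

record TwoFactorization (λ' n : ℕ) (𝒯 : List TwoFactorType) : Set where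
  field
    factors    : List (TwoFactor n)
    oneFactor  : List (Edge n)
    count      : length factors ≡ degree λ' n / 2
    areFactors : All IsTwoFactor factors
    oneFactorOK : OneFactorPart (degree λ' n) oneFactor
    decomposes : ∀ (u v : Fin n) → u ≢ v →
                 sum (map (λ F → mult u v (twoFactorEdges F)) factors)
                   + mult u v oneFactor ≡ λ'
    types      : Σ (List TwoFactorType) λ Ts →
                   Pointwise (λ F T → typeOf F ↭ T) factors Ts × (Ts ↭ 𝒯)

-- Let n = 2m. By Häggkvist, the graph obtained from a Hamilton cycle on m vertices by doubling every
-- vertex (and replacing every edge by four) splits into two 2-factors of any given bipartite type.
-- Walecki's construction decomposes K_m for odd m into Hamilton cycles, and for even m into Hamilton
-- cycles and a cubic ladder. The doubled ladder together with the edges between the two copies of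
-- each vertex is 7-regular; it splits into three 2-factors of any given bipartite type and a
-- 1-factor, which is shown by running along the ladder with a finite set of gadgets. Hence K_n
-- decomposes into a 1-factor and pairs of 2-factors of the same type, with one additional triple for
-- even m. By relabelling, the 1-factor can be prescribed, so that the 1-factors of two copies of
-- K_n can be made to form a 2-factor of any bipartite type. In λK_n this gives ⌊λ/2⌋ single
-- 2-factors, λ triples for even m, and pairs otherwise, and the parts α are made up of these.

module Submission where

open import Defs
open import Data.Bool using (Bool; T; _∧_; _∨_; false; if_then_else_; not; true)
open import Data.Bool.Properties using (T-∧; T-∨; ∧-comm; ∨-comm) renaming (_≟_ to _≟ᴮ_)
open import Data.Empty using (⊥; ⊥-elim)
open import Data.Fin using (Fin)
open import Data.Fin.Properties using () renaming (_≟_ to _≟ᶠ_)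
open import Data.List using (List; []; [_]; _++_; _∷_; allFin; concat; concatMap; downFrom; filter; length; map; replicate; reverse; zip; zipWith)
open import Data.List.Membership.Propositional using (_∈_)
open import Data.List.Membership.Propositional.Properties using (∈-++⁺ʳ; ∈-++⁺ˡ; ∈-++⁻; ∈-allFin; ∈-downFrom⁺; ∈-downFrom⁻; ∈-map⁺; ∈-map⁻; ∈-∃++)
open import Data.List.Properties using (++-assoc; ++-identityʳ; concatMap-++; filter-accept; filter-reject; length-++; length-downFrom; length-map; length-tabulate; map-++; map-id; map-∘; unfold-reverse; ∷-injective)
open import Data.List.Relation.Binary.Permutation.Propositional using (_↭_; prep; swap; ↭-refl; ↭-reflexive; ↭-sym; ↭-trans; ↭⇒↭ₛ)
open import Data.List.Relation.Binary.Permutation.Propositional.Properties using (++-comm; ++⁺ʳ; ++⁺ˡ; All-resp-↭; filter-↭; shift; shifts; ↭-length; ∈-resp-↭) renaming (map⁺ to ↭-map⁺)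
open import Data.List.Relation.Binary.Permutation.Setoid.Properties using (Unique-resp-↭)
open import Data.List.Relation.Binary.Pointwise as Pointwise using (Pointwise; Pointwise-length; []; _∷_)
open import Data.List.Relation.Unary.All as All using (All; []; _∷_)
open import Data.List.Relation.Unary.All.Properties using (++⁻ʳ; ++⁻ˡ; concat⁻; replicate⁺) renaming (++⁺ to All-++⁺)
open import Data.List.Relation.Unary.Any using (here; there)
open import Data.List.Relation.Unary.Unique.Propositional using (Unique; []; _∷_)
open import Data.List.Relation.Unary.Unique.Propositional.Properties using (allFin⁺; downFrom⁺) renaming (++⁺ to Unique-++⁺; map⁺ to Unique-map⁺)
open import Data.Maybe using (Maybe; just; nothing)
open import Data.Nat using (NonZero; _%_; _*_; _+_; _/_; _<?_; _<_; _∸_; _≡ᵇ_; _≤?_; _≤_; _≥_; suc; s≤s; s≤s⁻¹; zero; z≤n; ℕ)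
open import Data.Nat.DivMod using (%-distribˡ-+; +-distrib-/-∣ʳ; [m+kn]%n≡m%n; [m+n]%n≡m%n; m%n%n≡m%n; m%n<n; m*n%n≡0; m*n/n≡m; m/n*n≤m; m/n≤m; m<n⇒m%n≡m; m≡m%n+[m/n]*n)
open import Data.Nat.Divisibility using (n∣m*n)
open import Data.Nat.ListAction using (sum)
open import Data.Nat.ListAction.Properties using (sum-++; sum-↭)
open import Data.Nat.Properties using (*-assoc; *-cancelʳ-<; *-cancelʳ-≡; *-cancelʳ-≤; *-cancelˡ-≡; *-comm; *-distribʳ-+; +-assoc; +-cancelʳ-≡; +-cancelˡ-<; +-cancelˡ-≡; +-cancelˡ-≤; +-comm; +-identityʳ; +-mono-<; +-mono-≤; +-mono-≤-<; +-monoʳ-≤; +-suc; <-asym; <-cmp; <-irrefl; <-trans; <-≤-trans; <⇒≤; <⇒≱; _<?_; _≤?_; m+[n∸m]≡n; m+n∸m≡n; m<n⇒0<n∸m; m<n⇒m<1+n; m∸[m∸n]≡n; m∸n+n≡m; m∸n≡0⇒m≤n; m≤m+n; m≤n+m; m≤n⇒m<n∨m≡n; n≤0⇒n≡0; n≤1+n; n≮0; suc-injective; ∸-monoʳ-≤; ≡ᵇ⇒≡; ≤-<-trans; ≤-antisym; ≤-refl; ≤-reflexive; ≤-trans; ≮⇒≥; ≰⇒>) renaming (_≟_ to _≟ℕ_)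
open import Data.Nat.Tactic.RingSolver using (solve-∀)
open import Data.Product using (_,_; _×_; proj₁; proj₂; uncurry; Σ; ∃; ∃₂)
open import Data.Product.Properties using (≡-dec)
open import Data.Sum using (_⊎_; inj₁; inj₂)
open import Data.Unit using (tt)
open import Function using (Equivalence; _∘_)
open import Relation.Binary using (DecidableEquality)
open import Relation.Binary.Definitions using (Tri; tri<; tri>; tri≈)
open import Relation.Binary.PropositionalEquality using (_≡_; _≢_; cong; cong₂; refl; setoid; subst; subst₂; sym) renaming (trans to infixr 5 _⟫_)
open import Relation.Nullary using (does; no; yes)
open import Relation.Nullary.Decidable using (dec-false; dec-true)
open import Relation.Unary using (Decidable)

-- Edge and vertex lists are compared through test functions: two lists agree as multisets when
-- every weight (symmetric, for undirected edges) has the same sum over both. Decompositions thus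
-- become additive identities in `ℕ`, stable under doubling, relabelling and gluing, and
-- permutations are extracted only where needed. The obstacle is the ladder. A triangle closes it at
-- each end and one edge joins the two tips, so its columns form a cyclic sequence with one
-- irregular column, the apex column, and three 2-factors of one arbitrary type must close up around
-- it together. Returning to the same frontier costs every colour a multiple of four vertices, so
-- lengths congruent to 2 modulo 4 are placed in pairs. Three frontiers at which no cycle is open
-- suffice: `τ` if 4 occurs in the type, `κ` if all lengths are multiples of 4 from 8 on, `μ`
-- otherwise. Each has run frontiers crossed by open cycles, at which one more column lengthens the
-- cycle of every colour by 4. Hence finitely many gadgets, each verified by evaluating a Boolean,
-- handle all lengths.

private variable
  A B V : Set

-- Test functions and multisets

∑ : (A → ℕ) → List A → ℕ
∑ f []       = 0
∑ f (x ∷ xs) = f x + ∑ f xs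

∑-++ : (f : A → ℕ) (xs ys : List A) → ∑ f (xs ++ ys) ≡ ∑ f xs + ∑ f ys
∑-++ f []       ys = refl
∑-++ f (x ∷ xs) ys = cong (f x +_) (∑-++ f xs ys) ⟫ sym (+-assoc (f x) _ _)

∑-map : (f : B → ℕ) (h : A → B) (xs : List A) → ∑ f (map h xs) ≡ ∑ (f ∘ h) xs
∑-map f h []       = refl
∑-map f h (x ∷ xs) = cong (f (h x) +_) (∑-map f h xs)

∑-concat : (f : A → ℕ) (xss : List (List A)) → ∑ f (concat xss) ≡ ∑ (∑ f) xss
∑-concat f []         = refl
∑-concat f (xs ∷ xss) = ∑-++ f xs _ ⟫ cong (∑ f xs +_) (∑-concat f xss)

∑-concatMap : (f : B → ℕ) (h : A → List B) (xs : List A) → ∑ f (concatMap h xs) ≡ ∑ (λ x → ∑ f (h x)) xs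
∑-concatMap f h xs = ∑-concat f (map h xs) ⟫ ∑-map (∑ f) h xs

∑-cong : {f g : A → ℕ} → (∀ x → f x ≡ g x) → ∀ xs → ∑ f xs ≡ ∑ g xs
∑-cong e []       = refl
∑-cong e (x ∷ xs) = cong₂ _+_ (e x) (∑-cong e xs)

interchange : ∀ a b c d → (a + b) + (c + d) ≡ (a + c) + (b + d)
interchange = solve-∀

∑-+ : (f g : A → ℕ) (xs : List A) → ∑ (λ x → f x + g x) xs ≡ ∑ f xs + ∑ g xs
∑-+ f g []       = refl
∑-+ f g (x ∷ xs) = cong (f x + g x +_) (∑-+ f g xs) ⟫ interchange (f x) (g x) _ _

∑-↭ : (f : A → ℕ) {xs ys : List A} → xs ↭ ys → ∑ f xs ≡ ∑ f ys
∑-↭ f _↭_.refl         = refl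
∑-↭ f (prep x p)   = cong (f x +_) (∑-↭ f p)
∑-↭ f (swap {xs} {ys} x y p) = cong (λ z → f x + (f y + z)) (∑-↭ f p) ⟫ lem (f x) (f y) (∑ f ys)
  where
  lem : ∀ a b c → a + (b + c) ≡ b + (a + c)
  lem = solve-∀
∑-↭ f (_↭_.trans p q)  = ∑-↭ f p ⟫ ∑-↭ f q

∑-reverse : (f : A → ℕ) (xs : List A) → ∑ f (reverse xs) ≡ ∑ f xs
∑-reverse f []       = refl
∑-reverse f (x ∷ xs) = cong (∑ f) (unfold-reverse x xs) ⟫ ∑-++ f (reverse xs) [ x ]
  ⟫ cong₂ _+_ (∑-reverse f xs) (+-identityʳ (f x)) ⟫ +-comm _ (f x)

∑-one : (xs : List A) → ∑ (λ _ → 1) xs ≡ length xs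
∑-one []       = refl
∑-one (x ∷ xs) = cong suc (∑-one xs)

∈⇒↭ : {x : A} {ys : List A} → x ∈ ys → ∃ λ zs → ys ↭ x ∷ zs
∈⇒↭ {x = x} m with ∈-∃++ m
... | us , vs , refl = us ++ vs , shift x us vs

module _ (_≟_ : DecidableEquality A) where

  indicator : A → A → ℕ
  indicator x y with x ≟ y
  ... | yes _ = 1
  ... | no  _ = 0

  indicator-refl : ∀ x → indicator x x ≡ 1
  indicator-refl x with x ≟ x
  ... | yes _ = refl
  ... | no ¬p = ⊥-elim (¬p refl)

  ∑-indicator⇒∈ : ∀ x ys {k} → ∑ (indicator x) ys ≡ suc k → x ∈ ys
  ∑-indicator⇒∈ x (y ∷ ys) e with x ≟ y
  ... | yes p = here p
  ... | no  _ = there (∑-indicator⇒∈ x ys e)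

  -- Indicators suffice: the indicator of the head of `xs` has a positive sum over `ys`, which
  -- locates the head there, and cancelling it leaves the tails. The constant 1 excludes a nonempty
  -- `ys` against an empty `xs`. This is the way back from test functions to permutations.
  ∑⇒↭ : ∀ xs ys → (∀ g → ∑ g xs ≡ ∑ g ys) → xs ↭ ys
  ∑⇒↭ [] [] h = ↭-refl
  ∑⇒↭ [] (y ∷ ys) h with h (λ _ → 1)
  ... | ()
  ∑⇒↭ (x ∷ xs) ys h
    with ∈⇒↭ (∑-indicator⇒∈ x ys (sym (h (indicator x)) ⟫ cong (_+ ∑ (indicator x) xs) (indicator-refl x)))
  ... | zs , p = ↭-trans (prep x (∑⇒↭ xs zs λ g → +-cancelˡ-≡ (g x) _ _ (h g ⟫ ∑-↭ g p))) (↭-sym p)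

-- The pigeonhole principle, by which a covering becomes exact: taking the head of `K` out of `E`
-- preserves the inclusion because `K` has no repetition, and it preserves the inequality of
-- lengths.
unique-⊆⇒↭ : {K E : List A} → Unique K → (∀ {x} → x ∈ K → x ∈ E) → length E ≤ length K → K ↭ E
unique-⊆⇒↭ {K = []} {[]} u s l = ↭-refl
unique-⊆⇒↭ {K = x ∷ K} (x∉ ∷ u) s l with ∈⇒↭ (s (here refl))
... | E′ , p = ↭-trans (prep x (unique-⊆⇒↭ u s′ l′)) (↭-sym p)
  where
  l′ : length E′ ≤ length K
  l′ with subst (_≤ suc (length K)) (↭-length p) l
  ... | s≤s q = q
  s′ : ∀ {y} → y ∈ K → y ∈ E′
  s′ m with ∈-resp-↭ p (s (there m))
  ... | there q    = q
  ... | here  refl = ⊥-elim (All.lookup x∉ m refl)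

-- Weights of undirected paths, cycles and edge lists

Symmetric : (A → A → ℕ) → Set
Symmetric f = ∀ a b → f a b ≡ f b a

edgeSum : (A → A → ℕ) → List (A × A) → ℕ
edgeSum f = ∑ (uncurry f)

-- The ends are arguments and the list holds only the interior vertices: paths can be reversed and
-- spliced, and a cycle is the path from its first vertex back to it.
pathSum : (A → A → ℕ) → A → List A → A → ℕ
pathSum f u []       w = f u w
pathSum f u (x ∷ xs) w = f u x + pathSum f x xs w

cycleSum : (A → A → ℕ) → List A → ℕ
cycleSum f []       = 0
cycleSum f (x ∷ xs) = pathSum f x xs x

pathSum-++ : (f : A → A → ℕ) (u : A) (xs : List A) (y : A) (ys : List A) (w : A) →
             pathSum f u (xs ++ y ∷ ys) w ≡ pathSum f u xs y + pathSum f y ys w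
pathSum-++ f u []       y ys w = refl
pathSum-++ f u (x ∷ xs) y ys w = cong (f u x +_) (pathSum-++ f x xs y ys w) ⟫ sym (+-assoc (f u x) _ _)

pathSum-reverse : (f : A → A → ℕ) → Symmetric f → (u : A) (xs : List A) (w : A) →
                  pathSum f w (reverse xs) u ≡ pathSum f u xs w
pathSum-reverse f s u []       w = s w u
pathSum-reverse f s u (x ∷ xs) w = cong (λ l → pathSum f w l u) (unfold-reverse x xs)
  ⟫ pathSum-++ f w (reverse xs) x [] u
  ⟫ cong₂ _+_ (pathSum-reverse f s x xs w) (s x u) ⟫ +-comm _ (f u x)

pathSum-map : (f : B → B → ℕ) (h : A → B) (u : A) (xs : List A) (w : A) →
              pathSum f (h u) (map h xs) (h w) ≡ pathSum (λ a b → f (h a) (h b)) u xs w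
pathSum-map f h u []       w = refl
pathSum-map f h u (x ∷ xs) w = cong (f (h u) (h x) +_) (pathSum-map f h x xs w)

cycleSum-map : (f : B → B → ℕ) (h : A → B) (xs : List A) →
               cycleSum f (map h xs) ≡ cycleSum (λ a b → f (h a) (h b)) xs
cycleSum-map f h []       = refl
cycleSum-map f h (x ∷ xs) = pathSum-map f h x xs x

edgeSum-zip : (f : A → A → ℕ) (u : A) (xs : List A) (w : A) →
              edgeSum f (zip (u ∷ xs) (xs ++ [ w ])) ≡ pathSum f u xs w
edgeSum-zip f u []       w = +-identityʳ _
edgeSum-zip f u (x ∷ xs) w = cong (f u x +_) (edgeSum-zip f x xs w)

edgeSum-cycleEdges : ∀ {n} (f : _ → _ → ℕ) (C : Cycle n) → edgeSum f (cycleEdges C) ≡ cycleSum f C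
edgeSum-cycleEdges f []      = refl
edgeSum-cycleEdges f (x ∷ C) = edgeSum-zip f x C x

endpoints : List (A × A) → List A
endpoints = concatMap (λ e → proj₁ e ∷ proj₂ e ∷ [])

-- The edge list of the complete graph on the entries.
pairs : List A → List (A × A)
pairs []       = []
pairs (x ∷ xs) = map (x ,_) xs ++ pairs xs

edgeSum-pairs : (f : A → A → ℕ) (x : A) (xs : List A) →
                edgeSum f (pairs (x ∷ xs)) ≡ ∑ (f x) xs + edgeSum f (pairs xs)
edgeSum-pairs f x xs = ∑-++ (uncurry f) (map (x ,_) xs) _ ⟫ cong (_+ edgeSum f (pairs xs)) (∑-map (uncurry f) (x ,_) xs)

edgeSum-pairs-map : (f : B → B → ℕ) (h : A → B) (xs : List A) →
                    edgeSum f (pairs (map h xs)) ≡ edgeSum (λ a b → f (h a) (h b)) (pairs xs)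
edgeSum-pairs-map f h []       = refl
edgeSum-pairs-map f h (x ∷ xs) = edgeSum-pairs f (h x) (map h xs)
  ⟫ cong₂ _+_ (∑-map (f (h x)) h xs) (edgeSum-pairs-map f h xs)
  ⟫ sym (edgeSum-pairs (λ a b → f (h a) (h b)) x xs)

edgeSum-pairs-↭ : (f : A → A → ℕ) → Symmetric f → {xs ys : List A} → xs ↭ ys →
                  edgeSum f (pairs xs) ≡ edgeSum f (pairs ys)
edgeSum-pairs-↭ f s _↭_.refl       = refl
edgeSum-pairs-↭ f s (prep {xs} {ys} x p) = edgeSum-pairs f x xs
  ⟫ cong₂ _+_ (∑-↭ (f x) p) (edgeSum-pairs-↭ f s p) ⟫ sym (edgeSum-pairs f x ys)
edgeSum-pairs-↭ f s (swap {xs} {ys} x y p) = edgeSum-pairs f x (y ∷ xs)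
  ⟫ cong (f x y + ∑ (f x) xs +_) (edgeSum-pairs f y xs)
  ⟫ cong₂ _+_ (cong₂ _+_ (s x y) (∑-↭ (f x) p)) (cong₂ _+_ (∑-↭ (f y) p) (edgeSum-pairs-↭ f s p))
  ⟫ interchange (f y x) (∑ (f x) ys) (∑ (f y) ys) _
  ⟫ cong (f y x + ∑ (f y) ys +_) (sym (edgeSum-pairs f x ys))
  ⟫ sym (edgeSum-pairs f y (x ∷ ys))
edgeSum-pairs-↭ f s (_↭_.trans p q) = edgeSum-pairs-↭ f s p ⟫ edgeSum-pairs-↭ f s q

-- Gadgets for triples of 2-factors

data Colour : Set where
  red green blue : Colour

colours : List Colour
colours = red ∷ green ∷ blue ∷ []

tri : A → A → A → Colour → A
tri a b c red   = a
tri a b c green = b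
tri a b c blue  = c

-- The vertices of the i-th column are labelled 4i, …, 4i+3: the labels 4i and 4i+1 are the two
-- copies of one vertex of the cubic graph, and 4i+2 and 4i+3 the two copies of its partner.
-- The links say how a column is joined to the next one.
data Link : Set where
  rail into-apex from-apex : Link

-- Turns a label counted from the column behind the links into one counted from the column before
-- them.
ahead : List Link → ℕ → ℕ
ahead []       n = n
ahead (_ ∷ ls) n = 4 + ahead ls n

column : List (ℕ × ℕ)
column = (0 , 1) ∷ (2 , 3) ∷ (0 , 2) ∷ (0 , 3) ∷ (1 , 2) ∷ (1 , 3) ∷ []

-- A `rail` joins opposite places: the second vertex of a column with the first of the next one, and
-- the first with the second. This fits Walecki's ladder, where x stands beside -x and the rails
-- have sums 1 and -1. With `into-apex` both rails end at the first vertex of the next column, with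
-- `from-apex` both start at the second vertex of the present one.
gap : Link → List (ℕ × ℕ)
gap rail      = (2 , 4) ∷ (2 , 5) ∷ (3 , 4) ∷ (3 , 5) ∷ (0 , 6) ∷ (0 , 7) ∷ (1 , 6) ∷ (1 , 7) ∷ []
gap into-apex = (2 , 4) ∷ (2 , 5) ∷ (3 , 4) ∷ (3 , 5) ∷ (0 , 4) ∷ (0 , 5) ∷ (1 , 4) ∷ (1 , 5) ∷ []
gap from-apex = (2 , 4) ∷ (2 , 5) ∷ (3 , 4) ∷ (3 , 5) ∷ (2 , 6) ∷ (2 , 7) ∷ (3 , 6) ∷ (3 , 7) ∷ []

aheadᴱ : List Link → ℕ × ℕ → ℕ × ℕ
aheadᴱ ls (a , b) = ahead ls a , ahead ls b

region : List Link → List (ℕ × ℕ)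
region []       = []
region (l ∷ ls) = column ++ gap l ++ map (aheadᴱ [ l ]) (region ls)

corners : List Link → List ℕ
corners []       = []
corners (l ∷ ls) = 0 ∷ 1 ∷ 2 ∷ 3 ∷ map (ahead [ l ]) (corners ls)

-- The frontier between a finished part (to the left of and including part of a column) and the
-- rest: the edges of the column and, for each colour and for the matching, the vertices of the
-- column that belong to the finished part.  Where cycles run across the frontier, `ends` lists
-- the pairs of ends of the paths missing from the finished part, and `excess` fixes how the
-- total lengths of these paths differ between the colours.
record Frontier : Set where
  field
    done   : List (ℕ × ℕ)
    seen   : Colour → List ℕ
    seenᴹ  : List ℕ
    ends   : Colour → List (ℕ × ℕ)
    excess : Colour → ℕ

open Frontier public

nth : A → List A → ℕ → A
nth d []       _       = d
nth d (x ∷ xs) zero    = x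
nth d (x ∷ xs) (suc n) = nth d xs n

indices : List A → List ℕ
indices []       = []
indices (x ∷ xs) = 0 ∷ map suc (indices xs)

end : Frontier → Colour → ℕ → ℕ × ℕ
end s X = nth (0 , 0) (ends s X)

gaps : Frontier → Colour → List ℕ
gaps s X = indices (ends s X)

-- All edges and vertices from frontier s at column 0 up to frontier e beyond ls are used up.
record Tiling (s e : Frontier) (ls : List Link) (ρ : ℕ → V) (x : ℕ) (Ts : List ℕ) : Set where
  field
    cycles   : Colour → List (List V)
    fill     : Colour → ℕ → List V
    matching : List (V × V)

  fillSum : (V → V → ℕ) → Colour → ℕ → ℕ
  fillSum f X j = pathSum f (ρ (proj₁ (end s X j))) (fill X j) (ρ (proj₂ (end s X j)))

  field
    edges  : ∀ f → Symmetric f →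
             (∑ (λ X → ∑ (cycleSum f) (cycles X) + ∑ (fillSum f X) (gaps s X)) colours + edgeSum f matching)
               + edgeSum (λ a b → f (ρ a) (ρ b)) (done s)
             ≡ edgeSum (λ a b → f (ρ a) (ρ b)) (region ls)
               + edgeSum (λ a b → f (ρ (ahead ls a)) (ρ (ahead ls b))) (done e)
    verts  : ∀ X g → (∑ (∑ g) (cycles X) + ∑ (λ j → ∑ g (fill X j)) (gaps s X)) + ∑ (g ∘ ρ) (seen s X)
             ≡ ∑ (g ∘ ρ) (corners ls) + ∑ (g ∘ ρ ∘ ahead ls) (seen e X)
    vertsᴹ : ∀ g → ∑ g (endpoints matching) + ∑ (g ∘ ρ) (seenᴹ s)
             ≡ ∑ (g ∘ ρ) (corners ls) + ∑ (g ∘ ρ ∘ ahead ls) (seenᴹ e)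
    lens   : ∀ X → map length (cycles X) ≡ Ts
    total  : ∀ X → ∑ (λ j → length (fill X j)) (gaps s X) ≡ excess s X + x

-- A path of a gadget goes along edges or across one of the missing paths, in either direction.
data Step : Set where
  to        : ℕ → Step
  thru back : ℕ → Step

-- Checking gadgets by computation

data Atom : Set where
  edge : ℕ → ℕ → Atom
  node : ℕ → Atom
  hole : Colour → ℕ → Atom

isColour : Colour → Colour → Bool
isColour red   red   = true
isColour green green = true
isColour blue  blue  = true
isColour _     _     = false

isColour⇒≡ : ∀ X Y → T (isColour X Y) → X ≡ Y
isColour⇒≡ red   red   _ = refl
isColour⇒≡ green green _ = refl
isColour⇒≡ blue  blue  _ = refl

match : Atom → Atom → Bool
match (edge a b) (edge c d) = ((a ≡ᵇ c) ∧ (b ≡ᵇ d)) ∨ ((a ≡ᵇ d) ∧ (b ≡ᵇ c))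
match (node a)   (node b)   = a ≡ᵇ b
match (hole X i) (hole Y j) = isColour X Y ∧ (i ≡ᵇ j)
match _          _          = false

remove : Atom → List Atom → Maybe (List Atom)
remove x []       = nothing
remove x (y ∷ ys) with match x y | remove x ys
... | true  | _        = just ys
... | false | just zs  = just (y ∷ zs)
... | false | nothing  = nothing

same : List Atom → List Atom → Bool
same []       []      = true
same []       (_ ∷ _) = false
same (x ∷ xs) ys with remove x ys
... | just zs = same xs zs
... | nothing = false

module _ (F : Atom → ℕ) (F-sym : ∀ a b → F (edge a b) ≡ F (edge b a)) where

  both : ∀ {p q} → T (p ∧ q) → T p × T q
  both = Equivalence.to T-∧

  match-sound : ∀ x y → T (match x y) → F x ≡ F y
  match-sound (edge a b) (edge c d) t with Equivalence.to T-∨ t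
  ... | inj₁ u with both {a ≡ᵇ c} u
  ...   | p , q = cong₂ (λ x y → F (edge x y)) (≡ᵇ⇒≡ a c p) (≡ᵇ⇒≡ b d q)
  match-sound (edge a b) (edge c d) t | inj₂ u with both {a ≡ᵇ d} u
  ...   | p , q = cong₂ (λ x y → F (edge x y)) (≡ᵇ⇒≡ a d p) (≡ᵇ⇒≡ b c q) ⟫ F-sym d c
  match-sound (node a) (node b) t = cong (F ∘ node) (≡ᵇ⇒≡ a b t)
  match-sound (hole X i) (hole Y j) t with both {isColour X Y} t
  ... | p , q = cong₂ (λ x y → F (hole x y)) (isColour⇒≡ X Y p) (≡ᵇ⇒≡ i j q)

  remove-sound : ∀ x ys {zs} → remove x ys ≡ just zs → ∑ F ys ≡ F x + ∑ F zs
  remove-sound x (y ∷ ys) e with match x y in eq | remove x ys in eq′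
  remove-sound x (y ∷ ys) refl | true  | _ = cong (_+ ∑ F ys) (sym (match-sound x y (subst T (sym eq) tt)))
  remove-sound x (y ∷ ys) refl | false | just zs =
    cong (F y +_) (remove-sound x ys eq′) ⟫ lem (F y) (F x) (∑ F zs)
    where
    lem : ∀ a b c → a + (b + c) ≡ b + (a + c)
    lem = solve-∀

  -- One evaluation of `same` serves every valuation `F` of the atoms. Edge weights, vertex weights
  -- and lengths are the valuations used later; a missing path is a single unknown atom in each of
  -- them.
  same-sound : ∀ xs ys → T (same xs ys) → ∑ F xs ≡ ∑ F ys
  same-sound []       []       t = refl
  same-sound (x ∷ xs) ys t with remove x ys in eq
  ... | just zs = cong (F x +_) (same-sound xs zs t) ⟫ sym (remove-sound x ys eq)

-- What lies between two frontiers: `loops` are the cycles closed here and `paths` supply the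
-- missing paths of `s`. Both may run across the missing paths of `t`, which stay unknown.
record Gadget (s t : Frontier) : Set where
  field
    links  : List Link
    loops  : Colour → List (ℕ × List Step)
    paths  : Colour → List (List Step)
    pairing : List (ℕ × ℕ)
    -- the common lengths of the loops; true marks a loop that runs across all missing paths
    -- of its colour, whose lengths are then to be added
    sizes  : List (ℕ × Bool)
    growth : ℕ × Bool

  leap : Colour → ℕ → ℕ × ℕ
  leap X j = aheadᴱ links (end t X j)

  fits : Colour → ℕ → List Step → Bool
  fits X u []            = true
  fits X u (to a ∷ ss)   = fits X a ss
  fits X u (thru j ∷ ss) = (u ≡ᵇ proj₁ (leap X j)) ∧ fits X (proj₂ (leap X j)) ss
  fits X u (back j ∷ ss) = (u ≡ᵇ proj₂ (leap X j)) ∧ fits X (proj₁ (leap X j)) ss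

  -- The weight of a `hole` contains the edges at both of its ends, so no edge is recorded on
  -- entering or leaving it; `fits` ensures that it is entered at one of these ends.
  trail : Colour → ℕ → List Step → ℕ → List Atom
  trail X u []            w = edge u w ∷ []
  trail X u (to a ∷ ss)   w = edge u a ∷ trail X a ss w
  trail X u (thru j ∷ ss) w = hole X j ∷ trail X (proj₂ (leap X j)) ss w
  trail X u (back j ∷ ss) w = hole X j ∷ trail X (proj₁ (leap X j)) ss w

  -- Vertices are recorded on arrival, so the start is left out. The far end of a hole is listed
  -- separately because a fill holds interior vertices only.
  stops : Colour → List Step → List Atom
  stops X []            = []
  stops X (to a ∷ ss)   = node a ∷ stops X ss
  stops X (thru j ∷ ss) = hole X j ∷ node (proj₂ (leap X j)) ∷ stops X ss
  stops X (back j ∷ ss) = hole X j ∷ node (proj₁ (leap X j)) ∷ stops X ss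

  forget : Atom → Atom
  forget (node a) = node 0
  forget x        = x

  path : Colour → ℕ → List Step
  path X = nth [] (paths X)

  pathTrail : Colour → ℕ → List Atom
  pathTrail X j = trail X (proj₁ (end s X j)) (path X j) (proj₂ (end s X j))

  loopTrail loopStops : Colour → ℕ × List Step → List Atom
  loopTrail X (v , ss) = trail X v ss v
  loopStops X (v , ss) = node v ∷ stops X ss

  holes : Colour → List Atom
  holes X = map (hole X) (gaps t X)

  edgeAtoms : List (ℕ × ℕ) → List Atom
  edgeAtoms = map (uncurry edge)

  edgesOK : Bool
  edgesOK = same (concatMap (λ X → concatMap (loopTrail X) (loops X) ++ concatMap (pathTrail X) (gaps s X)) colours
                   ++ edgeAtoms pairing ++ edgeAtoms (done s))
                 (concatMap holes colours ++ edgeAtoms (region links) ++ edgeAtoms (map (aheadᴱ links) (done t)))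

  vertsOK : Colour → Bool
  vertsOK X = same (concatMap (loopStops X) (loops X) ++ concatMap (stops X ∘ path X) (gaps s X) ++ map node (seen s X))
                   (holes X ++ map node (corners links) ++ map node (map (ahead links) (seen t X)))

  vertsOKᴹ : Bool
  vertsOKᴹ = same (map node (endpoints pairing) ++ map node (seenᴹ s))
                  (map node (corners links) ++ map node (map (ahead links) (seenᴹ t)))

  loopsFit : Colour → List (ℕ × List Step) → Bool
  loopsFit X []             = true
  loopsFit X ((v , ss) ∷ l) = fits X v ss ∧ loopsFit X l

  pathsFit : Colour → List ℕ → Bool
  pathsFit X []       = true
  pathsFit X (j ∷ js) = fits X (proj₁ (end s X j)) (path X j) ∧ pathsFit X js

  ticks : ℕ → List Atom
  ticks n = replicate n (node 0)

  -- In the second case the holes of colour `X` have total length `excess t X + x`. The ticks added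
  -- on the left cancel this excess, so that one `n` serves all three colours although they place
  -- different numbers of vertices of their own.
  sizeOK : Colour → ℕ × Bool → List Atom → Bool
  sizeOK X (n , false) as = same (map forget as) (ticks n)
  sizeOK X (n , true)  as = same (ticks (excess t X) ++ map forget as) (ticks n ++ holes X)

  sizesOK : Colour → List (ℕ × List Step) → List (ℕ × Bool) → Bool
  sizesOK X []      []       = true
  sizesOK X (l ∷ ls) (z ∷ zs) = sizeOK X z (loopStops X l) ∧ sizesOK X ls zs
  sizesOK X _       _        = false

  growthOK : Colour → Bool
  growthOK X = sizeOK X (excess s X + proj₁ growth , proj₂ growth) (concatMap (stops X ∘ path X) (gaps s X))

  colourOK : Colour → Bool
  colourOK X = vertsOK X ∧ loopsFit X (loops X) ∧ pathsFit X (gaps s X) ∧ sizesOK X (loops X) sizes ∧ growthOK X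

  valid : Bool
  valid = edgesOK ∧ vertsOKᴹ ∧ colourOK red ∧ colourOK green ∧ colourOK blue

  lengthen : ℕ → ℕ × Bool → ℕ
  lengthen x (n , b) = n + (if b then x else 0)

  module Sound {V : Set} {e : Frontier} {ls : List Link} {ρ : ℕ → V} {x : ℕ} {Ts : List ℕ}
               (ok : T valid) (old : Tiling t e ls (ρ ∘ ahead links) x Ts) where

    module O = Tiling old

    expand : Colour → List Step → List V
    expand X []            = []
    expand X (to a ∷ ss)   = ρ a ∷ expand X ss
    expand X (thru j ∷ ss) = O.fill X j ++ ρ (proj₂ (leap X j)) ∷ expand X ss
    expand X (back j ∷ ss) = reverse (O.fill X j) ++ ρ (proj₁ (leap X j)) ∷ expand X ss

    loop : Colour → ℕ × List Step → List V
    loop X (v , ss) = ρ v ∷ expand X ss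

    okE : T edgesOK
    okE = proj₁ (Equivalence.to T-∧ ok)
    okM : T vertsOKᴹ
    okM = proj₁ (Equivalence.to T-∧ (proj₂ (Equivalence.to (T-∧ {edgesOK}) ok)))

    okX : ∀ X → T (colourOK X)
    okX X with Equivalence.to (T-∧ {vertsOKᴹ}) (proj₂ (Equivalence.to (T-∧ {edgesOK}) ok))
    ... | _ , r with Equivalence.to (T-∧ {colourOK red}) r
    okX red   | _ , r | p , _ = p
    okX green | _ , r | _ , q = proj₁ (Equivalence.to T-∧ q)
    okX blue  | _ , r | _ , q = proj₂ (Equivalence.to (T-∧ {colourOK green}) q)

    okV : ∀ X → T (vertsOK X)
    okV X = proj₁ (Equivalence.to T-∧ (okX X))
    okL : ∀ X → T (loopsFit X (loops X))
    okL X = proj₁ (Equivalence.to T-∧ (proj₂ (Equivalence.to (T-∧ {vertsOK X}) (okX X))))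
    ok₃ : ∀ X → T (pathsFit X (gaps s X) ∧ sizesOK X (loops X) sizes ∧ growthOK X)
    ok₃ X = proj₂ (Equivalence.to (T-∧ {loopsFit X (loops X)}) (proj₂ (Equivalence.to (T-∧ {vertsOK X}) (okX X))))
    okP : ∀ X → T (pathsFit X (gaps s X))
    okP X = proj₁ (Equivalence.to T-∧ (ok₃ X))
    okS : ∀ X → T (sizesOK X (loops X) sizes)
    okS X = proj₁ (Equivalence.to T-∧ (proj₂ (Equivalence.to (T-∧ {pathsFit X (gaps s X)}) (ok₃ X))))
    okG : ∀ X → T (growthOK X)
    okG X = proj₂ (Equivalence.to (T-∧ {sizesOK X (loops X) sizes}) (proj₂ (Equivalence.to (T-∧ {pathsFit X (gaps s X)}) (ok₃ X))))

    module _ (f : V → V → ℕ) (f-sym : Symmetric f) where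

      F : Atom → ℕ
      F (edge a b) = f (ρ a) (ρ b)
      F (node a)   = 0
      F (hole X j) = O.fillSum f X j

      trail-sum : ∀ X u ss w → T (fits X u ss) → pathSum f (ρ u) (expand X ss) (ρ w) ≡ ∑ F (trail X u ss w)
      trail-sum X u []            w p = sym (+-identityʳ _)
      trail-sum X u (to a ∷ ss)   w p = cong (f (ρ u) (ρ a) +_) (trail-sum X a ss w p)
      trail-sum X u (thru j ∷ ss) w p with Equivalence.to (T-∧ {u ≡ᵇ proj₁ (leap X j)}) p
      ... | q , r = pathSum-++ f (ρ u) (O.fill X j) (ρ (proj₂ (leap X j))) (expand X ss) (ρ w)
        ⟫ cong₂ _+_ (cong (λ z → pathSum f (ρ z) (O.fill X j) (ρ (proj₂ (leap X j)))) (≡ᵇ⇒≡ u _ q))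
                    (trail-sum X (proj₂ (leap X j)) ss w r)
      trail-sum X u (back j ∷ ss) w p with Equivalence.to (T-∧ {u ≡ᵇ proj₂ (leap X j)}) p
      ... | q , r = pathSum-++ f (ρ u) (reverse (O.fill X j)) (ρ (proj₁ (leap X j))) (expand X ss) (ρ w)
        ⟫ cong₂ _+_ (cong (λ z → pathSum f (ρ z) (reverse (O.fill X j)) (ρ (proj₁ (leap X j)))) (≡ᵇ⇒≡ u _ q)
                     ⟫ pathSum-reverse f f-sym _ (O.fill X j) _)
                    (trail-sum X (proj₁ (leap X j)) ss w r)

      loops-sum : ∀ X l → T (loopsFit X l) → ∑ (cycleSum f) (map (loop X) l) ≡ ∑ F (concatMap (loopTrail X) l)
      loops-sum X []             p = refl
      loops-sum X ((v , ss) ∷ l) p with Equivalence.to (T-∧ {fits X v ss}) p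
      ... | q , r = cong₂ _+_ (trail-sum X v ss v q) (loops-sum X l r)
        ⟫ sym (∑-++ F (trail X v ss v) (concatMap (loopTrail X) l))

      paths-sum : ∀ X js → T (pathsFit X js) →
        ∑ (λ j → pathSum f (ρ (proj₁ (end s X j))) (expand X (path X j)) (ρ (proj₂ (end s X j)))) js
        ≡ ∑ F (concatMap (pathTrail X) js)
      paths-sum X []       p = refl
      paths-sum X (j ∷ js) p with Equivalence.to (T-∧ {fits X (proj₁ (end s X j)) (path X j)}) p
      ... | q , r = cong₂ _+_ (trail-sum X _ (path X j) _ q) (paths-sum X js r)
        ⟫ sym (∑-++ F (pathTrail X j) (concatMap (pathTrail X) js))

    module _ (g : V → ℕ) where

      G : Atom → ℕ
      G (edge a b) = 0
      G (node a)   = g (ρ a)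
      G (hole X j) = ∑ g (O.fill X j)

      stops-sum : ∀ X ss → ∑ g (expand X ss) ≡ ∑ G (stops X ss)
      stops-sum X []            = refl
      stops-sum X (to a ∷ ss)   = cong (g (ρ a) +_) (stops-sum X ss)
      stops-sum X (thru j ∷ ss) = ∑-++ g (O.fill X j) _ ⟫ cong (λ z → ∑ g (O.fill X j) + (g _ + z)) (stops-sum X ss)
      stops-sum X (back j ∷ ss) = ∑-++ g (reverse (O.fill X j)) _
        ⟫ cong₂ _+_ (∑-reverse g (O.fill X j)) (cong (g _ +_) (stops-sum X ss))

      loops-nodes : ∀ X l → ∑ (∑ g) (map (loop X) l) ≡ ∑ G (concatMap (loopStops X) l)
      loops-nodes X l = ∑-map (∑ g) (loop X) l
        ⟫ ∑-cong (λ { (v , ss) → cong (g (ρ v) +_) (stops-sum X ss) }) l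
        ⟫ sym (∑-concatMap G (loopStops X) l)

      paths-nodes : ∀ X js → ∑ (λ j → ∑ g (expand X (path X j))) js ≡ ∑ G (concatMap (stops X ∘ path X) js)
      paths-nodes X js = ∑-cong (λ j → stops-sum X (path X j)) js ⟫ sym (∑-concatMap G (stops X ∘ path X) js)

      holes-nodes : ∀ X → ∑ G (holes X) ≡ ∑ (λ j → ∑ g (O.fill X j)) (gaps t X)
      holes-nodes X = ∑-map G (hole X) (gaps t X)

      nodes : ∀ l → ∑ G (map node l) ≡ ∑ (g ∘ ρ) l
      nodes l = ∑-map G node l

    edgeSum-atoms : ∀ f (f-sym : Symmetric f) l → ∑ (F f f-sym) (edgeAtoms l) ≡ edgeSum (λ a b → f (ρ a) (ρ b)) l
    edgeSum-atoms f f-sym []            = refl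
    edgeSum-atoms f f-sym ((a , b) ∷ l) = cong (f (ρ a) (ρ b) +_) (edgeSum-atoms f f-sym l)

    count : Atom → ℕ
    count (edge a b) = 0
    count (node a)   = 1
    count (hole X j) = length (O.fill X j)

    count-forget : ∀ as → ∑ count (map forget as) ≡ ∑ count as
    count-forget []              = refl
    count-forget (edge a b ∷ as) = count-forget as
    count-forget (node a ∷ as)   = cong suc (count-forget as)
    count-forget (hole X j ∷ as) = cong (length (O.fill X j) +_) (count-forget as)

    count-ticks : ∀ n → ∑ count (ticks n) ≡ n
    count-ticks zero    = refl
    count-ticks (suc n) = cong suc (count-ticks n)

    G≡count : ∀ as → ∑ (G (λ _ → 1)) as ≡ ∑ count as
    G≡count = ∑-cong λ { (edge a b) → refl ; (node a) → refl ; (hole X j) → ∑-one (O.fill X j) }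

    size-sound : ∀ X z as → T (sizeOK X z as) → ∑ count as ≡ lengthen x z
    size-sound X (n , false) as p = sym (count-forget as)
      ⟫ same-sound count (λ _ _ → refl) (map forget as) (ticks n) p ⟫ count-ticks n ⟫ sym (+-identityʳ n)
    size-sound X (n , true) as p = +-cancelˡ-≡ (excess t X) _ _
      (cong₂ _+_ (sym (count-ticks (excess t X))) (sym (count-forget as))
       ⟫ sym (∑-++ count (ticks (excess t X)) (map forget as))
       ⟫ same-sound count (λ _ _ → refl) (ticks (excess t X) ++ map forget as) (ticks n ++ holes X) p
       ⟫ ∑-++ count (ticks n) (holes X)
       ⟫ cong₂ _+_ (count-ticks n) (∑-map count (hole X) (gaps t X) ⟫ O.total X)
       ⟫ lem n (excess t X) x)
      where
      lem : ∀ a b c → a + (b + c) ≡ b + (a + c)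
      lem = solve-∀

    length-expand : ∀ X ss → length (expand X ss) ≡ ∑ count (stops X ss)
    length-expand X ss = sym (∑-one (expand X ss)) ⟫ stops-sum (λ _ → 1) X ss ⟫ G≡count (stops X ss)

    sizes-sound : ∀ X l zs → T (sizesOK X l zs) → map length (map (loop X) l) ≡ map (lengthen x) zs
    sizes-sound X []             []       p = refl
    sizes-sound X ((v , ss) ∷ l) (z ∷ zs) p with Equivalence.to (T-∧ {sizeOK X z (loopStops X (v , ss))}) p
    ... | q , r = cong₂ _∷_ (cong suc (length-expand X ss) ⟫ size-sound X z (loopStops X (v , ss)) q) (sizes-sound X l zs r)

    edgeSum-ahead : ∀ (f : V → V → ℕ) k l → edgeSum (λ a b → f (ρ a) (ρ b)) (map (aheadᴱ k) l)
                  ≡ edgeSum (λ a b → f (ρ (ahead k a)) (ρ (ahead k b))) l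
    edgeSum-ahead f k l = ∑-map _ (aheadᴱ k) l

  ahead-++ : ∀ k ls n → ahead (k ++ ls) n ≡ ahead k (ahead ls n)
  ahead-++ []      ls n = refl
  ahead-++ (_ ∷ k) ls n = cong (4 +_) (ahead-++ k ls n)

region-++ : (f : V → V → ℕ) (ρ : ℕ → V) (k ls : List Link) →
            edgeSum (λ a b → f (ρ a) (ρ b)) (region (k ++ ls))
            ≡ edgeSum (λ a b → f (ρ a) (ρ b)) (region k)
              + edgeSum (λ a b → f (ρ (ahead k a)) (ρ (ahead k b))) (region ls)
region-++ f ρ []      ls = refl
region-++ f ρ (l ∷ k) ls =
    ∑-++ φ column (gap l ++ map (aheadᴱ [ l ]) (region (k ++ ls)))
  ⟫ cong (∑ φ column +_) (∑-++ φ (gap l) (map (aheadᴱ [ l ]) (region (k ++ ls)))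
      ⟫ cong (∑ φ (gap l) +_) (∑-map φ (aheadᴱ [ l ]) (region (k ++ ls)) ⟫ region-++ f (ρ ∘ ahead [ l ]) k ls))
  ⟫ lem (∑ φ column) (∑ φ (gap l)) _ _
  ⟫ cong (_+ edgeSum (λ a b → f (ρ (ahead (l ∷ k) a)) (ρ (ahead (l ∷ k) b))) (region ls))
     (sym (∑-++ φ column (gap l ++ map (aheadᴱ [ l ]) (region k))
       ⟫ cong (∑ φ column +_) (∑-++ φ (gap l) (map (aheadᴱ [ l ]) (region k))
         ⟫ cong (∑ φ (gap l) +_) (∑-map φ (aheadᴱ [ l ]) (region k)))))
  where
  φ : ℕ × ℕ → ℕ
  φ = uncurry (λ a b → f (ρ a) (ρ b))
  lem : ∀ a b c d → a + (b + (c + d)) ≡ (a + (b + c)) + d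
  lem = solve-∀

corners-++ : (g : V → ℕ) (ρ : ℕ → V) (k ls : List Link) →
             ∑ (g ∘ ρ) (corners (k ++ ls)) ≡ ∑ (g ∘ ρ) (corners k) + ∑ (g ∘ ρ ∘ ahead k) (corners ls)
corners-++ g ρ []      ls = refl
corners-++ g ρ (l ∷ k) ls =
  cong (λ z → g (ρ 0) + (g (ρ 1) + (g (ρ 2) + (g (ρ 3) + z))))
    (∑-map (g ∘ ρ) (ahead [ l ]) (corners (k ++ ls)) ⟫ corners-++ g (ρ ∘ ahead [ l ]) k ls
     ⟫ cong (_+ ∑ (g ∘ ρ ∘ ahead (l ∷ k)) (corners ls)) (sym (∑-map (g ∘ ρ) (ahead [ l ]) (corners k))))
  ⟫ lem (g (ρ 0)) (g (ρ 1)) (g (ρ 2)) (g (ρ 3)) _ _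
  where
  lem : ∀ a b c d e h → a + (b + (c + (d + (e + h)))) ≡ (a + (b + (c + (d + e)))) + h
  lem = solve-∀

module _ {s t : Frontier} (𝒢 : Gadget s t) where
  open Gadget 𝒢

  -- The identities certified by `valid` and those of the old tiling are added. The terms at the
  -- seam, namely the missing paths, `done t` and the vertices seen in `t`, then occur on both sides
  -- and cancel. All corrections are written as additions, since the sums are natural numbers.
  prepend : {V : Set} {e : Frontier} {ls : List Link} {ρ : ℕ → V} {x : ℕ} {Ts : List ℕ} → T valid →
            Tiling t e ls (ρ ∘ ahead links) x Ts →
            Tiling s e (links ++ ls) ρ (lengthen x growth) (map (lengthen x) sizes ++ Ts)
  prepend {V} {e} {ls} {ρ} {x} {Ts} ok old = record
    { cycles   = λ X → map (loop X) (loops X) ++ O.cycles X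
    ; fill     = λ X j → expand X (path X j)
    ; matching = map (λ (a , b) → ρ a , ρ b) pairing ++ O.matching
    ; edges    = new-edges
    ; verts    = new-verts
    ; vertsᴹ   = new-vertsᴹ
    ; lens     = λ X → map-++ length (map (loop X) (loops X)) (O.cycles X)
                   ⟫ cong₂ _++_ (sizes-sound X (loops X) sizes (okS X)) (O.lens X)
    ; total    = new-total
    }
    where
    open Sound {V} {e} {ls} {ρ} {x} {Ts} ok old

    new-total : ∀ X → ∑ (λ j → length (expand X (path X j))) (gaps s X) ≡ excess s X + lengthen x growth
    new-total X = ∑-cong (λ j → length-expand X (path X j)) (gaps s X)
      ⟫ sym (∑-concatMap count (stops X ∘ path X) (gaps s X))
      ⟫ size-sound X (excess s X + proj₁ growth , proj₂ growth) (concatMap (stops X ∘ path X) (gaps s X)) (okG X)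
      ⟫ +-assoc (excess s X) (proj₁ growth) _

    new-verts : ∀ X g → (∑ (∑ g) (map (loop X) (loops X) ++ O.cycles X) + ∑ (λ j → ∑ g (expand X (path X j))) (gaps s X))
                          + ∑ (g ∘ ρ) (seen s X)
                      ≡ ∑ (g ∘ ρ) (corners (links ++ ls)) + ∑ (g ∘ ρ ∘ ahead (links ++ ls)) (seen e X)
    new-verts X g =
      cong (λ z → (z + ∑ (λ j → ∑ g (expand X (path X j))) (gaps s X)) + ∑ (g ∘ ρ) (seen s X))
        (∑-++ (∑ g) (map (loop X) (loops X)) (O.cycles X))
      ⟫ arith (∑ (∑ g) (map (loop X) (loops X))) (∑ (λ j → ∑ g (expand X (path X j))) (gaps s X)) (∑ (g ∘ ρ) (seen s X))
          (∑ (λ j → ∑ g (O.fill X j)) (gaps t X)) (∑ (g ∘ ρ) (corners links)) (∑ (g ∘ ρ ∘ ahead links) (seen t X))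
          (∑ (∑ g) (O.cycles X)) (∑ (g ∘ ρ ∘ ahead links) (corners ls)) (∑ (g ∘ ρ ∘ ahead links ∘ ahead ls) (seen e X))
          (cong₂ _+_ (cong₂ _+_ (loops-nodes g X (loops X)) (paths-nodes g X (gaps s X))) (sym (nodes g (seen s X)))
           ⟫ +-assoc (∑ γ ls₁) (∑ γ ls₂) (∑ γ ls₃)
           ⟫ cong (∑ γ ls₁ +_) (sym (∑-++ γ ls₂ ls₃)) ⟫ sym (∑-++ γ ls₁ (ls₂ ++ ls₃))
           ⟫ same-sound γ (λ _ _ → refl) (ls₁ ++ ls₂ ++ ls₃) (holes X ++ map node (corners links) ++ map node (map (ahead links) (seen t X))) (okV X)
           ⟫ ∑-++ γ (holes X) _ ⟫ cong₂ _+_ (holes-nodes g X) (∑-++ γ (map node (corners links)) _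
             ⟫ cong₂ _+_ (nodes g (corners links)) (nodes g (map (ahead links) (seen t X)) ⟫ ∑-map (g ∘ ρ) (ahead links) (seen t X))))
          (O.verts X g)
      ⟫ cong₂ _+_ (sym (corners-++ g ρ links ls))
          (∑-cong (λ n → cong (g ∘ ρ) (sym (ahead-++ links ls n))) (seen e X))
      where
      γ = G g
      ls₁ = concatMap (loopStops X) (loops X)
      ls₂ = concatMap (stops X ∘ path X) (gaps s X)
      ls₃ = map node (seen s X)
      arith : ∀ l p r h c r′ q c′ r″ → (l + p) + r ≡ h + (c + r′) → (q + h) + r′ ≡ c′ + r″ →
              ((l + q) + p) + r ≡ (c + c′) + r″
      arith l p r h c r′ q c′ r″ e₁ e₂ = +-cancelʳ-≡ (h + r′) _ _
        (k₁ l q p r h r′ ⟫ cong₂ _+_ e₁ e₂ ⟫ k₂ h c r′ c′ r″)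
        where
        k₁ : ∀ l q p r h r′ → (((l + q) + p) + r) + (h + r′) ≡ ((l + p) + r) + ((q + h) + r′)
        k₁ = solve-∀
        k₂ : ∀ h c r′ c′ r″ → (h + (c + r′)) + (c′ + r″) ≡ ((c + c′) + r″) + (h + r′)
        k₂ = solve-∀

    endpoints-map : ∀ g (l : List (ℕ × ℕ)) → ∑ g (endpoints (map (λ (a , b) → ρ a , ρ b) l)) ≡ ∑ (g ∘ ρ) (endpoints l)
    endpoints-map g []      = refl
    endpoints-map g ((a , b) ∷ l) = cong (λ z → g (ρ a) + (g (ρ b) + z)) (endpoints-map g l)

    endpoints-++ : ∀ g (l m : List (V × V)) → ∑ g (endpoints (l ++ m)) ≡ ∑ g (endpoints l) + ∑ g (endpoints m)
    endpoints-++ g l m = ∑-concatMap g _ (l ++ m) ⟫ ∑-++ _ l m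
      ⟫ cong₂ _+_ (sym (∑-concatMap g _ l)) (sym (∑-concatMap g _ m))

    new-vertsᴹ : ∀ g → ∑ g (endpoints (map (λ (a , b) → ρ a , ρ b) pairing ++ O.matching)) + ∑ (g ∘ ρ) (seenᴹ s)
                     ≡ ∑ (g ∘ ρ) (corners (links ++ ls)) + ∑ (g ∘ ρ ∘ ahead (links ++ ls)) (seenᴹ e)
    new-vertsᴹ g =
      cong (_+ ∑ (g ∘ ρ) (seenᴹ s)) (endpoints-++ g (map (λ (a , b) → ρ a , ρ b) pairing) O.matching ⟫ cong (_+ ∑ g (endpoints O.matching)) (endpoints-map g pairing))
      ⟫ arith (∑ (g ∘ ρ) (endpoints pairing)) (∑ (g ∘ ρ) (seenᴹ s)) (∑ (g ∘ ρ) (corners links))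
          (∑ (g ∘ ρ ∘ ahead links) (seenᴹ t)) (∑ g (endpoints O.matching))
          (∑ (g ∘ ρ ∘ ahead links) (corners ls)) (∑ (g ∘ ρ ∘ ahead links ∘ ahead ls) (seenᴹ e))
          (cong₂ _+_ (sym (nodes g (endpoints pairing))) (sym (nodes g (seenᴹ s)))
           ⟫ sym (∑-++ γ (map node (endpoints pairing)) (map node (seenᴹ s)))
           ⟫ same-sound γ (λ _ _ → refl) (map node (endpoints pairing) ++ map node (seenᴹ s))
               (map node (corners links) ++ map node (map (ahead links) (seenᴹ t))) okM
           ⟫ ∑-++ γ (map node (corners links)) _
           ⟫ cong₂ _+_ (nodes g (corners links)) (nodes g (map (ahead links) (seenᴹ t)) ⟫ ∑-map (g ∘ ρ) (ahead links) (seenᴹ t)))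
          (O.vertsᴹ g)
      ⟫ cong₂ _+_ (sym (corners-++ g ρ links ls))
          (∑-cong (λ n → cong (g ∘ ρ) (sym (ahead-++ links ls n))) (seenᴹ e))
      where
      γ = G g
      arith : ∀ p r c r′ q c′ r″ → p + r ≡ c + r′ → q + r′ ≡ c′ + r″ → (p + q) + r ≡ (c + c′) + r″
      arith p r c r′ q c′ r″ e₁ e₂ = +-cancelʳ-≡ r′ _ _ (k₁ p q r r′ ⟫ cong₂ _+_ e₁ e₂ ⟫ k₂ c r′ c′ r″)
        where
        k₁ : ∀ p q r r′ → ((p + q) + r) + r′ ≡ (p + r) + (q + r′)
        k₁ = solve-∀
        k₂ : ∀ c r′ c′ r″ → (c + r′) + (c′ + r″) ≡ ((c + c′) + r″) + r′
        k₂ = solve-∀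

    new-edges : ∀ f → Symmetric f →
      (∑ (λ X → ∑ (cycleSum f) (map (loop X) (loops X) ++ O.cycles X)
              + ∑ (λ j → pathSum f (ρ (proj₁ (end s X j))) (expand X (path X j)) (ρ (proj₂ (end s X j)))) (gaps s X)) colours
        + edgeSum f (map (λ (a , b) → ρ a , ρ b) pairing ++ O.matching))
        + edgeSum (λ a b → f (ρ a) (ρ b)) (done s)
      ≡ edgeSum (λ a b → f (ρ a) (ρ b)) (region (links ++ ls))
        + edgeSum (λ a b → f (ρ (ahead (links ++ ls) a)) (ρ (ahead (links ++ ls) b))) (done e)
    new-edges f f-sym =
      cong (_+ edgeSum φ (done s)) (cong₂ _+_
        (∑-cong (λ X → cong (_+ pth X) (∑-++ (cycleSum f) (map (loop X) (loops X)) (O.cycles X))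
                        ⟫ swap₃ (∑ (cycleSum f) (map (loop X) (loops X))) (∑ (cycleSum f) (O.cycles X)) (pth X)) colours
         ⟫ ∑-+ (λ X → ∑ (cycleSum f) (map (loop X) (loops X)) + pth X) (λ X → ∑ (cycleSum f) (O.cycles X)) colours)
        (∑-++ (uncurry f) (map (λ (a , b) → ρ a , ρ b) pairing) O.matching
         ⟫ cong (_+ edgeSum f O.matching) (∑-map (uncurry f) (λ (a , b) → ρ a , ρ b) pairing)))
      ⟫ arith (∑ (λ X → ∑ (cycleSum f) (map (loop X) (loops X)) + pth X) colours) (∑ (λ X → ∑ (cycleSum f) (O.cycles X)) colours)
          (edgeSum φ pairing) (edgeSum f O.matching) (edgeSum φ (done s))
          (∑ (λ X → ∑ (O.fillSum f X) (gaps t X)) colours) (edgeSum φ (region links))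
          (edgeSum (λ a b → φ (ahead links a) (ahead links b)) (done t))
          (edgeSum (λ a b → φ (ahead links a) (ahead links b)) (region ls))
          (edgeSum (λ a b → φ (ahead links (ahead ls a)) (ahead links (ahead ls b))) (done e))
          (cong₂ _+_ (cong₂ _+_
              (∑-cong (λ X → cong₂ _+_ (loops-sum f f-sym X (loops X) (okL X)) (paths-sum f f-sym X (gaps s X) (okP X))
                         ⟫ sym (∑-++ ψ (concatMap (loopTrail X) (loops X)) (concatMap (pathTrail X) (gaps s X)))) colours
               ⟫ sym (∑-concatMap ψ (λ X → concatMap (loopTrail X) (loops X) ++ concatMap (pathTrail X) (gaps s X)) colours))
              (sym (edgeSum-atoms f f-sym pairing)))
              (sym (edgeSum-atoms f f-sym (done s)))
           ⟫ +-assoc (∑ ψ as₁) (∑ ψ as₂) (∑ ψ as₃)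
           ⟫ cong (∑ ψ as₁ +_) (sym (∑-++ ψ as₂ as₃)) ⟫ sym (∑-++ ψ as₁ (as₂ ++ as₃))
           ⟫ same-sound ψ (λ a b → f-sym (ρ a) (ρ b)) (as₁ ++ as₂ ++ as₃)
               (concatMap holes colours ++ edgeAtoms (region links) ++ edgeAtoms (map (aheadᴱ links) (done t))) okE
           ⟫ ∑-++ ψ (concatMap holes colours) _
           ⟫ cong₂ _+_ (∑-concatMap ψ holes colours ⟫ ∑-cong (λ X → ∑-map ψ (hole X) (gaps t X)) colours)
               (∑-++ ψ (edgeAtoms (region links)) _
                ⟫ cong₂ _+_ (edgeSum-atoms f f-sym (region links))
                    (edgeSum-atoms f f-sym (map (aheadᴱ links) (done t)) ⟫ edgeSum-ahead f links (done t))))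
          (cong (λ z → (z + edgeSum f O.matching) + edgeSum (λ a b → f (ρ (ahead links a)) (ρ (ahead links b))) (done t))
             (sym (∑-+ (λ X → ∑ (cycleSum f) (O.cycles X)) (λ X → ∑ (O.fillSum f X) (gaps t X)) colours))
           ⟫ O.edges f f-sym)
      ⟫ cong₂ _+_ (sym (region-++ f ρ links ls))
          (∑-cong (λ (a , b) → cong₂ (λ a b → f (ρ a) (ρ b)) (sym (ahead-++ links ls a)) (sym (ahead-++ links ls b))) (done e))
      where
      ψ = F f f-sym
      φ : ℕ → ℕ → ℕ
      φ a b = f (ρ a) (ρ b)
      pth : Colour → ℕ
      pth X = ∑ (λ j → pathSum f (ρ (proj₁ (end s X j))) (expand X (path X j)) (ρ (proj₂ (end s X j)))) (gaps s X)
      as₁ = concatMap (λ X → concatMap (loopTrail X) (loops X) ++ concatMap (pathTrail X) (gaps s X)) colours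
      as₂ = edgeAtoms pairing
      as₃ = edgeAtoms (done s)
      swap₃ : ∀ a b c → (a + b) + c ≡ (a + c) + b
      swap₃ = solve-∀
      arith : ∀ p q m m′ r o c r′ c′ r″ → (p + m) + r ≡ o + (c + r′) → ((q + o) + m′) + r′ ≡ c′ + r″ →
              ((p + q) + (m + m′)) + r ≡ (c + c′) + r″
      arith p q m m′ r o c r′ c′ r″ e₁ e₂ = +-cancelʳ-≡ (o + r′) _ _
        (k₁ p q m m′ r o r′ ⟫ cong₂ _+_ e₁ e₂ ⟫ k₂ o c r′ c′ r″)
        where
        k₁ : ∀ p q m m′ r o r′ → (((p + q) + (m + m′)) + r) + (o + r′) ≡ ((p + m) + r) + (((q + o) + m′) + r′)
        k₁ = solve-∀
        k₂ : ∀ o c r′ c′ r″ → (o + (c + r′)) + (c′ + r″) ≡ ((c + c′) + r″) + (o + r′)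
        k₂ = solve-∀

finished : {V : Set} (e : Frontier) (ρ : ℕ → V) → (∀ X → ends e X ≡ []) → (∀ X → excess e X ≡ 0) → Tiling e e [] ρ 0 []
finished e ρ h k = record
  { cycles = λ _ → [] ; fill = λ _ _ → [] ; matching = []
  ; edges  = λ f f-sym → cong (λ z → (z + 0) + edgeSum (λ a b → f (ρ a) (ρ b)) (done e)) (none₃ λ X j → pathSum f (ρ (proj₁ (end e X j))) [] (ρ (proj₂ (end e X j))))
  ; verts  = λ X g → cong (_+ ∑ (g ∘ ρ) (seen e X)) (none X (λ _ → 0))
  ; vertsᴹ = λ g → refl
  ; lens   = λ _ → refl
  ; total  = λ X → none X (λ _ → 0) ⟫ sym (cong (_+ 0) (k X))
  }
  where
  none : ∀ X (φ : ℕ → ℕ) → ∑ φ (gaps e X) ≡ 0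
  none X φ rewrite h X = refl
  none₃ : (φ : Colour → ℕ → ℕ) → ∑ (λ X → 0 + ∑ (φ X) (gaps e X)) colours ≡ 0
  none₃ φ rewrite h red | h green | h blue = refl

-- The frontiers and gadgets were found by a computer search.  A name lists the lengths of the cycles
-- that a gadget closes, if they are fixed.
τ : Frontier
τ = record
  { done = []
  ; seen = tri [] (0 ∷ 2 ∷ []) (1 ∷ 3 ∷ [])
  ; seenᴹ = []
  ; ends = λ _ → []
  ; excess = λ _ → 0 }

κ : Frontier
κ = record
  { done = []
  ; seen = tri (0 ∷ 2 ∷ []) (1 ∷ []) (3 ∷ [])
  ; seenᴹ = []
  ; ends = λ _ → []
  ; excess = λ _ → 0 }

-- Three edges of the column are already used, so this frontier does not match the folded apex
-- column. Tilings from `μ` to `μ` start and end at one ordinary column, with the apex in between.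
μ : Frontier
μ = record
  { done = (0 , 2) ∷ (0 , 3) ∷ (1 , 2) ∷ []
  ; seen = tri [] (0 ∷ 1 ∷ 2 ∷ 3 ∷ []) (0 ∷ 2 ∷ [])
  ; seenᴹ = 1 ∷ 3 ∷ []
  ; ends = λ _ → []
  ; excess = λ _ → 0 }

-- The form of `τ` at the apex column, where the labels 0 and 1 are the copies of the apex: under
-- `folded`, the vertices seen in `τ` at the far end become exactly those seen here.
τ-apex : Frontier
τ-apex = record
  { done = []
  ; seen = tri [] (0 ∷ 1 ∷ []) (0 ∷ 1 ∷ [])
  ; seenᴹ = []
  ; ends = λ _ → []
  ; excess = λ _ → 0 }

κ-apex : Frontier
κ-apex = record
  { done = []
  ; seen = tri (0 ∷ 1 ∷ []) (1 ∷ []) (0 ∷ [])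
  ; seenᴹ = []
  ; ends = λ _ → []
  ; excess = λ _ → 0 }

-- The column is used up and one cycle of each colour is open. The excesses 2, 4, 4 differ among
-- themselves as the sizes 0, 2, 2 of `seen τ` do: missing paths closed by `τ-close` cover whole
-- columns and, in each colour, those vertices of the last one. `κ-run` and `μ-run` obey the same
-- rule with `seen κ` and `seen μ`.
τ-run : Frontier
τ-run = record
  { done = (0 , 1) ∷ (0 , 2) ∷ (0 , 3) ∷ (1 , 2) ∷ (1 , 3) ∷ (2 , 3) ∷ []
  ; seen = λ _ → 0 ∷ 1 ∷ 2 ∷ 3 ∷ []
  ; seenᴹ = 0 ∷ 1 ∷ 2 ∷ 3 ∷ []
  ; ends = tri ((0 , 2) ∷ []) ((0 , 1) ∷ (2 , 3) ∷ []) ((1 , 3) ∷ [])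
  ; excess = tri 2 4 4 }

κ-run : Frontier
κ-run = record
  { done = (0 , 1) ∷ (0 , 2) ∷ (0 , 3) ∷ (1 , 2) ∷ (1 , 3) ∷ (2 , 3) ∷ []
  ; seen = λ _ → 0 ∷ 1 ∷ 2 ∷ 3 ∷ []
  ; seenᴹ = 0 ∷ 1 ∷ 2 ∷ 3 ∷ []
  ; ends = tri ((0 , 1) ∷ (2 , 3) ∷ []) ((2 , 3) ∷ []) ((0 , 1) ∷ [])
  ; excess = tri 6 5 5 }

μ-run : Frontier
μ-run = record
  { done = (0 , 1) ∷ (0 , 2) ∷ (0 , 3) ∷ (1 , 2) ∷ (1 , 3) ∷ (2 , 3) ∷ []
  ; seen = λ _ → 0 ∷ 1 ∷ 2 ∷ 3 ∷ []
  ; seenᴹ = 0 ∷ 1 ∷ 2 ∷ 3 ∷ []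
  ; ends = tri ((0 , 2) ∷ []) ((1 , 3) ∷ []) ((0 , 1) ∷ (2 , 3) ∷ [])
  ; excess = tri 2 6 4 }

-- The excesses are those of `μ-run`, but red instead of blue crosses in two paths. In this state a
-- run reaches the apex, behind which `μ-apex-turn` continues in `μ-run`.
μ-run′ : Frontier
μ-run′ = record
  { done = (0 , 1) ∷ (0 , 2) ∷ (0 , 3) ∷ (1 , 2) ∷ (1 , 3) ∷ (2 , 3) ∷ []
  ; seen = λ _ → 0 ∷ 1 ∷ 2 ∷ 3 ∷ []
  ; seenᴹ = 0 ∷ 1 ∷ 2 ∷ 3 ∷ []
  ; ends = tri ((0 , 1) ∷ (2 , 3) ∷ []) ((0 , 2) ∷ []) ((1 , 3) ∷ [])
  ; excess = tri 2 6 4 }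

τ-apex-4 : Gadget τ-apex τ
τ-apex-4 = record
  { links = from-apex ∷ []
  ; loops = tri
      ((0 , map to (2 ∷ 1 ∷ 3 ∷ [])) ∷ [])
      ((2 , map to (4 ∷ 3 ∷ 6 ∷ [])) ∷ [])
      ((2 , map to (5 ∷ 3 ∷ 7 ∷ [])) ∷ [])
  ; paths = λ _ → []
  ; pairing = (0 , 1) ∷ (2 , 3) ∷ []
  ; sizes = (4 , false) ∷ []
  ; growth = 0 , false }

τ-apex-44 : Gadget τ-apex τ
τ-apex-44 = record
  { links = from-apex ∷ rail ∷ []
  ; loops = tri
      ((0 , map to (2 ∷ 1 ∷ 3 ∷ [])) ∷ (4 , map to (6 ∷ 5 ∷ 7 ∷ [])) ∷ [])
      ((2 , map to (4 ∷ 10 ∷ 5 ∷ [])) ∷ (3 , map to (6 ∷ 8 ∷ 7 ∷ [])) ∷ [])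
      ((2 , map to (6 ∷ 9 ∷ 7 ∷ [])) ∷ (3 , map to (4 ∷ 11 ∷ 5 ∷ [])) ∷ [])
  ; paths = λ _ → []
  ; pairing = (0 , 1) ∷ (2 , 3) ∷ (4 , 5) ∷ (6 , 7) ∷ []
  ; sizes = (4 , false) ∷ (4 , false) ∷ []
  ; growth = 0 , false }

τ-44 : Gadget τ τ
τ-44 = record
  { links = rail ∷ rail ∷ []
  ; loops = tri
      ((0 , map to (2 ∷ 1 ∷ 3 ∷ [])) ∷ (4 , map to (6 ∷ 5 ∷ 7 ∷ [])) ∷ [])
      ((1 , map to (6 ∷ 8 ∷ 7 ∷ [])) ∷ (3 , map to (4 ∷ 10 ∷ 5 ∷ [])) ∷ [])
      ((0 , map to (6 ∷ 9 ∷ 7 ∷ [])) ∷ (2 , map to (4 ∷ 11 ∷ 5 ∷ [])) ∷ [])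
  ; paths = λ _ → []
  ; pairing = (0 , 1) ∷ (2 , 3) ∷ (4 , 5) ∷ (6 , 7) ∷ []
  ; sizes = (4 , false) ∷ (4 , false) ∷ []
  ; growth = 0 , false }

τ-8 : Gadget τ τ
τ-8 = record
  { links = rail ∷ rail ∷ []
  ; loops = tri
      ((0 , map to (3 ∷ 4 ∷ 7 ∷ 5 ∷ 2 ∷ 1 ∷ 6 ∷ [])) ∷ [])
      ((1 , map to (3 ∷ 5 ∷ 10 ∷ 4 ∷ 6 ∷ 8 ∷ 7 ∷ [])) ∷ [])
      ((0 , map to (2 ∷ 4 ∷ 11 ∷ 5 ∷ 6 ∷ 9 ∷ 7 ∷ [])) ∷ [])
  ; paths = λ _ → []
  ; pairing = (0 , 1) ∷ (2 , 3) ∷ (4 , 5) ∷ (6 , 7) ∷ []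
  ; sizes = (8 , false) ∷ []
  ; growth = 0 , false }

τ-66 : Gadget τ τ
τ-66 = record
  { links = rail ∷ rail ∷ rail ∷ []
  ; loops = tri
      ((0 , map to (1 ∷ 6 ∷ 8 ∷ 9 ∷ 7 ∷ [])) ∷ (2 , map to (3 ∷ 4 ∷ 11 ∷ 10 ∷ 5 ∷ [])) ∷ [])
      ((1 , map to (3 ∷ 5 ∷ 6 ∷ 4 ∷ 7 ∷ [])) ∷ (8 , map to (11 ∷ 12 ∷ 10 ∷ 9 ∷ 14 ∷ [])) ∷ [])
      ((0 , map to (2 ∷ 4 ∷ 5 ∷ 7 ∷ 6 ∷ [])) ∷ (8 , map to (10 ∷ 13 ∷ 11 ∷ 9 ∷ 15 ∷ [])) ∷ [])
  ; paths = λ _ → []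
  ; pairing = (0 , 3) ∷ (1 , 2) ∷ (6 , 9) ∷ (7 , 8) ∷ (4 , 10) ∷ (5 , 11) ∷ []
  ; sizes = (6 , false) ∷ (6 , false) ∷ []
  ; growth = 0 , false }

τ-open : Gadget τ τ-run
τ-open = record
  { links = rail ∷ []
  ; loops = tri
      ((0 , to 2 ∷ to 1 ∷ to 7 ∷ to 4 ∷ thru 0 ∷ to 5 ∷ to 3 ∷ []) ∷ [])
      ((1 , to 3 ∷ to 4 ∷ thru 0 ∷ to 7 ∷ back 1 ∷ []) ∷ [])
      ((0 , to 6 ∷ to 4 ∷ to 2 ∷ to 5 ∷ thru 0 ∷ []) ∷ [])
  ; paths = λ _ → []
  ; pairing = (0 , 1) ∷ (2 , 3) ∷ (4 , 5) ∷ (6 , 7) ∷ []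
  ; sizes = (10 , true) ∷ []
  ; growth = 0 , false }

τ-6-open : Gadget τ τ-run
τ-6-open = record
  { links = rail ∷ rail ∷ []
  ; loops = tri
      ((4 , to 7 ∷ to 9 ∷ to 8 ∷ thru 0 ∷ to 11 ∷ []) ∷ (0 , map to (3 ∷ 5 ∷ 2 ∷ 1 ∷ 6 ∷ [])) ∷ [])
      ((8 , thru 0 ∷ to 11 ∷ back 1 ∷ []) ∷ (1 , map to (3 ∷ 4 ∷ 5 ∷ 6 ∷ 7 ∷ [])) ∷ [])
      ((6 , to 8 ∷ to 11 ∷ back 0 ∷ []) ∷ (0 , map to (2 ∷ 4 ∷ 10 ∷ 5 ∷ 7 ∷ [])) ∷ [])
  ; paths = λ _ → []
  ; pairing = (0 , 1) ∷ (2 , 3) ∷ (4 , 6) ∷ (9 , 10) ∷ (7 , 8) ∷ (5 , 11) ∷ []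
  ; sizes = (8 , true) ∷ (6 , false) ∷ []
  ; growth = 0 , false }

τ-step : Gadget τ-run τ-run
τ-step = record
  { links = rail ∷ []
  ; loops = λ _ → []
  ; paths = tri
      ((to 7 ∷ to 5 ∷ to 6 ∷ back 0 ∷ []) ∷ [])
      ((to 6 ∷ thru 1 ∷ []) ∷ (to 5 ∷ back 0 ∷ []) ∷ [])
      ((to 6 ∷ to 4 ∷ to 7 ∷ back 0 ∷ []) ∷ [])
  ; pairing = (4 , 5) ∷ (6 , 7) ∷ []
  ; sizes = []
  ; growth = 4 , true }

-- One cycle ends and the next opens within the same gadget: between two cycles of length 2 modulo 4
-- the frontier cannot be `τ`, as every colour covers a multiple of four vertices from one such
-- frontier to another.
τ-turn : Gadget τ-run τ-run
τ-turn = record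
  { links = rail ∷ rail ∷ []
  ; loops = tri
      ((5 , to 6 ∷ to 9 ∷ to 8 ∷ thru 0 ∷ to 11 ∷ []) ∷ [])
      ((8 , thru 0 ∷ to 11 ∷ back 1 ∷ []) ∷ [])
      ((4 , to 10 ∷ to 9 ∷ thru 0 ∷ []) ∷ [])
  ; paths = tri
      ((map to (7 ∷ 4 ∷ [])) ∷ [])
      ((map to (6 ∷ 7 ∷ [])) ∷ (map to (5 ∷ 4 ∷ [])) ∷ [])
      ((map to (6 ∷ 8 ∷ 7 ∷ 5 ∷ [])) ∷ [])
  ; pairing = (4 , 6) ∷ (8 , 11) ∷ (7 , 9) ∷ (5 , 10) ∷ []
  ; sizes = (8 , true) ∷ []
  ; growth = 0 , false }

τ-close : Gadget τ-run τ
τ-close = record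
  { links = rail ∷ rail ∷ []
  ; loops = λ _ → []
  ; paths = tri
      ((map to (7 ∷ 5 ∷ 6 ∷ 4 ∷ [])) ∷ [])
      ((map to (6 ∷ 8 ∷ 7 ∷ [])) ∷ (map to (5 ∷ 10 ∷ 4 ∷ [])) ∷ [])
      ((map to (6 ∷ 9 ∷ 7 ∷ 4 ∷ 11 ∷ 5 ∷ [])) ∷ [])
  ; pairing = (4 , 5) ∷ (6 , 7) ∷ []
  ; sizes = []
  ; growth = 2 , false }

κ-apex-8 : Gadget κ-apex κ
κ-apex-8 = record
  { links = from-apex ∷ rail ∷ []
  ; loops = tri
      ((2 , map to (5 ∷ 10 ∷ 4 ∷ 3 ∷ 6 ∷ 8 ∷ 7 ∷ [])) ∷ [])
      ((0 , map to (2 ∷ 4 ∷ 6 ∷ 9 ∷ 7 ∷ 5 ∷ 3 ∷ [])) ∷ [])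
      ((1 , map to (2 ∷ 6 ∷ 5 ∷ 11 ∷ 4 ∷ 7 ∷ 3 ∷ [])) ∷ [])
  ; paths = λ _ → []
  ; pairing = (0 , 1) ∷ (2 , 3) ∷ (4 , 5) ∷ (6 , 7) ∷ []
  ; sizes = (8 , false) ∷ []
  ; growth = 0 , false }

κ-apex-open : Gadget κ-apex κ-run
κ-apex-open = record
  { links = from-apex ∷ []
  ; loops = tri
      ((2 , to 5 ∷ back 0 ∷ to 3 ∷ to 6 ∷ thru 1 ∷ []) ∷ [])
      ((0 , to 2 ∷ to 4 ∷ to 7 ∷ back 0 ∷ to 5 ∷ to 3 ∷ []) ∷ [])
      ((1 , to 2 ∷ to 6 ∷ to 4 ∷ thru 0 ∷ to 7 ∷ to 3 ∷ []) ∷ [])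
  ; paths = λ _ → []
  ; pairing = (0 , 1) ∷ (2 , 3) ∷ (4 , 5) ∷ (6 , 7) ∷ []
  ; sizes = (12 , true) ∷ []
  ; growth = 0 , false }

κ-8 : Gadget κ κ
κ-8 = record
  { links = rail ∷ rail ∷ []
  ; loops = tri
      ((1 , map to (3 ∷ 4 ∷ 10 ∷ 5 ∷ 6 ∷ 8 ∷ 7 ∷ [])) ∷ [])
      ((0 , map to (3 ∷ 5 ∷ 2 ∷ 4 ∷ 7 ∷ 9 ∷ 6 ∷ [])) ∷ [])
      ((0 , map to (2 ∷ 1 ∷ 6 ∷ 4 ∷ 11 ∷ 5 ∷ 7 ∷ [])) ∷ [])
  ; paths = λ _ → []
  ; pairing = (0 , 1) ∷ (2 , 3) ∷ (4 , 5) ∷ (6 , 7) ∷ []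
  ; sizes = (8 , false) ∷ []
  ; growth = 0 , false }

κ-open : Gadget κ κ-run
κ-open = record
  { links = rail ∷ []
  ; loops = tri
      ((1 , to 3 ∷ to 4 ∷ thru 0 ∷ to 6 ∷ thru 1 ∷ []) ∷ [])
      ((0 , to 3 ∷ to 5 ∷ to 2 ∷ to 4 ∷ to 7 ∷ back 0 ∷ []) ∷ [])
      ((0 , to 2 ∷ to 1 ∷ to 6 ∷ to 4 ∷ thru 0 ∷ to 7 ∷ []) ∷ [])
  ; paths = λ _ → []
  ; pairing = (0 , 1) ∷ (2 , 3) ∷ (4 , 5) ∷ (6 , 7) ∷ []
  ; sizes = (12 , true) ∷ []
  ; growth = 0 , false }

κ-step : Gadget κ-run κ-run
κ-step = record
  { links = rail ∷ []
  ; loops = λ _ → []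
  ; paths = tri
      ((to 7 ∷ back 1 ∷ []) ∷ (to 4 ∷ thru 0 ∷ []) ∷ [])
      ((to 5 ∷ to 7 ∷ back 0 ∷ to 4 ∷ []) ∷ [])
      ((to 6 ∷ to 5 ∷ back 0 ∷ to 7 ∷ []) ∷ [])
  ; pairing = (4 , 5) ∷ (6 , 7) ∷ []
  ; sizes = []
  ; growth = 4 , true }

κ-close : Gadget κ-run κ
κ-close = record
  { links = rail ∷ rail ∷ []
  ; loops = λ _ → []
  ; paths = tri
      ((map to (7 ∷ 8 ∷ 6 ∷ [])) ∷ (map to (5 ∷ 10 ∷ 4 ∷ [])) ∷ [])
      ((map to (4 ∷ 7 ∷ 9 ∷ 6 ∷ 5 ∷ [])) ∷ [])
      ((map to (6 ∷ 4 ∷ 11 ∷ 5 ∷ 7 ∷ [])) ∷ [])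
  ; pairing = (4 , 5) ∷ (6 , 7) ∷ []
  ; sizes = []
  ; growth = 0 , false }

μ-8 : Gadget μ μ
μ-8 = record
  { links = rail ∷ rail ∷ []
  ; loops = tri
      ((0 , map to (1 ∷ 3 ∷ 2 ∷ 4 ∷ 6 ∷ 5 ∷ 7 ∷ [])) ∷ [])
      ((4 , map to (5 ∷ 11 ∷ 8 ∷ 7 ∷ 6 ∷ 9 ∷ 10 ∷ [])) ∷ [])
      ((1 , map to (6 ∷ 8 ∷ 10 ∷ 5 ∷ 3 ∷ 4 ∷ 7 ∷ [])) ∷ [])
  ; paths = λ _ → []
  ; pairing = (2 , 5) ∷ (0 , 6) ∷ (7 , 9) ∷ (4 , 11) ∷ []
  ; sizes = (8 , false) ∷ []
  ; growth = 0 , false }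

μ-66 : Gadget μ μ
μ-66 = record
  { links = rail ∷ rail ∷ rail ∷ []
  ; loops = tri
      ((0 , map to (1 ∷ 3 ∷ 2 ∷ 4 ∷ 7 ∷ [])) ∷ (5 , map to (10 ∷ 8 ∷ 6 ∷ 9 ∷ 11 ∷ [])) ∷ [])
      ((4 , map to (5 ∷ 6 ∷ 7 ∷ 9 ∷ 10 ∷ [])) ∷ (8 , map to (14 ∷ 13 ∷ 11 ∷ 12 ∷ 15 ∷ [])) ∷ [])
      ((1 , map to (6 ∷ 4 ∷ 3 ∷ 5 ∷ 7 ∷ [])) ∷ (8 , map to (9 ∷ 14 ∷ 12 ∷ 10 ∷ 11 ∷ [])) ∷ [])
  ; paths = λ _ → []
  ; pairing = (2 , 5) ∷ (0 , 6) ∷ (7 , 8) ∷ (4 , 11) ∷ (10 , 13) ∷ (9 , 15) ∷ []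
  ; sizes = (6 , false) ∷ (6 , false) ∷ []
  ; growth = 0 , false }

μ-open : Gadget μ μ-run
μ-open = record
  { links = rail ∷ []
  ; loops = tri
      ((0 , to 1 ∷ to 6 ∷ back 0 ∷ to 2 ∷ to 3 ∷ to 5 ∷ to 7 ∷ []) ∷ [])
      ((4 , to 5 ∷ thru 0 ∷ to 6 ∷ []) ∷ [])
      ((1 , to 3 ∷ to 4 ∷ thru 0 ∷ to 6 ∷ thru 1 ∷ []) ∷ [])
  ; paths = λ _ → []
  ; pairing = (4 , 7) ∷ (2 , 5) ∷ (0 , 6) ∷ []
  ; sizes = (10 , true) ∷ []
  ; growth = 0 , false }

μ-step : Gadget μ-run μ-run
μ-step = record
  { links = rail ∷ []
  ; loops = λ _ → []
  ; paths = tri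
      ((to 7 ∷ to 5 ∷ to 6 ∷ back 0 ∷ []) ∷ [])
      ((to 6 ∷ to 4 ∷ to 7 ∷ back 0 ∷ []) ∷ [])
      ((to 6 ∷ thru 1 ∷ []) ∷ (to 5 ∷ back 0 ∷ []) ∷ [])
  ; pairing = (4 , 5) ∷ (6 , 7) ∷ []
  ; sizes = []
  ; growth = 4 , true }

μ-turn : Gadget μ-run μ-run
μ-turn = record
  { links = rail ∷ rail ∷ []
  ; loops = tri
      ((4 , to 6 ∷ to 9 ∷ to 8 ∷ thru 0 ∷ to 11 ∷ []) ∷ [])
      ((9 , thru 0 ∷ []) ∷ [])
      ((8 , thru 0 ∷ to 10 ∷ thru 1 ∷ []) ∷ [])
  ; paths = tri
      ((map to (7 ∷ 5 ∷ [])) ∷ [])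
      ((map to (6 ∷ 5 ∷ 10 ∷ 8 ∷ 7 ∷ 4 ∷ [])) ∷ [])
      ((map to (6 ∷ 7 ∷ [])) ∷ (map to (4 ∷ 5 ∷ [])) ∷ [])
  ; pairing = (6 , 8) ∷ (7 , 9) ∷ (4 , 10) ∷ (5 , 11) ∷ []
  ; sizes = (8 , true) ∷ []
  ; growth = 0 , false }

μ-close : Gadget μ-run μ
μ-close = record
  { links = rail ∷ rail ∷ []
  ; loops = λ _ → []
  ; paths = tri
      ((map to (7 ∷ 6 ∷ 5 ∷ 4 ∷ [])) ∷ [])
      ((map to (7 ∷ 4 ∷ 11 ∷ 8 ∷ 6 ∷ 9 ∷ 10 ∷ 5 ∷ [])) ∷ [])
      ((map to (6 ∷ [])) ∷ (map to (5 ∷ 7 ∷ 8 ∷ 10 ∷ 4 ∷ [])) ∷ [])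
  ; pairing = (4 , 6) ∷ (7 , 9) ∷ (5 , 11) ∷ []
  ; sizes = []
  ; growth = 2 , false }

μ-close-6 : Gadget μ-run μ
μ-close-6 = record
  { links = rail ∷ rail ∷ rail ∷ []
  ; loops = tri
      ((5 , map to (6 ∷ 8 ∷ 9 ∷ 11 ∷ 10 ∷ [])) ∷ [])
      ((8 , map to (14 ∷ 13 ∷ 11 ∷ 12 ∷ 15 ∷ [])) ∷ [])
      ((7 , map to (8 ∷ 10 ∷ 12 ∷ 14 ∷ 9 ∷ [])) ∷ [])
  ; paths = tri
      ((map to (7 ∷ 4 ∷ [])) ∷ [])
      ((map to (7 ∷ 6 ∷ 9 ∷ 10 ∷ 4 ∷ 5 ∷ [])) ∷ [])
      ((map to (6 ∷ [])) ∷ (map to (5 ∷ 11 ∷ 4 ∷ [])) ∷ [])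
  ; pairing = (4 , 6) ∷ (5 , 7) ∷ (8 , 11) ∷ (10 , 13) ∷ (9 , 15) ∷ []
  ; sizes = (6 , false) ∷ []
  ; growth = 0 , false }

μ-apex-66 : Gadget μ μ
μ-apex-66 = record
  { links = into-apex ∷ from-apex ∷ rail ∷ []
  ; loops = tri
      ((0 , map to (1 ∷ 4 ∷ 2 ∷ 3 ∷ 5 ∷ [])) ∷ (6 , map to (9 ∷ 8 ∷ 7 ∷ 11 ∷ 10 ∷ [])) ∷ [])
      ((4 , map to (5 ∷ 7 ∷ 10 ∷ 8 ∷ 6 ∷ [])) ∷ (9 , map to (14 ∷ 13 ∷ 11 ∷ 12 ∷ 15 ∷ [])) ∷ [])
      ((1 , map to (3 ∷ 4 ∷ 7 ∷ 6 ∷ 5 ∷ [])) ∷ (8 , map to (11 ∷ 9 ∷ 10 ∷ 12 ∷ 14 ∷ [])) ∷ [])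
  ; paths = λ _ → []
  ; pairing = (0 , 4) ∷ (2 , 5) ∷ (7 , 9) ∷ (6 , 11) ∷ (10 , 13) ∷ (8 , 15) ∷ []
  ; sizes = (6 , false) ∷ (6 , false) ∷ []
  ; growth = 0 , false }

μ-6-apex-open : Gadget μ μ-run
μ-6-apex-open = record
  { links = into-apex ∷ from-apex ∷ []
  ; loops = tri
      ((6 , to 8 ∷ thru 0 ∷ to 11 ∷ to 7 ∷ to 9 ∷ []) ∷ (0 , map to (1 ∷ 4 ∷ 2 ∷ 3 ∷ 5 ∷ [])) ∷ [])
      ((9 , thru 0 ∷ []) ∷ (4 , map to (5 ∷ 7 ∷ 8 ∷ 10 ∷ 6 ∷ [])) ∷ [])
      ((8 , thru 0 ∷ to 10 ∷ thru 1 ∷ []) ∷ (1 , map to (3 ∷ 4 ∷ 7 ∷ 6 ∷ 5 ∷ [])) ∷ [])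
  ; paths = λ _ → []
  ; pairing = (8 , 9) ∷ (0 , 4) ∷ (2 , 5) ∷ (7 , 10) ∷ (6 , 11) ∷ []
  ; sizes = (8 , true) ∷ (6 , false) ∷ []
  ; growth = 0 , false }

μ-open′ : Gadget μ μ-run′
μ-open′ = record
  { links = rail ∷ []
  ; loops = tri
      ((0 , to 1 ∷ to 3 ∷ to 2 ∷ to 4 ∷ thru 0 ∷ to 6 ∷ thru 1 ∷ []) ∷ [])
      ((4 , thru 0 ∷ to 7 ∷ to 5 ∷ []) ∷ [])
      ((1 , to 6 ∷ to 4 ∷ to 3 ∷ to 5 ∷ thru 0 ∷ []) ∷ [])
  ; paths = λ _ → []
  ; pairing = (4 , 7) ∷ (2 , 5) ∷ (0 , 6) ∷ []
  ; sizes = (10 , true) ∷ []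
  ; growth = 0 , false }

μ-step′ : Gadget μ-run′ μ-run′
μ-step′ = record
  { links = rail ∷ []
  ; loops = λ _ → []
  ; paths = tri
      ((to 7 ∷ back 1 ∷ []) ∷ (to 4 ∷ thru 0 ∷ []) ∷ [])
      ((to 6 ∷ back 0 ∷ to 7 ∷ to 5 ∷ []) ∷ [])
      ((to 7 ∷ back 0 ∷ to 6 ∷ to 4 ∷ []) ∷ [])
  ; pairing = (4 , 5) ∷ (6 , 7) ∷ []
  ; sizes = []
  ; growth = 4 , true }

μ-apex-turn : Gadget μ-run′ μ-run
μ-apex-turn = record
  { links = into-apex ∷ from-apex ∷ []
  ; loops = tri
      ((6 , to 9 ∷ to 7 ∷ to 8 ∷ thru 0 ∷ to 11 ∷ []) ∷ [])
      ((9 , thru 0 ∷ []) ∷ [])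
      ((8 , thru 0 ∷ to 10 ∷ thru 1 ∷ []) ∷ [])
  ; paths = tri
      ((map to (5 ∷ [])) ∷ (map to (4 ∷ [])) ∷ [])
      ((map to (4 ∷ 6 ∷ 8 ∷ 10 ∷ 7 ∷ 5 ∷ [])) ∷ [])
      ((map to (4 ∷ 7 ∷ 6 ∷ 5 ∷ [])) ∷ [])
  ; pairing = (4 , 5) ∷ (8 , 9) ∷ (6 , 10) ∷ (7 , 11) ∷ []
  ; sizes = (8 , true) ∷ []
  ; growth = 0 , false }

-- Tilings with prescribed cycle lengths

rails : ℕ → List Link → List Link
rails zero    tl = tl
rails (suc n) tl = rail ∷ rails n tl

-- The names refer to half of the length modulo 2: 8, 12, 16, ... and 6, 10, 14, .... Length 4 is
-- kept apart because only `τ` has gadgets for it.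
quad odd : ℕ → ℕ
quad q = 8 + q * 4
odd  o = 6 + o * 4

twoOdds : List (ℕ × ℕ) → List ℕ
twoOdds = concatMap (λ (o , p) → odd o ∷ odd p ∷ [])

module _ {V : Set} where

  Fill : Frontier → Frontier → List Link → ℕ → List ℕ → Set
  Fill s e ls x Ts = (ρ : ℕ → V) → Tiling s e ls ρ x Ts

  iterate : ∀ {r e} → (∀ {ls x Ts} → Fill r e ls x Ts → Fill r e (rail ∷ ls) (4 + x) Ts) →
            ∀ i {ls x Ts} → Fill r e ls x Ts → Fill r e (rails i ls) (i * 4 + x) Ts
  iterate step zero    F = F
  iterate step (suc i) F = step (iterate step i F)

  rails-+ : ∀ i n → rails i (rails n []) ≡ rails (i + n) []
  rails-+ zero    n = refl
  rails-+ (suc i) n = cong (rail ∷_) (rails-+ i n)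

  -- The gadgets may close the cycles in an order other than that of `T`. Each column holds four
  -- vertices of every colour, which fixes the number of columns.
  Laid : Frontier → Frontier → List ℕ → Set
  Laid s e T = ∃ λ n → 4 * n ≡ sum T × ∃ λ Ts → Ts ↭ T × Fill s e (rails n []) 0 Ts

  Laid-↭ : ∀ {s e T T′} → T ↭ T′ → Laid s e T → Laid s e T′
  Laid-↭ p (n , e , Ts , q , F) = n , e ⟫ sum-↭ p , Ts , ↭-trans q p , F

  recast : ∀ {s e ls ls′ x Ts Ts′} → ls ≡ ls′ → Ts ≡ Ts′ → Fill s e ls x Ts → Fill s e ls′ x Ts′
  recast refl refl F = F

  τ-run-step : ∀ {e ls x Ts} → Fill τ-run e ls x Ts → Fill τ-run e (rail ∷ ls) (4 + x) Ts
  τ-run-step F ρ = prepend τ-step tt (F _)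

  κ-run-step : ∀ {e ls x Ts} → Fill κ-run e ls x Ts → Fill κ-run e (rail ∷ ls) (4 + x) Ts
  κ-run-step F ρ = prepend κ-step tt (F _)

  μ-run-step : ∀ {e ls x Ts} → Fill μ-run e ls x Ts → Fill μ-run e (rail ∷ ls) (4 + x) Ts
  μ-run-step F ρ = prepend μ-step tt (F _)

  μ-run′-step : ∀ {e ls x Ts} → Fill μ-run′ e ls x Ts → Fill μ-run′ e (rail ∷ ls) (4 + x) Ts
  μ-run′-step F ρ = prepend μ-step′ tt (F _)

  length-quad : ∀ i → 10 + (i * 4 + 2) ≡ quad (suc i)
  length-quad i = lem i
    where
    lem : ∀ i → 10 + (i * 4 + 2) ≡ 8 + (4 + i * 4)
    lem = solve-∀

  length-odd : ∀ i → 8 + (i * 4 + 2) ≡ odd (suc i)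
  length-odd i = lem i
    where
    lem : ∀ i → 8 + (i * 4 + 2) ≡ 6 + (4 + i * 4)
    lem = solve-∀

  length-odd′ : ∀ i → 10 + (i * 4 + 0) ≡ odd (suc i)
  length-odd′ i = lem i
    where
    lem : ∀ i → 10 + (i * 4 + 0) ≡ 6 + (4 + i * 4)
    lem = solve-∀

  length-quad′ : ∀ i → 12 + (i * 4 + 0) ≡ quad (suc i)
  length-quad′ i = lem i
    where
    lem : ∀ i → 12 + (i * 4 + 0) ≡ 8 + (4 + i * 4)
    lem = solve-∀

  add-quad : ∀ i n {s} → 4 * n ≡ s → 4 * (1 + (i + (2 + n))) ≡ quad (suc i) + s
  add-quad i n {s} e = lem i n ⟫ cong (quad (suc i) +_) e
    where
    lem : ∀ i n → 4 * (1 + (i + (2 + n))) ≡ (8 + (4 + i * 4)) + 4 * n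
    lem = solve-∀

  add-8 : ∀ n {s} → 4 * n ≡ s → 4 * (2 + n) ≡ 8 + s
  add-8 n e = lem n ⟫ cong (8 +_) e
    where
    lem : ∀ n → 4 * (2 + n) ≡ 8 + 4 * n
    lem = solve-∀

  add-66 : ∀ n {s} → 4 * n ≡ s → 4 * (3 + n) ≡ 6 + (6 + s)
  add-66 n e = lem n ⟫ cong (12 +_) e
    where
    lem : ∀ n → 4 * (3 + n) ≡ 12 + 4 * n
    lem = solve-∀

  add-6-odd : ∀ j n {s} → 4 * n ≡ s → 4 * (2 + (j + (2 + n))) ≡ 6 + (odd (suc j) + s)
  add-6-odd j n {s} e = lem j n ⟫ cong (λ z → 6 + (odd (suc j) + z)) e
    where
    lem : ∀ j n → 4 * (2 + (j + (2 + n))) ≡ 6 + ((6 + (4 + j * 4)) + 4 * n)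
    lem = solve-∀

  add-odd-odd : ∀ i j n {s} → 4 * n ≡ s → 4 * (1 + (i + (2 + (j + (2 + n))))) ≡ odd (suc i) + (odd (suc j) + s)
  add-odd-odd i j n {s} e = lem i j n ⟫ cong (λ z → odd (suc i) + (odd (suc j) + z)) e
    where
    lem : ∀ i j n → 4 * (1 + (i + (2 + (j + (2 + n))))) ≡ (6 + (4 + i * 4)) + ((6 + (4 + j * 4)) + 4 * n)
    lem = solve-∀

  Adds-quads Adds-pairs : Frontier → Set
  Adds-quads σ = ∀ q {T} → Laid σ σ T → Laid σ σ (quad q ∷ T)
  Adds-pairs σ = ∀ o p {T} → Laid σ σ T → Laid σ σ (odd o ∷ odd p ∷ T)

  -- Length 8 has a gadget of its own. From 12 on a cycle is opened in one column, lengthened by 4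
  -- in each of `i` columns, and closed with two more.
  τ-quad : Adds-quads τ
  τ-quad zero    (n , e , Ts , r , F) = 2 + n , add-8 n e , 8 ∷ Ts , prep 8 r , λ ρ → prepend τ-8 tt (F _)
  τ-quad (suc i) (n , e , Ts , r , F) = 1 + (i + (2 + n)) , add-quad i n e , quad (suc i) ∷ Ts , prep _ r ,
    recast (cong (rail ∷_) (rails-+ i (2 + n))) (cong (_∷ Ts) (length-quad i))
      (λ ρ → prepend τ-open tt (iterate τ-run-step i (λ ρ → prepend τ-close tt (F _)) _))

  κ-quad : Adds-quads κ
  κ-quad zero    (n , e , Ts , r , F) = 2 + n , add-8 n e , 8 ∷ Ts , prep 8 r , λ ρ → prepend κ-8 tt (F _)
  κ-quad (suc i) (n , e , Ts , r , F) = 1 + (i + (2 + n)) , add-quad i n e , quad (suc i) ∷ Ts , prep _ r ,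
    recast (cong (rail ∷_) (rails-+ i (2 + n))) (cong (_∷ Ts) (length-quad′ i))
      (λ ρ → prepend κ-open tt (iterate κ-run-step i (λ ρ → prepend κ-close tt (F _)) _))

  μ-quad : Adds-quads μ
  μ-quad zero    (n , e , Ts , r , F) = 2 + n , add-8 n e , 8 ∷ Ts , prep 8 r , λ ρ → prepend μ-8 tt (F _)
  μ-quad (suc i) (n , e , Ts , r , F) = 1 + (i + (2 + n)) , add-quad i n e , quad (suc i) ∷ Ts , prep _ r ,
    recast (cong (rail ∷_) (rails-+ i (2 + n))) (cong (_∷ Ts) (length-quad i))
      (λ ρ → prepend μ-open tt (iterate μ-run-step i (λ ρ → prepend μ-close tt (F _)) _))

  -- Two 6-cycles form one gadget; a single 6 is closed by the gadget that opens its partner; two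
  -- lengths from 10 on are two runs joined by `τ-turn`.
  τ-pair : Adds-pairs τ
  τ-pair zero    zero    (n , e , Ts , r , F) =
    3 + n , add-66 n e , 6 ∷ 6 ∷ Ts , prep 6 (prep 6 r) , λ ρ → prepend τ-66 tt (F _)
  τ-pair zero    (suc j) (n , e , Ts , r , F) =
    2 + (j + (2 + n)) , add-6-odd j n e , odd (suc j) ∷ 6 ∷ Ts , swap _ 6 r ,
    recast (cong (λ z → rail ∷ rail ∷ z) (rails-+ j (2 + n))) (cong (λ z → z ∷ 6 ∷ Ts) (length-odd j))
      (λ ρ → prepend τ-6-open tt (iterate τ-run-step j (λ ρ → prepend τ-close tt (F _)) _))
  τ-pair (suc i) zero    L = Laid-↭ (swap 6 (odd (suc i)) ↭-refl) (τ-pair zero (suc i) L)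
  τ-pair (suc i) (suc j) (n , e , Ts , r , F) =
    1 + (i + (2 + (j + (2 + n)))) , add-odd-odd i j n e , odd (suc i) ∷ odd (suc j) ∷ Ts , prep _ (prep _ r) ,
    recast (cong (rail ∷_) (cong (λ z → rails i (rail ∷ rail ∷ z)) (rails-+ j (2 + n)) ⟫ rails-+ i _))
      (cong₂ (λ y z → y ∷ z ∷ Ts) (length-odd′ i) (length-odd j))
      (λ ρ → prepend τ-open tt (iterate τ-run-step i (λ ρ → prepend τ-turn tt
        (iterate τ-run-step j (λ ρ → prepend τ-close tt (F _)) _)) _))

  add-odd-6 : ∀ j n {s} → 4 * n ≡ s → 4 * (1 + (j + (3 + n))) ≡ 6 + (odd (suc j) + s)
  add-odd-6 j n {s} e = lem j n ⟫ cong (λ z → 6 + (odd (suc j) + z)) e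
    where
    lem : ∀ j n → 4 * (1 + (j + (3 + n))) ≡ 6 + ((6 + (4 + j * 4)) + 4 * n)
    lem = solve-∀

  -- As for `τ`, except that a single 6 comes at the end of its partner's run, in `μ-close-6`.
  μ-pair : Adds-pairs μ
  μ-pair zero    zero    (n , e , Ts , r , F) =
    3 + n , add-66 n e , 6 ∷ 6 ∷ Ts , prep 6 (prep 6 r) , λ ρ → prepend μ-66 tt (F _)
  μ-pair zero    (suc j) (n , e , Ts , r , F) =
    1 + (j + (3 + n)) , add-odd-6 j n e , odd (suc j) ∷ 6 ∷ Ts , swap _ 6 r ,
    recast (cong (rail ∷_) (rails-+ j (3 + n))) (cong (λ z → z ∷ 6 ∷ Ts) (length-odd′ j))
      (λ ρ → prepend μ-open tt (iterate μ-run-step j (λ ρ → prepend μ-close-6 tt (F _)) _))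
  μ-pair (suc i) zero    L = Laid-↭ (swap 6 (odd (suc i)) ↭-refl) (μ-pair zero (suc i) L)
  μ-pair (suc i) (suc j) (n , e , Ts , r , F) =
    1 + (i + (2 + (j + (2 + n)))) , add-odd-odd i j n e , odd (suc i) ∷ odd (suc j) ∷ Ts , prep _ (prep _ r) ,
    recast (cong (rail ∷_) (cong (λ z → rails i (rail ∷ rail ∷ z)) (rails-+ j (2 + n)) ⟫ rails-+ i _))
      (cong₂ (λ y z → y ∷ z ∷ Ts) (length-odd′ i) (length-odd j))
      (λ ρ → prepend μ-open tt (iterate μ-run-step i (λ ρ → prepend μ-turn tt
        (iterate μ-run-step j (λ ρ → prepend μ-close tt (F _)) _)) _))

  add-quads : ∀ {σ} → Adds-quads σ → ∀ qs {T} → Laid σ σ T → Laid σ σ (map quad qs ++ T)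
  add-quads A []       L = L
  add-quads A (q ∷ qs) L = A q (add-quads A qs L)

  add-pairs : ∀ {σ} → Adds-pairs σ → ∀ ps {T} → Laid σ σ T → Laid σ σ (twoOdds ps ++ T)
  add-pairs A []             L = L
  add-pairs A ((o , p) ∷ ps) L = A o p (add-pairs A ps L)

  nothing-laid : ∀ σ → (∀ X → ends σ X ≡ []) → (∀ X → excess σ X ≡ 0) → Laid σ σ []
  nothing-laid σ h k = 0 , refl , [] , ↭-refl , λ ρ → finished σ ρ h k

  τ-fours : ∀ h {T} → Laid τ τ T → Laid τ τ (replicate (h * 2) 4 ++ T)
  τ-fours zero    L = L
  τ-fours (suc h) L with τ-fours h L
  ... | n , e , Ts , r , F = 2 + n , add-8 n e , 4 ∷ 4 ∷ Ts , prep 4 (prep 4 r) , λ ρ → prepend τ-44 tt (F _)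

  -- The column through the apex comes first; the last column consists of copies of the apex.
  ApexFirst : Frontier → Frontier → List ℕ → Set
  ApexFirst s e T = ∃ λ n → 4 * suc n ≡ sum T × ∃ λ Ts → Ts ↭ T × Fill s e (from-apex ∷ rails n []) 0 Ts

  -- Counted from the ordinary column at which the cycle of columns is cut, `a + 1` columns precede
  -- the apex column and `b` follow it.
  ApexInside : List ℕ → Set
  ApexInside T = ∃ λ a → ∃ λ b → 4 * (2 + (a + b)) ≡ sum T ×
                 ∃ λ Ts → Ts ↭ T × Fill μ μ (rails a (into-apex ∷ from-apex ∷ rails b [])) 0 Ts

  τ-apex-one : ∀ {T} → Laid τ τ T → ApexFirst τ-apex τ (4 ∷ T)
  τ-apex-one (n , e , Ts , r , F) = n , lem n ⟫ cong (4 +_) e , 4 ∷ Ts , prep 4 r , λ ρ → prepend τ-apex-4 tt (F _)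
    where
    lem : ∀ n → 4 * suc n ≡ 4 + 4 * n
    lem = solve-∀

  τ-apex-two : ∀ {T} → Laid τ τ T → ApexFirst τ-apex τ (4 ∷ 4 ∷ T)
  τ-apex-two (n , e , Ts , r , F) = suc n , add-8 n e , 4 ∷ 4 ∷ Ts , prep 4 (prep 4 r) , λ ρ → prepend τ-apex-44 tt (F _)

  κ-apex-quad : ∀ q {T} → Laid κ κ T → ApexFirst κ-apex κ (quad q ∷ T)
  κ-apex-quad zero    (n , e , Ts , r , F) = suc n , add-8 n e , 8 ∷ Ts , prep 8 r , λ ρ → prepend κ-apex-8 tt (F _)
  κ-apex-quad (suc i) (n , e , Ts , r , F) = i + (2 + n) , add-quad i n e , quad (suc i) ∷ Ts , prep _ r ,
    recast (cong (from-apex ∷_) (rails-+ i (2 + n))) (cong (_∷ Ts) (length-quad′ i))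
      (λ ρ → prepend κ-apex-open tt (iterate κ-run-step i (λ ρ → prepend κ-close tt (F _)) _))

  -- The passage of the apex uses up one pair of lengths. If both are at least 10, the first run
  -- extends up to the apex, where `μ-apex-turn` closes its cycle and opens the second; a 6 is
  -- closed by the gadget that passes the apex and opens its partner.
  μ-apex-pair : ∀ o p {T} → Laid μ μ T → ApexInside (odd o ∷ odd p ∷ T)
  μ-apex-pair zero    zero    (n , e , Ts , r , F) =
    0 , suc n , add-66 n e , 6 ∷ 6 ∷ Ts , prep 6 (prep 6 r) , λ ρ → prepend μ-apex-66 tt (F _)
  μ-apex-pair zero    (suc j) (n , e , Ts , r , F) =
    0 , j + (2 + n) , add-6-odd j n e , odd (suc j) ∷ 6 ∷ Ts , swap _ 6 r ,
    recast (cong (λ z → into-apex ∷ from-apex ∷ z) (rails-+ j (2 + n))) (cong (λ z → z ∷ 6 ∷ Ts) (length-odd j))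
      (λ ρ → prepend μ-6-apex-open tt (iterate μ-run-step j (λ ρ → prepend μ-close tt (F _)) _))
  μ-apex-pair (suc i) zero    L with μ-apex-pair zero (suc i) L
  ... | a , b , e , Ts , r , F = a , b , e ⟫ lem (odd (suc i)) _ , Ts , ↭-trans r (swap 6 (odd (suc i)) ↭-refl) , F
    where
    lem : ∀ y z → 6 + (y + z) ≡ y + (6 + z)
    lem = solve-∀
  μ-apex-pair (suc i) (suc j) {T} (n , e , Ts , r , F) =
    suc i , j + (2 + n) , lem i j n (sum T) e , odd (suc i) ∷ odd (suc j) ∷ Ts , prep _ (prep _ r) ,
    recast (cong (λ z → rails (suc i) (into-apex ∷ from-apex ∷ z)) (rails-+ j (2 + n)))
      (cong₂ (λ y z → y ∷ z ∷ Ts) (length-odd′ i) (length-odd j))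
      (λ ρ → prepend μ-open′ tt (iterate μ-run′-step i (λ ρ → prepend μ-apex-turn tt
        (iterate μ-run-step j (λ ρ → prepend μ-close tt (F _)) _)) _))
    where
    lem : ∀ i j n s → 4 * n ≡ s → 4 * (2 + (suc i + (j + (2 + n)))) ≡ odd (suc i) + (odd (suc j) + s)
    lem i j n s e = k i j n ⟫ add-odd-odd i j n e
      where
      k : ∀ i j n → 4 * (2 + (suc i + (j + (2 + n)))) ≡ 4 * (1 + (i + (2 + (j + (2 + n)))))
      k = solve-∀

  data Arrangement (T : List ℕ) : Set where
    by-τ : ApexFirst τ-apex τ T → Arrangement T
    by-κ : ApexFirst κ-apex κ T → Arrangement T
    by-μ : ApexInside T → Arrangement T

-- Cycle lengths modulo 4

data Shape : ℕ → Set where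
  four  : Shape 4
  quadˢ : ∀ q → Shape (quad q)
  oddˢ  : ∀ o → Shape (odd o)

shape : ∀ h → Shape (4 + h * 2)
shape zero          = four
shape (suc zero)    = oddˢ 0
shape (suc (suc h)) with 4 + h * 2 | shape h
... | _ | four    = quadˢ 0
... | _ | quadˢ q = quadˢ (suc q)
... | _ | oddˢ o  = oddˢ (suc o)

Even≥4 : ℕ → Set
Even≥4 c = ∃ λ h → c ≡ 4 + h * 2

-- lengths sorted by their residues modulo 4, the lengths ≡ 2 in pairs with at most one left over
record Sorted (T : List ℕ) : Set where
  field
    fours : ℕ
    quads : List ℕ
    duos  : List (ℕ × ℕ)
    solo  : List ℕ
    solo≤ : length solo ≤ 1
    order : T ↭ replicate fours 4 ++ map quad quads ++ twoOdds duos ++ map odd solo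

sorted : ∀ T → All Even≥4 T → Sorted T
sorted []      []       = record { fours = 0 ; quads = [] ; duos = [] ; solo = [] ; solo≤ = z≤n ; order = ↭-refl }
sorted (c ∷ T) (p ∷ ps) = insert (subst Shape (sym (proj₂ p)) (shape (proj₁ p))) (sorted T ps)
  where
  insert : ∀ {c T} → Shape c → Sorted T → Sorted (c ∷ T)
  insert four S = record { Sorted S ; fours = suc (Sorted.fours S) ; order = prep 4 (Sorted.order S) }
  insert (quadˢ q) S = record { Sorted S ; quads = q ∷ Sorted.quads S
    ; order = ↭-trans (prep _ (Sorted.order S)) (↭-sym (shift (quad q) (replicate (Sorted.fours S) 4) _)) }
  insert (oddˢ o) S with Sorted.solo S | Sorted.solo≤ S | Sorted.order S
  ... | [] | _ | r = record { Sorted S ; solo = o ∷ [] ; solo≤ = s≤s z≤n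
    ; order = ↭-trans (prep _ r) (↭-trans (↭-sym (shift (odd o) (replicate (Sorted.fours S) 4) _))
        (++⁺ˡ (replicate (Sorted.fours S) 4) (↭-trans (↭-sym (shift (odd o) (map quad (Sorted.quads S)) _))
          (++⁺ˡ (map quad (Sorted.quads S)) (↭-sym (shift (odd o) (twoOdds (Sorted.duos S)) _)))))) }
  ... | u ∷ [] | _ | r = record { Sorted S ; duos = (o , u) ∷ Sorted.duos S ; solo = [] ; solo≤ = z≤n
    ; order = ↭-trans (prep _ r) (↭-trans (↭-sym (shift (odd o) (replicate (Sorted.fours S) 4) _))
        (++⁺ˡ (replicate (Sorted.fours S) 4) (↭-trans (↭-sym (shift (odd o) (map quad (Sorted.quads S)) _))
          (++⁺ˡ (map quad (Sorted.quads S)) (prep (odd o) (shift (odd u) (twoOdds (Sorted.duos S)) []))))))  }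
  ... | _ ∷ _ ∷ _ | s≤s () | _

halve : ∀ f → (∃ λ h → f ≡ h * 2) ⊎ (∃ λ h → f ≡ suc (h * 2))
halve zero    = inj₁ (0 , refl)
halve (suc f) with halve f
... | inj₁ (h , refl) = inj₂ (h , refl)
... | inj₂ (h , refl) = inj₁ (suc h , refl)

Fourfold : ℕ → Set
Fourfold s = ∃ λ k → s ≡ k * 4

fourfold-+ : ∀ {a b} → Fourfold a → Fourfold b → Fourfold (a + b)
fourfold-+ (j , refl) (k , refl) = j + k , lem j k
  where
  lem : ∀ j k → j * 4 + k * 4 ≡ (j + k) * 4
  lem = solve-∀

fourfold-fours : ∀ f → Fourfold (sum (replicate f 4))
fourfold-fours zero    = 0 , refl
fourfold-fours (suc f) = fourfold-+ (1 , refl) (fourfold-fours f)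

fourfold-quads : ∀ qs → Fourfold (sum (map quad qs))
fourfold-quads []       = 0 , refl
fourfold-quads (q ∷ qs) = fourfold-+ (2 + q , refl) (fourfold-quads qs)

fourfold-duos : ∀ ds → Fourfold (sum (twoOdds ds))
fourfold-duos []             = 0 , refl
fourfold-duos ((o , p) ∷ ds) = subst Fourfold (+-assoc (odd o) (odd p) _) (fourfold-+ (3 + (o + p) , lem o p) (fourfold-duos ds))
  where
  lem : ∀ o p → (6 + o * 4) + (6 + p * 4) ≡ 12 + (o + p) * 4
  lem = solve-∀

-- The total is divisible by 4, so no length 2 modulo 4 stays unpaired. If 4 occurs, `τ` is taken,
-- and the parity of the number of 4s selects the gadget at the apex. Without 4s, `κ` serves when
-- all lengths are divisible by 4; otherwise one pair is spent on passing the apex under `μ`.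
arrangement : ∀ {V : Set} {T} → Sorted T → ∀ k → sum T ≡ suc k * 4 → Arrangement {V} T
arrangement {V} {T} S k e with Sorted.solo S | Sorted.solo≤ S | Sorted.order S
... | o ∷ [] | _ | r = ⊥-elim (2≢0 (sym (rem 2 (Y + o)) ⟫ cong (_% 4) eq ⟫ rem 0 (suc k)))
  where
  Q D : List ℕ
  Q = map quad (Sorted.quads S)
  D = twoOdds (Sorted.duos S)
  all : Fourfold (sum (replicate (Sorted.fours S) 4) + (sum Q + sum D))
  all = fourfold-+ (fourfold-fours (Sorted.fours S)) (fourfold-+ (fourfold-quads (Sorted.quads S)) (fourfold-duos (Sorted.duos S)))
  Y : ℕ
  Y = 1 + proj₁ all
  rem : ∀ a b → (a + b * 4) % 4 ≡ a % 4
  rem a b = [m+kn]%n≡m%n a b 4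
  2≢0 : 2 ≢ 0
  2≢0 ()
  eq : 2 + (Y + o) * 4 ≡ 0 + suc k * 4
  eq = lem (proj₁ all) o ⟫ cong (_+ (odd o + 0)) (sym (proj₂ all))
     ⟫ lem′ (sum (replicate (Sorted.fours S) 4)) (sum Q) (sum D) (odd o)
     ⟫ sym (sum-↭ r ⟫ sum-++ (replicate (Sorted.fours S) 4) _
            ⟫ cong (sum (replicate (Sorted.fours S) 4) +_) (sum-++ Q _ ⟫ cong (sum Q +_) (sum-++ D _)))
     ⟫ e
    where
    lem : ∀ y o → 2 + (1 + y + o) * 4 ≡ y * 4 + (6 + o * 4 + 0)
    lem = solve-∀
    lem′ : ∀ a b c d → (a + (b + c)) + (d + 0) ≡ a + (b + (c + (d + 0)))
    lem′ = solve-∀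
... | _ ∷ _ ∷ _ | s≤s () | _
... | [] | _ | r with halve (Sorted.fours S)
...   | inj₂ (h , p) = by-τ (move (τ-apex-one (τ-fours h (add-quads τ-quad (Sorted.quads S)
                        (add-pairs τ-pair (Sorted.duos S) (nothing-laid τ (λ _ → refl) (λ _ → refl)))))))
  where
  r′ : _ ↭ _
  r′ = ↭-sym (subst (λ f → T ↭ replicate f 4 ++ map quad (Sorted.quads S) ++ twoOdds (Sorted.duos S) ++ []) p r)
  move : ApexFirst _ _ _ → ApexFirst τ-apex τ T
  move (n , q , Ts , u , F) = n , (q ⟫ sum-↭ r′) , Ts , ↭-trans u r′ , F
...   | inj₁ (suc h , p) = by-τ (move (τ-apex-two (τ-fours h (add-quads τ-quad (Sorted.quads S)
                        (add-pairs τ-pair (Sorted.duos S) (nothing-laid τ (λ _ → refl) (λ _ → refl)))))))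
  where
  r′ : _ ↭ _
  r′ = ↭-sym (subst (λ f → T ↭ replicate f 4 ++ map quad (Sorted.quads S) ++ twoOdds (Sorted.duos S) ++ []) p r)
  move : ApexFirst _ _ _ → ApexFirst τ-apex τ T
  move (n , q , Ts , u , F) = n , (q ⟫ sum-↭ r′) , Ts , ↭-trans u r′ , F
...   | inj₁ (zero , p) with Sorted.quads S | Sorted.duos S | subst (λ f → T ↭ replicate f 4 ++ map quad (Sorted.quads S) ++ twoOdds (Sorted.duos S) ++ []) p r
...     | [] | [] | r′ = ⊥-elim (absurd (sym (sum-↭ r′) ⟫ e))
  where
  absurd : 0 ≢ suc k * 4
  absurd ()
...     | q ∷ qs | [] | r′ = by-κ (move (κ-apex-quad q (add-quads κ-quad qs (nothing-laid κ (λ _ → refl) (λ _ → refl)))))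
  where
  move : ApexFirst _ _ _ → ApexFirst κ-apex κ T
  move (n , q , Ts , u , F) = n , (q ⟫ sym (sum-↭ r′)) , Ts , ↭-trans u (↭-sym r′) , F
...     | qs | (o , p) ∷ ds | r′ = by-μ (move (μ-apex-pair o p (add-quads μ-quad qs (add-pairs μ-pair ds (nothing-laid μ (λ _ → refl) (λ _ → refl))))))
  where
  r″ : odd o ∷ odd p ∷ map quad qs ++ twoOdds ds ++ [] ↭ T
  r″ = ↭-sym (↭-trans r′ (↭-trans (shift (odd o) (map quad qs) _) (prep (odd o) (shift (odd p) (map quad qs) _))))
  move : ApexInside _ → ApexInside T
  move (a , b , q , Ts , u , F) = a , b , (q ⟫ sum-↭ r″) , Ts , ↭-trans u r″ , F

-- Wrapping tilings around the ladder

split : ∀ {A : Set} n m (xs : List A) → length xs ≡ n + suc m →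
        ∃ λ ys → ∃₂ λ z zs → xs ≡ ys ++ z ∷ zs × length ys ≡ n × length zs ≡ m
split zero    m (x ∷ xs) e = [] , x , xs , refl , refl , suc-injective e
split (suc n) m (x ∷ xs) e with split n m xs (suc-injective e)
... | ys , z , zs , refl , p , q = x ∷ ys , z , zs , refl , cong suc p , q

module _ {V : Set} where

  Column : Set
  Column = V × V × V × V

  corner : Column → ℕ → V
  corner (a , b , c , d) 0 = a
  corner (a , b , c , d) 1 = b
  corner (a , b , c , d) 2 = c
  corner (a , b , c , d) _ = d

  -- Labels beyond the listed columns fall into `z`, the column on which the last gap lands.
  at : List Column → Column → ℕ → V
  at []                   z n = corner z n
  at ((a , b , c , d) ∷ cs) z 0 = a
  at ((a , b , c , d) ∷ cs) z 1 = b
  at ((a , b , c , d) ∷ cs) z 2 = c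
  at ((a , b , c , d) ∷ cs) z 3 = d
  at (_ ∷ cs) z (suc (suc (suc (suc n)))) = at cs z n

  headOr : List Column → Column → Column
  headOr []      z = z
  headOr (c ∷ _) z = c

  columnSum : (V → V → ℕ) → Column → ℕ
  columnSum f c = edgeSum (λ i j → f (corner c i) (corner c j)) column

  gapSum : (V → V → ℕ) → Link → Column → Column → ℕ
  gapSum f l c c′ = edgeSum (λ i j → f (at [ c ] c′ i) (at [ c ] c′ j)) (gap l)

  nodeSum : (V → ℕ) → Column → ℕ
  nodeSum g (a , b , c , d) = g a + (g b + (g c + g d))

  regionSum : (V → V → ℕ) → List Link → (ℕ → V) → ℕ
  regionSum f ls ρ = edgeSum (λ i j → f (ρ i) (ρ j)) (region ls)

  regionSum-∷ : ∀ f l ls c cs z → regionSum f (l ∷ ls) (at (c ∷ cs) z)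
              ≡ columnSum f c + (gapSum f l c (headOr cs z) + regionSum f ls (at cs z))
  regionSum-∷ f l ls c cs z =
    ∑-++ φ column (gap l ++ map (aheadᴱ [ l ]) (region ls))
    ⟫ cong₂ _+_ (col c) (∑-++ φ (gap l) _ ⟫ cong₂ _+_ (gp l c cs) (∑-map φ (aheadᴱ [ l ]) (region ls)))
    where
    φ : ℕ × ℕ → ℕ
    φ = uncurry (λ i j → f (at (c ∷ cs) z i) (at (c ∷ cs) z j))
    col : ∀ c → ∑ (uncurry (λ i j → f (at (c ∷ cs) z i) (at (c ∷ cs) z j))) column ≡ columnSum f c
    col (_ , _ , _ , _) = refl
    gp : ∀ l c cs → ∑ (uncurry (λ i j → f (at (c ∷ cs) z i) (at (c ∷ cs) z j))) (gap l) ≡ gapSum f l c (headOr cs z)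
    gp rail      c []      = refl
    gp rail      c ((_ , _ , _ , _) ∷ _) = refl
    gp into-apex c []      = refl
    gp into-apex c ((_ , _ , _ , _) ∷ _) = refl
    gp from-apex c []      = refl
    gp from-apex c ((_ , _ , _ , _) ∷ _) = refl

  cornersSum-∷ : ∀ (g : V → ℕ) l ls c cs z → ∑ (g ∘ at (c ∷ cs) z) (corners (l ∷ ls)) ≡ nodeSum g c + ∑ (g ∘ at cs z) (corners ls)
  cornersSum-∷ g l ls c@(p , q , r , s) cs z =
    cong (λ y → g p + (g q + (g r + (g s + y)))) (∑-map (g ∘ at (c ∷ cs) z) (ahead [ l ]) (corners ls))
    ⟫ lem (g p) (g q) (g r) (g s) (∑ (g ∘ at cs z) (corners ls))
    where
    lem : ∀ a b c d e → a + (b + (c + (d + e))) ≡ (a + (b + (c + d))) + e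
    lem = solve-∀

  at-ahead : ∀ ls cs z n → length cs ≡ length ls → at cs z (ahead ls n) ≡ corner z n
  at-ahead []       []       z n e = refl
  at-ahead (_ ∷ ls) (_ ∷ cs) z n e = at-ahead ls cs z n (suc-injective e)

  chainSum : (V → V → ℕ) → List Column → Column → ℕ
  chainSum f []       z = 0
  chainSum f (c ∷ cs) z = columnSum f c + (gapSum f rail c (headOr cs z) + chainSum f cs z)

  climbSum : (V → V → ℕ) → List Column → Column → ℕ
  climbSum f []            ω = 0
  climbSum f (c ∷ [])      ω = columnSum f c + (gapSum f into-apex c ω + 0)
  climbSum f (c ∷ d ∷ cs)  ω = columnSum f c + (gapSum f rail c d + climbSum f (d ∷ cs) ω)

  -- The cyclic ladder cut at the apex column: it leaves `ω` by `from-apex`, and the climb along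
  -- `ds` returns to `ω` by `into-apex`.
  ladderSum : (V → V → ℕ) → Column → List Column → ℕ
  ladderSum f ω ds = columnSum f ω + (gapSum f from-apex ω (headOr ds ω) + climbSum f ds ω)

  regionSum-rails : ∀ f cs z → regionSum f (rails (length cs) []) (at cs z) ≡ chainSum f cs z
  regionSum-rails f []       z = refl
  regionSum-rails f (c ∷ cs) z = regionSum-∷ f rail (rails (length cs) []) c cs z
    ⟫ cong (λ y → columnSum f c + (gapSum f rail c (headOr cs z) + y)) (regionSum-rails f cs z)

  regionSum-into : ∀ f tl c ys ω xs z → regionSum f (rails (length ys) (into-apex ∷ tl)) (at ((c ∷ ys) ++ ω ∷ xs) z)
                 ≡ climbSum f (c ∷ ys) ω + regionSum f tl (at (ω ∷ xs) z)
  regionSum-into f tl c [] ω xs z = regionSum-∷ f into-apex tl c (ω ∷ xs) z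
    ⟫ lem (columnSum f c) (gapSum f into-apex c ω) (regionSum f tl (at (ω ∷ xs) z))
    where
    lem : ∀ a b d → a + (b + d) ≡ (a + (b + 0)) + d
    lem = solve-∀
  regionSum-into f tl c (y ∷ ys) ω xs z = regionSum-∷ f rail (rails (length ys) (into-apex ∷ tl)) c ((y ∷ ys) ++ ω ∷ xs) z
    ⟫ cong (λ w → columnSum f c + (gapSum f rail c y + w)) (regionSum-into f tl y ys ω xs z)
    ⟫ lem (columnSum f c) (gapSum f rail c y) (climbSum f (y ∷ ys) ω) (regionSum f tl (at (ω ∷ xs) z))
    where
    lem : ∀ a b d e → a + (b + (d + e)) ≡ (a + (b + d)) + e
    lem = solve-∀

  cornersSum : ∀ (g : V → ℕ) ls cs z → length cs ≡ length ls → ∑ (g ∘ at cs z) (corners ls) ≡ ∑ (nodeSum g) cs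
  cornersSum g []       []       z e = refl
  cornersSum g (l ∷ ls) (c ∷ cs) z e = cornersSum-∷ g l ls c cs z ⟫ cong (nodeSum g c +_) (cornersSum g ls cs z (suc-injective e))

  length-rails : ∀ n tl → length (rails n tl) ≡ n + length tl
  length-rails zero    tl = refl
  length-rails (suc n) tl = cong suc (length-rails n tl)

  climb-++ : ∀ f xs y ys ω → climbSum f (xs ++ y ∷ ys) ω ≡ chainSum f xs y + climbSum f (y ∷ ys) ω
  climb-++ f []           y ys ω = refl
  climb-++ f (x ∷ [])     y ys ω = lem (columnSum f x) (gapSum f rail x y) (climbSum f (y ∷ ys) ω)
    where
    lem : ∀ a b c → a + (b + c) ≡ (a + (b + 0)) + c
    lem = solve-∀
  climb-++ f (x ∷ x′ ∷ xs) y ys ω = cong (λ w → columnSum f x + (gapSum f rail x x′ + w)) (climb-++ f (x′ ∷ xs) y ys ω)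
    ⟫ lem (columnSum f x) (gapSum f rail x x′) (chainSum f (x′ ∷ xs) y) (climbSum f (y ∷ ys) ω)
    where
    lem : ∀ a b c d → a + (b + (c + d)) ≡ (a + (b + c)) + d
    lem = solve-∀

  -- The copies of the apex appear in opposite orders in the two halves. Labels 0 and 2 are then
  -- distinct copies, and so are 1 and 3, as the vertices seen in `τ` and `κ` require.
  folded : Column → Column
  folded (a , b , _ , _) = a , b , b , a

  -- The last column of a chain may be replaced by the two copies of the apex, each listed twice.
  chain-folded : ∀ f c cs ω → chainSum f (c ∷ cs) (folded ω) ≡ climbSum f (c ∷ cs) ω
  chain-folded f (p , q , r , s) [] (a , b , _ , _) = cong (columnSum f (p , q , r , s) +_)
    (lem (f r a) (f r b) (f s a) (f s b) (f p b) (f p a) (f q b) (f q a))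
    where
    lem : ∀ a b c d e h i j → (a + (b + (c + (d + (e + (h + (i + (j + 0)))))))) + 0 ≡ (a + (b + (c + (d + (h + (e + (j + (i + 0)))))))) + 0
    lem = solve-∀
  chain-folded f c (d ∷ cs) ω = cong (λ w → columnSum f c + (gapSum f rail c d + w)) (chain-folded f d cs ω)

  record Triple (ω : Column) (ds : List Column) (T : List ℕ) : Set where
    field
      factor   : Colour → List (List V)
      matching : List (V × V)
      edges    : ∀ f → Symmetric f →
                 ∑ (λ X → ∑ (cycleSum f) (factor X)) colours + edgeSum f matching ≡ ladderSum f ω ds
      spans    : ∀ X g → ∑ (∑ g) (factor X) ≡ ∑ (nodeSum g) (ω ∷ ds)
      spansᴹ   : ∀ g → ∑ g (endpoints matching) ≡ ∑ (nodeSum g) (ω ∷ ds)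
      type     : ∀ X → map length (factor X) ↭ T

  -- The tiling is closed into a ring: once its last column is identified with its first, the used
  -- edges and the seen vertices of the two frontiers coincide and cancel.
  from-tiling : ∀ {s e ls Ts T} {ρ : ℕ → V} {ω ds} → Ts ↭ T → Tiling s e ls ρ 0 Ts → (∀ X → ends s X ≡ []) →
    (∀ f → regionSum f ls ρ ≡ ladderSum f ω ds) →
    (∀ f → edgeSum (λ i j → f (ρ (ahead ls i)) (ρ (ahead ls j))) (done e) ≡ edgeSum (λ i j → f (ρ i) (ρ j)) (done s)) →
    (∀ g → ∑ (g ∘ ρ) (corners ls) ≡ ∑ (nodeSum g) (ω ∷ ds)) →
    (∀ X g → ∑ (g ∘ ρ ∘ ahead ls) (seen e X) ≡ ∑ (g ∘ ρ) (seen s X)) →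
    (∀ g → ∑ (g ∘ ρ ∘ ahead ls) (seenᴹ e) ≡ ∑ (g ∘ ρ) (seenᴹ s)) →
    Triple ω ds T
  from-tiling {s} {e} {ls} {Ts} {T} {ρ} {ω} {ds} p t h r d c v m = record
    { factor   = Tiling.cycles t
    ; matching = Tiling.matching t
    ; edges    = λ f f-sym → +-cancelʳ-≡ (edgeSum (λ i j → f (ρ i) (ρ j)) (done s)) _ _
        (cong (λ z → (z + edgeSum f (Tiling.matching t)) + edgeSum (λ i j → f (ρ i) (ρ j)) (done s))
           (∑-cong (λ X → sym (cong (∑ (cycleSum f) (Tiling.cycles t X) +_) (none X (Tiling.fillSum t f X)) ⟫ +-identityʳ _)) colours)
         ⟫ Tiling.edges t f f-sym ⟫ cong₂ _+_ (r f) (d f))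
    ; spans    = λ X g → +-cancelʳ-≡ (∑ (g ∘ ρ) (seen s X)) _ _
        (cong (_+ ∑ (g ∘ ρ) (seen s X)) (sym (cong (∑ (∑ g) (Tiling.cycles t X) +_) (none X (λ j → ∑ g (Tiling.fill t X j))) ⟫ +-identityʳ _))
         ⟫ Tiling.verts t X g ⟫ cong₂ _+_ (c g) (v X g))
    ; spansᴹ   = λ g → +-cancelʳ-≡ (∑ (g ∘ ρ) (seenᴹ s)) _ _ (Tiling.vertsᴹ t g ⟫ cong₂ _+_ (c g) (m g))
    ; type     = λ X → ↭-trans (↭-reflexive (Tiling.lens t X)) p
    }
    where
    none : ∀ X (φ : ℕ → ℕ) → ∑ φ (gaps s X) ≡ 0
    none X φ rewrite h X = refl

  apexFirst-triple : ∀ {s e} {T} ω d ds → (∀ X → ends s X ≡ []) → done s ≡ [] → done e ≡ [] →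
    (∀ X (g : V → ℕ) → ∑ (g ∘ corner (folded ω)) (seen e X) ≡ ∑ (g ∘ corner ω) (seen s X)) →
    (∀ X (g : V → ℕ) cs z → ∑ (g ∘ at (ω ∷ cs) z) (seen s X) ≡ ∑ (g ∘ corner ω) (seen s X)) →
    seenᴹ s ≡ [] → seenᴹ e ≡ [] →
    ApexFirst {V} s e T → sum T ≡ (2 + length ds) * 4 → Triple ω (d ∷ ds) T
  apexFirst-triple {s} {e} {T} ω d ds h ds≡ de≡ v w ms me (n , q , Ts , u , F) total =
    from-tiling u (F ρ) h
      (λ f → cong (λ n → regionSum f (from-apex ∷ rails n []) ρ) n≡ ⟫ regionSum-∷ f from-apex (rails (length (d ∷ ds)) []) ω (d ∷ ds) (folded ω)
         ⟫ cong (λ y → columnSum f ω + (gapSum f from-apex ω d + y)) (regionSum-rails f (d ∷ ds) (folded ω) ⟫ chain-folded f d ds ω))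
      (λ f → cong (edgeSum _) de≡ ⟫ sym (cong (edgeSum (λ i j → f (ρ i) (ρ j))) ds≡))
      (λ g → cornersSum g (from-apex ∷ rails n []) (ω ∷ d ∷ ds) (folded ω) len)
      (λ X g → ∑-cong (λ i → cong g (at-ahead (from-apex ∷ rails n []) (ω ∷ d ∷ ds) (folded ω) i len)) (seen e X) ⟫ v X g ⟫ sym (w X g (d ∷ ds) (folded ω)))
      (λ g → cong (∑ _) me ⟫ sym (cong (∑ (g ∘ ρ)) ms))
    where
    ρ : ℕ → V
    ρ = at (ω ∷ d ∷ ds) (folded ω)
    n≡ : n ≡ suc (length ds)
    n≡ = suc-injective (*-cancelˡ-≡ _ _ 4 (q ⟫ total ⟫ *-comm (2 + length ds) 4))
    len : length (ω ∷ d ∷ ds) ≡ length (from-apex ∷ rails n [])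
    len = cong suc (sym (length-rails n [] ⟫ +-identityʳ n ⟫ n≡))

  triple : ∀ {T} → Sorted T → ∀ ω d ds → sum T ≡ (2 + length ds) * 4 → Triple ω (d ∷ ds) T
  triple {T} S ω@(a , b , _ , _) d ds total with arrangement {V} S (suc (length ds)) total
  ... | by-τ A = apexFirst-triple ω d ds (λ _ → refl) refl refl
          (λ { red g → refl ; green g → refl ; blue g → lem (g b) (g a) })
          (λ { red g cs z → refl ; green g cs z → refl ; blue g cs z → refl }) refl refl A total
    where
    lem : ∀ x y → x + (y + 0) ≡ y + (x + 0)
    lem = solve-∀
  ... | by-κ A = apexFirst-triple ω d ds (λ _ → refl) refl refl
          (λ { red g → refl ; green g → refl ; blue g → refl })
          (λ { red g cs z → refl ; green g cs z → refl ; blue g cs z → refl }) refl refl A total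
  -- The ring of columns is rotated to start at `y`: the `m + 1` columns from `y` on lead up to the
  -- apex, and the `n` columns before `y` follow it.
  ... | by-μ (m , n , q , Ts , u , F) with split n m (d ∷ ds) size
    where
    size : length (d ∷ ds) ≡ n + suc m
    size = sym (lem n m ⟫ suc-injective (*-cancelˡ-≡ _ _ 4 (q ⟫ total ⟫ *-comm (2 + length ds) 4)))
      where
      lem : ∀ n m → n + suc m ≡ suc (m + n)
      lem = solve-∀
  ...   | xs , y@(y₀ , y₁ , y₂ , y₃) , ys , eq , refl , refl = subst (λ l → Triple ω l T) (sym eq)
    (from-tiling u (F ρ) (λ _ → refl)
      (λ f → regionSum-into f (from-apex ∷ rails n []) y ys ω xs y
         ⟫ cong (climbSum f (y ∷ ys) ω +_) (regionSum-∷ f from-apex (rails n []) ω xs y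
             ⟫ cong (λ w → columnSum f ω + (gapSum f from-apex ω (headOr xs y) + w)) (regionSum-rails f xs y))
         ⟫ lem (climbSum f (y ∷ ys) ω) (columnSum f ω) (gapSum f from-apex ω (headOr xs y)) (chainSum f xs y)
         ⟫ cong₂ (λ v w → columnSum f ω + (gapSum f from-apex ω v + w)) (head-++ xs) (sym (climb-++ f xs y ys ω)))
      (λ f → ∑-cong (λ (i , j) → cong₂ f (at-ahead ls cs y i len) (at-ahead ls cs y j len)) (done μ))
      (λ g → cornersSum g ls cs y len ⟫ ∑-++ (nodeSum g) (y ∷ ys) (ω ∷ xs)
         ⟫ lem′ (∑ (nodeSum g) (y ∷ ys)) (nodeSum g ω) (∑ (nodeSum g) xs)
         ⟫ cong (nodeSum g ω +_) (sym (∑-++ (nodeSum g) xs (y ∷ ys))))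
      (λ { red g → refl
         ; green g → ∑-cong (λ i → cong g (at-ahead ls cs y i len)) (seen μ green)
         ; blue g → ∑-cong (λ i → cong g (at-ahead ls cs y i len)) (seen μ blue) })
      (λ g → ∑-cong (λ i → cong g (at-ahead ls cs y i len)) (seenᴹ μ)))
    where
    ls : List Link
    ls = rails m (into-apex ∷ from-apex ∷ rails n [])
    cs : List Column
    cs = (y ∷ ys) ++ ω ∷ xs
    ρ : ℕ → V
    ρ = at cs y
    len : length cs ≡ length ls
    len = length-++ (y ∷ ys) {ω ∷ xs} ⟫ lem″ m n ⟫ cong (λ w → m + (2 + w)) (sym (length-rails n [] ⟫ +-identityʳ n))
      ⟫ sym (length-rails m (into-apex ∷ from-apex ∷ rails n []))
      where
      lem″ : ∀ m n → suc m + suc n ≡ m + (2 + n)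
      lem″ = solve-∀
    head-++ : ∀ xs → headOr xs y ≡ headOr (xs ++ y ∷ ys) ω
    head-++ []      = refl
    head-++ (_ ∷ _) = refl
    lem : ∀ a b c d → a + (b + (c + d)) ≡ b + (c + (d + a))
    lem = solve-∀
    lem′ : ∀ a b c → a + (b + c) ≡ b + (c + a)
    lem′ = solve-∀

-- Häggkvist's doubling of a cycle

module _ {A : Set} where

  doubled : (A × Bool → A × Bool → ℕ) → A → A → ℕ
  doubled f a b = (f (a , false) (b , false) + f (a , false) (b , true)) + (f (a , true) (b , false) + f (a , true) (b , true))

  bothCopies : (A × Bool → ℕ) → A → ℕ
  bothCopies g a = g (a , false) + g (a , true)

  -- Out along the first copies, a turn at `e`, and back along the second copies. `crossing` changes
  -- the copy at every step instead, so that together they use all four edges over each interior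
  -- edge of the path.
  straight : List A → A × Bool → List (A × Bool)
  straight []       e = [ e ]
  straight (y ∷ ys) e = (y , false) ∷ straight ys e ++ [ y , true ]

  crossing : Bool → List A → A × Bool → List (A × Bool)
  crossing b []       e = [ e ]
  crossing b (y ∷ ys) e = (y , b) ∷ crossing (not b) ys e ++ [ y , not b ]

  module _ (f : A × Bool → A × Bool → ℕ) (f-sym : Symmetric f) where

    hairpins : ∀ b y ys e →
      pathSum f (y , false) (straight ys (e , true)) (y , true) + pathSum f (y , b) (crossing (not b) ys (e , false)) (y , not b)
      ≡ pathSum (doubled f) y ys e
    hairpins false y [] e = cong₂ (λ u v → (f (y , false) (e , true) + u) + (f (y , false) (e , false) + v))
        (f-sym (e , true) (y , true)) (f-sym (e , false) (y , true))
      ⟫ lem (f (y , false) (e , true)) (f (y , true) (e , true)) (f (y , false) (e , false)) (f (y , true) (e , false))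
      where
      lem : ∀ a b c d → (a + b) + (c + d) ≡ (c + a) + (d + b)
      lem = solve-∀
    hairpins true y [] e = cong₂ (λ u v → (f (y , false) (e , true) + u) + (f (y , true) (e , false) + v))
        (f-sym (e , true) (y , true)) (f-sym (e , false) (y , false))
      ⟫ lem (f (y , false) (e , true)) (f (y , true) (e , true)) (f (y , true) (e , false)) (f (y , false) (e , false))
      where
      lem : ∀ a b c d → (a + b) + (c + d) ≡ (d + a) + (c + b)
      lem = solve-∀
    hairpins false y (x ∷ ys) e =
      cong₂ (λ u v → (f (y , false) (x , false) + u) + (f (y , false) (x , true) + v))
        (pathSum-++ f (x , false) (straight ys (e , true)) (x , true) [] (y , true) ⟫ cong (pathSum f (x , false) (straight ys (e , true)) (x , true) +_) (f-sym (x , true) (y , true)))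
        (pathSum-++ f (x , true) (crossing false ys (e , false)) (x , false) [] (y , true) ⟫ cong (pathSum f (x , true) (crossing false ys (e , false)) (x , false) +_) (f-sym (x , false) (y , true)))
      ⟫ lem (f (y , false) (x , false)) (pathSum f (x , false) (straight ys (e , true)) (x , true)) (f (y , true) (x , true))
            (f (y , false) (x , true)) (pathSum f (x , true) (crossing false ys (e , false)) (x , false)) (f (y , true) (x , false))
      ⟫ cong (doubled f y x +_) (hairpins true x ys e)
      where
      lem : ∀ a b c d p q → (a + (b + c)) + (d + (p + q)) ≡ ((a + d) + (q + c)) + (b + p)
      lem = solve-∀
    hairpins true y (x ∷ ys) e =
      cong₂ (λ u v → (f (y , false) (x , false) + u) + (f (y , true) (x , false) + v))
        (pathSum-++ f (x , false) (straight ys (e , true)) (x , true) [] (y , true) ⟫ cong (pathSum f (x , false) (straight ys (e , true)) (x , true) +_) (f-sym (x , true) (y , true)))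
        (pathSum-++ f (x , false) (crossing true ys (e , false)) (x , true) [] (y , false) ⟫ cong (pathSum f (x , false) (crossing true ys (e , false)) (x , true) +_) (f-sym (x , true) (y , false)))
      ⟫ lem (f (y , false) (x , false)) (pathSum f (x , false) (straight ys (e , true)) (x , true)) (f (y , true) (x , true))
            (f (y , true) (x , false)) (pathSum f (x , false) (crossing true ys (e , false)) (x , true)) (f (y , false) (x , true))
      ⟫ cong (doubled f y x +_) (hairpins false x ys e)
      where
      lem : ∀ a b c d p q → (a + (b + c)) + (d + (p + q)) ≡ ((a + q) + (d + c)) + (b + p)
      lem = solve-∀

    -- At the start the straight cycle takes both edges from the first copy of `y` and the crossing
    -- cycle both from the second. At the turn the straight cycle uses the second copy of `e` and
    -- the crossing cycle the first.
    block-edges : ∀ y x xs e →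
      cycleSum f ((y , false) ∷ straight (x ∷ xs) (e , true)) + cycleSum f ((y , true) ∷ crossing false (x ∷ xs) (e , false))
      ≡ pathSum (doubled f) y (x ∷ xs) e
    block-edges y x xs e =
      cong₂ (λ u v → (f (y , false) (x , false) + u) + (f (y , true) (x , false) + v))
        (pathSum-++ f (x , false) (straight xs (e , true)) (x , true) [] (y , false) ⟫ cong (pathSum f (x , false) (straight xs (e , true)) (x , true) +_) (f-sym (x , true) (y , false)))
        (pathSum-++ f (x , false) (crossing true xs (e , false)) (x , true) [] (y , true) ⟫ cong (pathSum f (x , false) (crossing true xs (e , false)) (x , true) +_) (f-sym (x , true) (y , true)))
      ⟫ lem (f (y , false) (x , false)) (pathSum f (x , false) (straight xs (e , true)) (x , true)) (f (y , false) (x , true))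
            (f (y , true) (x , false)) (pathSum f (x , false) (crossing true xs (e , false)) (x , true)) (f (y , true) (x , true))
      ⟫ cong (doubled f y x +_) (hairpins false x xs e)
      where
      lem : ∀ a b c d p q → (a + (b + c)) + (d + (p + q)) ≡ ((a + c) + (d + q)) + (b + p)
      lem = solve-∀

  straight-nodes : ∀ g ys e → ∑ g (straight ys e) ≡ ∑ (bothCopies g) ys + g e
  straight-nodes g []       e = +-identityʳ _
  straight-nodes g (y ∷ ys) e = cong (g (y , false) +_) (∑-++ g (straight ys e) _ ⟫ cong (_+ (g (y , true) + 0)) (straight-nodes g ys e))
    ⟫ lem (g (y , false)) (∑ (bothCopies g) ys) (g e) (g (y , true))
    where
    lem : ∀ a b c d → a + ((b + c) + (d + 0)) ≡ ((a + d) + b) + c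
    lem = solve-∀

  crossing-nodes : ∀ g b ys e → ∑ g (crossing b ys e) ≡ ∑ (bothCopies g) ys + g e
  crossing-nodes g b []       e = +-identityʳ _
  crossing-nodes g b (y ∷ ys) e = cong (g (y , b) +_) (∑-++ g (crossing (not b) ys e) _ ⟫ cong (_+ (g (y , not b) + 0)) (crossing-nodes g (not b) ys e))
    ⟫ lem (g (y , b)) (∑ (bothCopies g) ys) (g e) (g (y , not b)) ⟫ cong (λ z → (z + ∑ (bothCopies g) ys) + g e) (flip b)
    where
    lem : ∀ a b c d → a + ((b + c) + (d + 0)) ≡ ((a + d) + b) + c
    lem = solve-∀
    flip : ∀ b → g (y , b) + g (y , not b) ≡ bothCopies g y
    flip false = refl
    flip true  = +-comm (g (y , true)) _

  length-straight : ∀ ys e → suc (length (straight ys e)) ≡ suc (length ys) * 2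
  length-straight ys e = cong suc (sym (∑-one (straight ys e)) ⟫ straight-nodes (λ _ → 1) ys e ⟫ cong (_+ 1) (twice ys)) ⟫ lem (length ys)
    where
    twice : ∀ ys → ∑ (λ _ → 2) ys ≡ length ys * 2
    twice []       = refl
    twice (y ∷ ys) = cong (2 +_) (twice ys)
    lem : ∀ n → suc (n * 2 + 1) ≡ suc n * 2
    lem = solve-∀

  length-crossing : ∀ b ys e → suc (length (crossing b ys e)) ≡ suc (length ys) * 2
  length-crossing b ys e = cong suc (sym (∑-one (crossing b ys e)) ⟫ crossing-nodes (λ _ → 1) b ys e
    ⟫ sym (straight-nodes (λ _ → 1) ys e) ⟫ ∑-one (straight ys e)) ⟫ length-straight ys e

  -- Häggkvist's doubling construction along the path y, ys, z: the first factor contains only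
  -- the first copy of y and, beyond the path, the second copy of z.
  record Halves (rs : List ℕ) (y : A) (ys : List A) (z : A) : Set where
    field
      first second : List (List (A × Bool))
      edges  : ∀ f → Symmetric f → ∑ (cycleSum f) first + ∑ (cycleSum f) second ≡ pathSum (doubled f) y ys z
      nodes₁ : ∀ g → ∑ (∑ g) first  + g (y , true)  ≡ ∑ (bothCopies g) (y ∷ ys) + g (z , true)
      nodes₂ : ∀ g → ∑ (∑ g) second + g (y , false) ≡ ∑ (bothCopies g) (y ∷ ys) + g (z , false)
      type₁  : map length first  ≡ map (_* 2) rs
      type₂  : map length second ≡ map (_* 2) rs

  -- Successive blocks share the border vertex `w`: in the first factor a cycle turns at its second
  -- copy and the next cycle starts at its first copy, in the second factor conversely. Since `r` is
  -- at least 2, each block has an interior vertex and its cycles have length at least 4.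
  halves : ∀ r rs → 2 ≤ r → All (2 ≤_) rs → ∀ y ys z → suc (length ys) ≡ r + sum rs → Halves (r ∷ rs) y ys z
  halves (suc (suc r)) [] _ [] y (x ∷ xs) z e = record
    { first = [ (y , false) ∷ straight (x ∷ xs) (z , true) ] ; second = [ (y , true) ∷ crossing false (x ∷ xs) (z , false) ]
    ; edges  = λ f f-sym → cong₂ _+_ (+-identityʳ (cycleSum f ((y , false) ∷ straight (x ∷ xs) (z , true)))) (+-identityʳ (cycleSum f ((y , true) ∷ crossing false (x ∷ xs) (z , false)))) ⟫ block-edges f f-sym y x xs z
    ; nodes₁ = λ g → cong (λ w → ((g (y , false) + w) + 0) + g (y , true)) (straight-nodes g (x ∷ xs) (z , true))
                 ⟫ lem (g (y , false)) (∑ (bothCopies g) (x ∷ xs)) _ _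
    ; nodes₂ = λ g → cong (λ w → ((g (y , true) + w) + 0) + g (y , false)) (crossing-nodes g false (x ∷ xs) (z , false))
                 ⟫ lem′ (g (y , true)) (∑ (bothCopies g) (x ∷ xs)) _ _
    ; type₁  = cong [_] (length-straight (x ∷ xs) (z , true) ⟫ cong (_* 2) (e ⟫ +-identityʳ _))
    ; type₂  = cong [_] (length-crossing false (x ∷ xs) (z , false) ⟫ cong (_* 2) (e ⟫ +-identityʳ _)) }
    where
    lem : ∀ a b c d → ((a + (b + c)) + 0) + d ≡ ((a + d) + b) + c
    lem = solve-∀
    lem′ : ∀ a b c d → ((a + (b + c)) + 0) + d ≡ ((d + a) + b) + c
    lem′ = solve-∀
  halves (suc (suc r)) [] _ [] y [] z ()
  halves (suc zero) _ (s≤s ())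
  halves (suc (suc r)) (suc s ∷ rs) _ (p ∷ ps) y ys z e with split (suc r) (s + sum rs) ys (suc-injective e ⟫ refl)
  ... | x ∷ xs , w , ws , refl , q , q′ = record
    { first  = ((y , false) ∷ straight (x ∷ xs) (w , true)) ∷ H.first
    ; second = ((y , true) ∷ crossing false (x ∷ xs) (w , false)) ∷ H.second
    ; edges  = λ f f-sym → lem₀ (cycleSum f ((y , false) ∷ straight (x ∷ xs) (w , true))) (∑ (cycleSum f) H.first)
                    (cycleSum f ((y , true) ∷ crossing false (x ∷ xs) (w , false))) (∑ (cycleSum f) H.second)
                 ⟫ cong₂ _+_ (block-edges f f-sym y x xs w) (H.edges f f-sym)
                 ⟫ sym (pathSum-++ (doubled f) y (x ∷ xs) w ws z)
    ; nodes₁ = λ g → arith (g (y , false)) (g (y , true)) (∑ (bothCopies g) (x ∷ xs)) (g (w , true)) _ _ _ _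
                 (straight-nodes g (x ∷ xs) (w , true)) (H.nodes₁ g)
                 ⟫ cong (λ u → ((g (y , false) + g (y , true)) + u) + g (z , true)) (sym (∑-++ (bothCopies g) (x ∷ xs) (w ∷ ws)))
    ; nodes₂ = λ g → arith (g (y , true)) (g (y , false)) (∑ (bothCopies g) (x ∷ xs)) (g (w , false)) _ _ _ _
                 (crossing-nodes g false (x ∷ xs) (w , false)) (H.nodes₂ g)
                 ⟫ cong₂ (λ v u → (v + u) + g (z , false)) (+-comm (g (y , true)) _) (sym (∑-++ (bothCopies g) (x ∷ xs) (w ∷ ws)))
    ; type₁  = cong₂ _∷_ (length-straight (x ∷ xs) (w , true) ⟫ cong (λ k → suc k * 2) q) H.type₁
    ; type₂  = cong₂ _∷_ (length-crossing false (x ∷ xs) (w , false) ⟫ cong (λ k → suc k * 2) q) H.type₂ }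
    where
    module H = Halves (halves (suc s) rs p ps w ws z (cong suc q′))
    lem₀ : ∀ a b c d → (a + b) + (c + d) ≡ (a + c) + (b + d)
    lem₀ = solve-∀
    arith : ∀ a b i c s h j k → s ≡ i + c → h + c ≡ j + k → ((a + s) + h) + b ≡ ((a + b) + (i + j)) + k
    arith a b i c s h j k refl e = l₁ a b i c h ⟫ cong (((a + b) + i) +_) e ⟫ l₂ (a + b) i j k
      where
      l₁ : ∀ a b i c h → ((a + (i + c)) + h) + b ≡ ((a + b) + i) + (h + c)
      l₁ = solve-∀
      l₂ : ∀ a i j k → (a + i) + (j + k) ≡ (a + (i + j)) + k
      l₂ = solve-∀

  record Twins (rs : List ℕ) (C : List A) : Set where
    field
      first second : List (List (A × Bool))
      edges  : ∀ f → Symmetric f → ∑ (cycleSum f) first + ∑ (cycleSum f) second ≡ cycleSum (doubled f) C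
      nodes₁ : ∀ g → ∑ (∑ g) first  ≡ ∑ (bothCopies g) C
      nodes₂ : ∀ g → ∑ (∑ g) second ≡ ∑ (bothCopies g) C
      type₁  : map length first  ≡ map (_* 2) rs
      type₂  : map length second ≡ map (_* 2) rs

  -- The path is closed by taking its end equal to its start: the copy of `y` that each factor omits
  -- at the start is the one at which its last cycle turns.
  twins : ∀ rs → All (2 ≤_) rs → ∀ C → length C ≡ sum rs → Twins rs C
  twins [] [] [] e = record { first = [] ; second = [] ; edges = λ _ _ → refl ; nodes₁ = λ _ → refl ; nodes₂ = λ _ → refl
                            ; type₁ = refl ; type₂ = refl }
  twins (r ∷ rs) (p ∷ ps) (y ∷ ys) e = record
    { first = H.first ; second = H.second ; edges = H.edges
    ; nodes₁ = λ g → +-cancelʳ-≡ (g (y , true)) _ _ (H.nodes₁ g)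
    ; nodes₂ = λ g → +-cancelʳ-≡ (g (y , false)) _ _ (H.nodes₂ g)
    ; type₁ = H.type₁ ; type₂ = H.type₂ }
    where module H = Halves (halves r rs p ps y ys y e)
  twins (suc r ∷ rs) (p ∷ ps) [] ()

-- Walecki decompositions

consecutive : A → List A → A → List (A × A)
consecutive u []       w = [ u , w ]
consecutive u (x ∷ xs) w = (u , x) ∷ consecutive x xs w

edgeSum-consecutive : (f : A → A → ℕ) (u : A) (xs : List A) (w : A) → edgeSum f (consecutive u xs w) ≡ pathSum f u xs w
edgeSum-consecutive f u []       w = +-identityʳ _
edgeSum-consecutive f u (x ∷ xs) w = cong (f u x +_) (edgeSum-consecutive f x xs w)

length-consecutive : (u : A) (xs : List A) (w : A) → length (consecutive u xs w) ≡ suc (length xs)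
length-consecutive u []       w = refl
length-consecutive u (x ∷ xs) w = cong suc (length-consecutive x xs w)

data Adjacent (a b : A) : List A → Set where
  here  : ∀ {l} → Adjacent a b (a ∷ b ∷ l)
  there : ∀ {c l} → Adjacent a b l → Adjacent a b (c ∷ l)

adjacent⇒∈ : {a b : A} (u : A) (xs : List A) (w : A) → Adjacent a b (u ∷ xs) → (a , b) ∈ consecutive u xs w
adjacent⇒∈ u (x ∷ xs) w here      = here refl
adjacent⇒∈ u (x ∷ xs) w (there p) = there (adjacent⇒∈ x xs w p)

adjacent-map : {B : Set} (h : A → B) {a b : A} {l : List A} → Adjacent a b l → Adjacent (h a) (h b) (map h l)
adjacent-map h here      = here
adjacent-map h (there p) = there (adjacent-map h p)

-- the orientation in which pairs (downFrom m) lists its elements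
orient : ℕ × ℕ → ℕ × ℕ
orient (a , b) with a <? b
... | yes _ = b , a
... | no  _ = a , b

edgeSum-orient : ∀ f → Symmetric f → ∀ E → edgeSum f (map orient E) ≡ edgeSum f E
edgeSum-orient f s []            = refl
edgeSum-orient f s ((a , b) ∷ E) with a <? b
... | yes _ = cong₂ _+_ (s b a) (edgeSum-orient f s E)
... | no  _ = cong (f a b +_) (edgeSum-orient f s E)

Joins : List (ℕ × ℕ) → ℕ → ℕ → Set
Joins E a b = (a , b) ∈ E ⊎ (b , a) ∈ E

orient-> : ∀ {a b} → b < a → orient (a , b) ≡ (a , b)
orient-> {a} {b} p with a <? b
... | yes q = ⊥-elim (<-asym p q)
... | no  _ = refl

orient-< : ∀ {a b} → a < b → orient (a , b) ≡ (b , a)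
orient-< {a} {b} p with a <? b
... | yes _ = refl
... | no ¬q = ⊥-elim (¬q p)

joins⇒∈ : ∀ {E a b} → b < a → Joins E a b → (a , b) ∈ map orient E
joins⇒∈ {E} p (inj₁ q) = subst (_∈ map orient E) (orient-> p) (∈-map⁺ orient q)
joins⇒∈ {E} p (inj₂ q) = subst (_∈ map orient E) (orient-< p) (∈-map⁺ orient q)

∈-pairs-downFrom : ∀ m {a b} → (a , b) ∈ pairs (downFrom m) → b < a × a < m
∈-pairs-downFrom (suc m) p with ∈-++⁻ (map (m ,_) (downFrom m)) p
... | inj₂ q = let r , s = ∈-pairs-downFrom m q in r , m<n⇒m<1+n s
... | inj₁ q with ∈-map⁻ (m ,_) q
...   | b , r , refl = ∈-downFrom⁻ r , ≤-refl

unique-pairs : {xs : List A} → Unique xs → Unique (pairs xs)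
unique-pairs []            = []
unique-pairs {xs = x ∷ xs} (x∉ ∷ u) = Unique-++⁺ (Unique-map⁺ (λ { refl → refl }) u) (unique-pairs u) disjoint
  where
  first∈ : ∀ {xs : List A} {a b} → (a , b) ∈ pairs xs → a ∈ xs
  first∈ {xs = y ∷ ys} p with ∈-++⁻ (map (y ,_) ys) p
  ... | inj₂ q = there (first∈ q)
  ... | inj₁ q with ∈-map⁻ (y ,_) q
  ...   | _ , _ , refl = here refl
  disjoint : ∀ {e} → (e ∈ map (x ,_) xs × e ∈ pairs xs) → ⊥
  disjoint (p , q) with ∈-map⁻ (x ,_) p
  ... | _ , _ , refl = All.lookup x∉ (first∈ q) refl

length-pairs : (xs : List A) → length (pairs xs) * 2 + length xs ≡ length xs * length xs
length-pairs []       = refl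
length-pairs (x ∷ xs) = cong (λ z → z * 2 + suc (length xs)) (length-++ (map (x ,_) xs) ⟫ cong (_+ length (pairs xs)) (length-map (x ,_) xs))
  ⟫ lem (length xs) (length (pairs xs)) ⟫ cong (λ z → suc (length xs + (length xs + z))) (length-pairs xs) ⟫ lem′ (length xs)
  where
  lem : ∀ n p → (n + p) * 2 + suc n ≡ suc (n + (n + (p * 2 + n)))
  lem = solve-∀
  lem′ : ∀ n → suc (n + (n + n * n)) ≡ suc n * suc n
  lem′ = solve-∀

-- Counting edges turns "every pair is joined" into "every pair is joined exactly once".
complete : ∀ m E → (∀ a b → b < a → a < m → Joins E a b) → length E * 2 + m ≡ m * m →
           ∀ f → Symmetric f → edgeSum f E ≡ edgeSum f (pairs (downFrom m))
complete m E cover count f s = sym (edgeSum-orient f s E) ⟫ sym (∑-↭ (uncurry f) perm)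
  where
  sizes : length (pairs (downFrom m)) ≡ length E
  sizes = *-cancelʳ-≡ _ _ 2 (+-cancelʳ-≡ m _ _
    (subst (λ k → length (pairs (downFrom m)) * 2 + k ≡ k * k) (length-downFrom m) (length-pairs (downFrom m)) ⟫ sym count))
  perm : pairs (downFrom m) ↭ map orient E
  perm = unique-⊆⇒↭ (unique-pairs (downFrom⁺ m))
    (λ { {a , b} p → let q , r = ∈-pairs-downFrom m p in joins⇒∈ q (cover a b q r) })
    (≤-reflexive (length-map orient E ⟫ sym sizes))

module Zigzag (q : ℕ) {{_ : NonZero q}} where

  rotate : ℕ → ℕ → ℕ
  rotate i x = (x + i) % q

  unrotate : ℕ → ℕ → ℕ
  unrotate i a = (a + (q ∸ i)) % q

  rotate-unrotate : ∀ i a → i ≤ q → a < q → rotate i (unrotate i a) ≡ a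
  rotate-unrotate i a i≤q a<q =
    %-distribˡ-+ (unrotate i a) i q
    ⟫ cong (λ z → (z + i % q) % q) (m%n%n≡m%n (a + (q ∸ i)) q)
    ⟫ sym (%-distribˡ-+ (a + (q ∸ i)) i q)
    ⟫ cong (_% q) (+-assoc a (q ∸ i) i ⟫ cong (a +_) (m∸n+n≡m i≤q))
    ⟫ [m+n]%n≡m%n a q ⟫ m<n⇒m%n≡m a<q

  -- Rotation by `i` shifts a sum by `i * 2`. Away from the hub, the wheel of offset `i` therefore
  -- holds the edges whose ends sum to `i * 2` or `i * 2 + 1`, and the sum of the ends tells which
  -- wheel to look in.
  unrotate-residue : ∀ i ε a b → i ≤ q → ε < q → (a + b) % q ≡ i * 2 + ε → (unrotate i a + unrotate i b) % q ≡ ε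
  unrotate-residue i ε a b i≤q ε<q e = sym (%-distribˡ-+ (a + (q ∸ i)) (b + (q ∸ i)) q)
    ⟫ cong (_% q) (regroup a b (q ∸ i) ⟫ cong (_+ (q ∸ i) * 2) (m≡m%n+[m/n]*n (a + b) q ⟫ cong (_+ (a + b) / q * q) e)
        ⟫ lem i ε ((a + b) / q * q) (q ∸ i) ⟫ cong (λ z → ε + (z * 2 + (a + b) / q * q)) (m+[n∸m]≡n i≤q) ⟫ lem′ ε q ((a + b) / q))
    ⟫ [m+kn]%n≡m%n ε (2 + (a + b) / q) q ⟫ m<n⇒m%n≡m ε<q
    where
    regroup : ∀ a b d → (a + d) + (b + d) ≡ (a + b) + d * 2
    regroup = solve-∀
    lem : ∀ i ε w d → (i * 2 + ε + w) + d * 2 ≡ ε + ((i + d) * 2 + w)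
    lem = solve-∀
    lem′ : ∀ ε q w → ε + (q * 2 + w * q) ≡ ε + (2 + w) * q
    lem′ = solve-∀

  below-2q : ∀ s ε → s < q + q → s % q ≡ ε → s ≡ ε ⊎ s ≡ ε + q
  below-2q s ε l e with s / q | m≡m%n+[m/n]*n s q
  ... | zero        | eq = inj₁ (eq ⟫ +-identityʳ _ ⟫ e)
  ... | suc zero    | eq = inj₂ (eq ⟫ cong₂ _+_ e (+-identityʳ q))
  ... | suc (suc k) | eq = ⊥-elim (<⇒≱ l (≤-trans (≤-trans (+-monoʳ-≤ q (m≤m+n q (k * q))) (m≤n+m (q + (q + k * q)) (s % q))) (≤-reflexive (sym eq))))

  unrotate-sum : ∀ i ε a b → i ≤ q → ε < q → (a + b) % q ≡ i * 2 + ε →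
                 unrotate i a + unrotate i b ≡ ε ⊎ unrotate i a + unrotate i b ≡ ε + q
  unrotate-sum i ε a b i≤q ε<q e = below-2q _ ε (+-mono-< (m%n<n (a + (q ∸ i)) q) (m%n<n (b + (q ∸ i)) q))
    (unrotate-residue i ε a b i≤q ε<q e)

  -- the vertices x, -x, x+1, -(x+1), … modulo q
  zigzag : ℕ → ℕ → List ℕ
  zigzag zero    x = []
  zigzag (suc n) x = x ∷ (q ∸ x) ∷ zigzag n (suc x)

  length-zigzag : ∀ n x → length (zigzag n x) ≡ n * 2
  length-zigzag zero    x = refl
  length-zigzag (suc n) x = cong (2 +_) (length-zigzag n (suc x))

  rung : ∀ n x j tl → j < n → Adjacent (x + j) (q ∸ (x + j)) (zigzag n x ++ tl)
  rung (suc n) x zero    tl p       rewrite +-identityʳ x = here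
  rung (suc n) x (suc j) tl (s≤s p) rewrite +-suc x j = there (there (rung n (suc x) j tl p))

  link : ∀ n x j tl → suc j < n → Adjacent (q ∸ (x + j)) (suc (x + j)) (zigzag n x ++ tl)
  link (suc zero)    x j       tl (s≤s ())
  link (suc (suc n)) x zero    tl p       rewrite +-identityʳ x = there here
  link (suc (suc n)) x (suc j) tl (s≤s p) rewrite +-suc x j = there (there (link (suc n) (suc x) j tl p))

  last-link : ∀ n x h → Adjacent (q ∸ (x + n)) h (zigzag (suc n) x ++ [ h ])
  last-link zero    x h rewrite +-identityʳ x = there here
  last-link (suc n) x h rewrite +-suc x n = there (there (last-link n (suc x) h))

  low∈ : ∀ n x j tl → j < n → x + j ∈ zigzag n x ++ tl
  low∈ (suc n) x zero    tl p       rewrite +-identityʳ x = here refl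
  low∈ (suc n) x (suc j) tl (s≤s p) rewrite +-suc x j = there (there (low∈ n (suc x) j tl p))

  high∈ : ∀ n x j tl → j < n → q ∸ (x + j) ∈ zigzag n x ++ tl
  high∈ (suc n) x zero    tl p       rewrite +-identityʳ x = there (here refl)
  high∈ (suc n) x (suc j) tl (s≤s p) rewrite +-suc x j = there (there (high∈ n (suc x) j tl p))

  wheel : List ℕ → ℕ → List ℕ
  wheel Z i = q ∷ map (rotate i) Z

  spokes : List ℕ → ℕ → List (ℕ × ℕ)
  spokes Z i = consecutive q (map (rotate i) Z) q

  edgeSum-spokes : ∀ f Z i → edgeSum f (spokes Z i) ≡ cycleSum f (wheel Z i)
  edgeSum-spokes f Z i = edgeSum-consecutive f q (map (rotate i) Z) q

  rotated : ∀ Z i {a b x y} → Adjacent x y Z → rotate i x ≡ a → rotate i y ≡ b → (a , b) ∈ spokes Z i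
  rotated Z i p refl refl = adjacent⇒∈ q (map (rotate i) Z) q (there (adjacent-map (rotate i) p))

  wheel-↭ : ∀ Z i → i ≤ q → length Z ≡ q → (∀ x → x < q → x ∈ Z) → downFrom (suc q) ↭ wheel Z i
  wheel-↭ Z i i≤q l c = unique-⊆⇒↭ (downFrom⁺ (suc q)) covered
    (≤-reflexive (cong suc (length-map (rotate i) Z ⟫ l ⟫ sym (length-downFrom q))))
    where
    covered : ∀ {v} → v ∈ downFrom (suc q) → v ∈ wheel Z i
    covered (here refl) = here refl
    covered {v} (there p) = there (subst (_∈ map (rotate i) Z) (rotate-unrotate i v i≤q (∈-downFrom⁻ p))
      (∈-map⁺ (rotate i) (c (unrotate i v) (m%n<n (v + (q ∸ i)) q))))

  wheels : List ℕ → List ℕ → List (ℕ × ℕ)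
  wheels Z is = concatMap (spokes Z) is

  edgeSum-wheels : ∀ f Z is → edgeSum f (wheels Z is) ≡ ∑ (λ i → cycleSum f (wheel Z i)) is
  edgeSum-wheels f Z is = ∑-concatMap (uncurry f) (spokes Z) is ⟫ ∑-cong (edgeSum-spokes f Z) is

  length-wheels : ∀ Z is → length Z ≡ q → length (wheels Z is) ≡ length is * suc q
  length-wheels Z []       l = refl
  length-wheels Z (i ∷ is) l = length-++ (spokes Z i) ⟫ cong₂ _+_ (length-consecutive q (map (rotate i) Z) q ⟫ cong suc (length-map (rotate i) Z ⟫ l)) (length-wheels Z is l)

  spoke⇒wheels : ∀ Z is i {e} → i ∈ is → e ∈ spokes Z i → e ∈ wheels Z is
  spoke⇒wheels Z (j ∷ is) i (here refl) p = ∈-++⁺ˡ p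
  spoke⇒wheels Z (j ∷ is) i (there r)   p = ∈-++⁺ʳ (spokes Z j) (spoke⇒wheels Z is i r p)

  -- The three values are the positive sums below `q + q` that are 0 or 1 modulo `q`, as for
  -- neighbours in a zigzag.
  Consecutive : List ℕ → Set
  Consecutive Z = ∀ x y → x < y → y < q → x + y ≡ 1 ⊎ x + y ≡ q ⊎ x + y ≡ 1 + q → Adjacent x y Z ⊎ Adjacent y x Z

  spokes-join : ∀ Z → Consecutive Z → ∀ i ε a b → i ≤ q → ε ≤ 1 → ε < q → a < q → b < q → a ≢ b → (a + b) % q ≡ i * 2 + ε →
                Joins (spokes Z i) a b
  spokes-join Z C i ε a b i≤q ε≤1 ε<q a<q b<q a≢b e = found (<-cmp x y)
    where
    x y : ℕ
    x = unrotate i a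
    y = unrotate i b
    ra : rotate i x ≡ a
    ra = rotate-unrotate i a i≤q a<q
    rb : rotate i y ≡ b
    rb = rotate-unrotate i b i≤q b<q
    sums : ∀ {s} ε → ε ≤ 1 → s ≡ ε ⊎ s ≡ ε + q → 0 < s → s ≡ 1 ⊎ s ≡ q ⊎ s ≡ 1 + q
    sums zero       _ (inj₁ refl) ()
    sums zero       _ (inj₂ p)    _ = inj₂ (inj₁ p)
    sums (suc zero) _ (inj₁ p)    _ = inj₁ p
    sums (suc zero) _ (inj₂ p)    _ = inj₂ (inj₂ p)
    sums (suc (suc _)) (s≤s ()) _ _
    found : Tri (x < y) (x ≡ y) (y < x) → Joins (spokes Z i) a b
    found (tri≈ _ p _) = ⊥-elim (a≢b (sym ra ⟫ cong (rotate i) p ⟫ rb))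
    found (tri< p _ _) with C x y p (m%n<n (b + (q ∸ i)) q) (sums ε ε≤1 (unrotate-sum i ε a b i≤q ε<q e) (≤-trans (≤-trans (s≤s z≤n) p) (m≤n+m y x)))
    ... | inj₁ r = inj₁ (rotated Z i r ra rb)
    ... | inj₂ r = inj₂ (rotated Z i r rb ra)
    found (tri> _ _ p) with C y x p (m%n<n (a + (q ∸ i)) q)
                              (sums ε ε≤1 (subst (λ s → s ≡ ε ⊎ s ≡ ε + q) (+-comm x y) (unrotate-sum i ε a b i≤q ε<q e)) (≤-trans (≤-trans (s≤s z≤n) p) (m≤n+m x y)))
    ... | inj₁ r = inj₂ (rotated Z i r rb ra)
    ... | inj₂ r = inj₁ (rotated Z i r ra rb)

  lower-half : ∀ {x y s n} → x < y → x + y ≡ s → s ≤ 2 + n * 2 → x ≤ n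
  lower-half {x} {y} {s} {n} p e l = ≮⇒≥ λ n<x → <⇒≱
    (<-≤-trans (≤-reflexive (lem n)) (≤-trans (+-mono-≤ n<x (≤-trans (s≤s n<x) p)) (≤-reflexive e))) l
    where
    lem : ∀ n → suc (2 + n * 2) ≡ suc n + (2 + n)
    lem = solve-∀

  complement : ∀ {x y} → x + y ≡ q → q ∸ x ≡ y
  complement {x} {y} refl = m+n∸m≡n x y

  complement⁺ : ∀ {x y} → suc x + y ≡ 1 + q → q ∸ x ≡ y
  complement⁺ e = complement (suc-injective e)

  -- Sum `q` is a step from `x` to `q ∸ x`, sum `1 + q` a step from `q ∸ x` to `suc x`, and sum 1
  -- only the initial step from 0 to 1.
  zigzag-odd : ∀ n → 1 ≤ n → q ≡ suc (n * 2) → Consecutive (0 ∷ zigzag n 1 ++ [])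
  zigzag-odd (suc n) _ Q zero    (suc zero) _ _ _ = inj₁ here
  zigzag-odd (suc n) _ Q zero    (suc (suc y)) _ _ (inj₁ ())
  zigzag-odd (suc n) _ Q zero    y _ y<q (inj₂ (inj₁ p)) = ⊥-elim (<-irrefl p y<q)
  zigzag-odd (suc n) _ Q zero    y _ y<q (inj₂ (inj₂ p)) = ⊥-elim (<-irrefl p (m<n⇒m<1+n y<q))
  zigzag-odd (suc n) _ Q (suc x) (suc y) _ _ (inj₁ p) with subst (_≡ 1) (+-suc (suc x) y) p
  ... | ()
  zigzag-odd (suc n) _ Q (suc x) y x<y y<q (inj₂ (inj₁ p)) =
    inj₁ (there (subst (λ z → Adjacent (suc x) z (zigzag (suc n) 1 ++ [])) (complement p)
      (rung (suc n) 1 x [] (lower-half {n = suc n} x<y p (≤-trans (≤-reflexive Q) (n≤1+n _))))))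
  zigzag-odd (suc n) _ Q (suc zero) y x<y y<q (inj₂ (inj₂ p)) = ⊥-elim (<-irrefl (suc-injective p) y<q)
  zigzag-odd (suc n) _ Q (suc (suc x)) y x<y y<q (inj₂ (inj₂ p)) =
    inj₂ (there (subst (λ z → Adjacent z (suc (suc x)) (zigzag (suc n) 1 ++ [])) (complement⁺ p)
      (link (suc n) 1 x [] (lower-half {n = suc n} x<y p (s≤s (≤-reflexive Q))))))

  -- For even `q` the residue `suc n` is its own negative; it stands alone at the end and is reached
  -- by one additional step.
  zigzag-even : ∀ n → q ≡ suc n * 2 → Consecutive (0 ∷ zigzag n 1 ++ [ suc n ])
  zigzag-even zero    Q zero    (suc zero) _ _ _ = inj₁ here
  zigzag-even (suc n) Q zero    (suc zero) _ _ _ = inj₁ here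
  zigzag-even n Q zero    (suc (suc y)) _ _ (inj₁ ())
  zigzag-even n Q zero    y _ y<q (inj₂ (inj₁ p)) = ⊥-elim (<-irrefl p y<q)
  zigzag-even n Q zero    y _ y<q (inj₂ (inj₂ p)) = ⊥-elim (<-irrefl p (m<n⇒m<1+n y<q))
  zigzag-even n Q (suc x) (suc y) _ _ (inj₁ p) with subst (_≡ 1) (+-suc (suc x) y) p
  ... | ()
  zigzag-even n Q (suc x) y x<y y<q (inj₂ (inj₁ p)) =
    inj₁ (there (subst (λ z → Adjacent (suc x) z (zigzag n 1 ++ [ suc n ])) (complement p)
      (rung n 1 x [ suc n ] (lower-half {n = n} x<y p (≤-reflexive Q)))))
  zigzag-even n Q (suc zero) y x<y y<q (inj₂ (inj₂ p)) = ⊥-elim (<-irrefl (suc-injective p) y<q)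
  zigzag-even n Q (suc (suc x)) y x<y y<q (inj₂ (inj₂ p))
    with m≤n⇒m<n∨m≡n (s≤s⁻¹ (lower-half {n = suc n} x<y p (≤-trans (s≤s (≤-reflexive Q)) (n≤1+n _))))
  ... | inj₁ l = inj₂ (there (subst (λ z → Adjacent z (suc (suc x)) (zigzag n 1 ++ [ suc n ])) (complement⁺ p) (link n 1 x [ suc n ] l)))
  ... | inj₂ refl = inj₂ (there (subst (λ z → Adjacent z (suc (suc x)) (zigzag (suc x) 1 ++ [ suc (suc x) ])) (complement⁺ p)
                      (last-link x 1 (suc (suc x)))))

  covers : ∀ n tl → (∀ x → x < q → n < x → q ∸ x ≤ n ⊎ x ∈ tl) → ∀ x → x < q → x ∈ 0 ∷ zigzag n 1 ++ tl
  covers n tl h zero    p = here refl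
  covers n tl h (suc x) p with suc x ≤? n
  ... | yes l = there (low∈ n 1 x tl l)
  ... | no ¬l with h (suc x) p (≰⇒> ¬l)
  ...   | inj₂ m = there (∈-++⁺ʳ (zigzag n 1) m)
  ...   | inj₁ m with q ∸ suc x in eq
  ...     | zero  = ⊥-elim (<⇒≱ p (m∸n≡0⇒m≤n eq))
  ...     | suc j = there (subst (_∈ zigzag n 1 ++ tl) (cong (q ∸_) (sym eq) ⟫ m∸[m∸n]≡n (<⇒≤ p)) (high∈ n 1 j tl m))

  last∈ : ∀ (u : ℕ) xs l w → (l , w) ∈ consecutive u (xs ++ [ l ]) w
  last∈ u []       l w = there (here refl)
  last∈ u (x ∷ xs) l w = there (last∈ x xs l w)

Hamiltonian : ℕ → List (List ℕ) → Set
Hamiltonian m Cs = All (λ C → downFrom m ↭ C) Cs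

module _ (g : ℕ) where

  private
    q : ℕ
    q = suc g * 2

  open Zigzag q

  private
    Z : List ℕ
    Z = 0 ∷ zigzag g 1 ++ [ suc g ]

    length-Z : length Z ≡ q
    length-Z = cong suc (length-++ (zigzag g 1) ⟫ cong (_+ 1) (length-zigzag g 1) ⟫ +-comm (g * 2) 1)

    covers-Z : ∀ x → x < q → x ∈ Z
    covers-Z = covers g [ suc g ] λ x p l → beyond x p l (m≤n⇒m<n∨m≡n l)
      where
      beyond : ∀ x → x < q → g < x → suc g < x ⊎ suc g ≡ x → q ∸ x ≤ g ⊎ x ∈ [ suc g ]
      beyond x p l (inj₂ refl) = inj₂ (here refl)
      beyond x p l (inj₁ r)    = inj₁ (≤-trans (∸-monoʳ-≤ q r) (≤-reflexive (cong (_∸ suc (suc g)) (lem g) ⟫ m+n∸m≡n (suc (suc g)) g)))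
        where
        lem : ∀ g → suc g * 2 ≡ suc (suc g) + g
        lem = solve-∀

    half<q : suc g < q
    half<q = s≤s (s≤s (≤-trans (m≤m+n g g) (≤-reflexive (lem g))))
      where
      lem : ∀ g → g + g ≡ g * 2
      lem = solve-∀

    -- Off the hub, halving the residue of the sum gives the offset. The wheel of offset `i` joins
    -- the hub to `i` and to `i + suc g`, and for `i` up to `g` these are all residues.
    cover : ∀ a b → b < a → a < suc q → Joins (wheels Z (downFrom (suc g))) a b
    cover a b b<a (s≤s a≤q) with m≤n⇒m<n∨m≡n a≤q
    ... | inj₁ a<q = widen (spokes-join Z (zigzag-even g refl) i ε a b (≤-trans (<⇒≤ i<h) (<⇒≤ half<q)) (s≤s⁻¹ (m%n<n s 2))
                       (<-≤-trans (m%n<n s 2) (s≤s (s≤s z≤n))) a<q (<-trans b<a a<q) (λ e → <-irrefl (sym e) b<a)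
                       (m≡m%n+[m/n]*n s 2 ⟫ +-comm ε _))
      where
      s i ε : ℕ
      s = (a + b) % q
      i = s / 2
      ε = s % 2
      i<h : i < suc g
      i<h = *-cancelʳ-< 2 i (suc g) (≤-<-trans (m/n*n≤m s 2) (m%n<n (a + b) q))
      widen : Joins (spokes Z i) a b → Joins (wheels Z (downFrom (suc g))) a b
      widen (inj₁ p) = inj₁ (spoke⇒wheels Z _ i (∈-downFrom⁺ i<h) p)
      widen (inj₂ p) = inj₂ (spoke⇒wheels Z _ i (∈-downFrom⁺ i<h) p)
    ... | inj₂ refl with b <? suc g
    ...   | yes b<h = inj₁ (spoke⇒wheels Z _ b (∈-downFrom⁺ b<h) (here (cong (q ,_) (sym (m<n⇒m%n≡m b<a)))))
    ...   | no ¬b<h = inj₂ (spoke⇒wheels Z _ (b ∸ suc g) (∈-downFrom⁺ small)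
                        (subst (λ z → (z , q) ∈ spokes Z (b ∸ suc g)) ends∈ (subst (λ l → (rotate (b ∸ suc g) (suc g) , q) ∈ consecutive q (rotate (b ∸ suc g) 0 ∷ l) q)
                          (sym (Data.List.Properties.map-++ (rotate (b ∸ suc g)) (zigzag g 1) [ suc g ]))
                          (last∈ q (rotate (b ∸ suc g) 0 ∷ map (rotate (b ∸ suc g)) (zigzag g 1)) (rotate (b ∸ suc g) (suc g)) q))))
      where
      small : b ∸ suc g < suc g
      small = +-cancelˡ-< (suc g) _ _ (subst₂ _<_ (sym (m+[n∸m]≡n (≮⇒≥ ¬b<h))) (lem g) b<a)
        where
        lem : ∀ g → suc g * 2 ≡ suc g + suc g
        lem = solve-∀
      ends∈ : rotate (b ∸ suc g) (suc g) ≡ b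
      ends∈ = cong (_% q) (m+[n∸m]≡n (≮⇒≥ ¬b<h)) ⟫ m<n⇒m%n≡m b<a

  abstract
    walecki-odd : ∃ λ Cs → length Cs ≡ suc g × Hamiltonian (suc q) Cs ×
                  (∀ f → Symmetric f → ∑ (cycleSum f) Cs ≡ edgeSum f (pairs (downFrom (suc q))))
    walecki-odd = map (wheel Z) (downFrom (suc g)) , length-map (wheel Z) (downFrom (suc g)) ⟫ length-downFrom (suc g) ,
      ham (downFrom (suc g)) (λ p → ≤-trans (<⇒≤ (∈-downFrom⁻ p)) (<⇒≤ half<q)) ,
      λ f s → ∑-map (cycleSum f) (wheel Z) (downFrom (suc g)) ⟫ sym (edgeSum-wheels f Z (downFrom (suc g)))
        ⟫ complete (suc q) (wheels Z (downFrom (suc g))) cover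
            (cong (λ l → l * 2 + suc q) (length-wheels Z (downFrom (suc g)) length-Z ⟫ cong (_* suc q) (length-downFrom (suc g))) ⟫ lem g) f s
      where
      ham : ∀ is → (∀ {i} → i ∈ is → i ≤ q) → Hamiltonian (suc q) (map (wheel Z) is)
      ham []       h = []
      ham (i ∷ is) h = wheel-↭ Z i (h (here refl)) length-Z covers-Z ∷ ham is (h ∘ there)
      lem : ∀ g → suc g * suc (suc g * 2) * 2 + suc (suc g * 2) ≡ suc (suc g * 2) * suc (suc g * 2)
      lem = solve-∀

-- For an even number of vertices, the edges whose ends have sum 0, 1 or -1 modulo q are left for the ladder.
module _ (g : ℕ) where

  private
    h q : ℕ
    h = suc g
    q = suc (h * 2)

  open Zigzag q

  columnsFrom : ℕ → ℕ → List (ℕ × ℕ)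
  columnsFrom zero    x = []
  columnsFrom (suc n) x = (x , q ∸ x) ∷ columnsFrom n (suc x)

  -- A rung of sum 0 and the two rails of sums 1 and -1 modulo `q`. In the last column of the
  -- ladder, where `x = h`, the rails would be loops; edges to the hub `q` stand in their place.
  climb : ℕ → ℕ → List (ℕ × ℕ)
  climb zero          x = []
  climb (suc zero)    x = (x , q ∸ x) ∷ (q ∸ x , q) ∷ (x , q) ∷ []
  climb (suc (suc n)) x = (x , q ∸ x) ∷ (q ∸ x , suc x) ∷ (x , q ∸ suc x) ∷ climb (suc n) (suc x)

  ladder : List (ℕ × ℕ)
  ladder = (q , 0) ∷ (0 , 1) ∷ (0 , q ∸ 1) ∷ climb h 1

  private
    length-climb : ∀ n x → length (climb (suc n) x) ≡ 3 + n * 3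
    length-climb zero    x = refl
    length-climb (suc n) x = cong (3 +_) (length-climb n (suc x))

    rung∈ : ∀ n x j → j < n → (x + j , q ∸ (x + j)) ∈ climb n x
    rung∈ (suc zero)    x zero    p       rewrite +-identityʳ x = here refl
    rung∈ (suc zero)    x (suc j) (s≤s ())
    rung∈ (suc (suc n)) x zero    p       rewrite +-identityʳ x = here refl
    rung∈ (suc (suc n)) x (suc j) (s≤s p) rewrite +-suc x j = there (there (there (rung∈ (suc n) (suc x) j p)))

    up∈ : ∀ n x j → suc j < n → (q ∸ (x + j) , suc (x + j)) ∈ climb n x
    up∈ (suc zero)    x j       (s≤s ())
    up∈ (suc (suc n)) x zero    p       rewrite +-identityʳ x = there (here refl)
    up∈ (suc (suc n)) x (suc j) (s≤s p) rewrite +-suc x j = there (there (there (up∈ (suc n) (suc x) j p)))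

    down∈ : ∀ n x j → suc j < n → (x + j , q ∸ suc (x + j)) ∈ climb n x
    down∈ (suc zero)    x j       (s≤s ())
    down∈ (suc (suc n)) x zero    p       rewrite +-identityʳ x = there (there (here refl))
    down∈ (suc (suc n)) x (suc j) (s≤s p) rewrite +-suc x j = there (there (there (down∈ (suc n) (suc x) j p)))

    top∈ : ∀ n x → (q ∸ (x + n) , q) ∈ climb (suc n) x × (x + n , q) ∈ climb (suc n) x
    top∈ zero    x rewrite +-identityʳ x = there (here refl) , there (there (here refl))
    top∈ (suc n) x rewrite +-suc x n = let p , r = top∈ n (suc x) in there (there (there p)) , there (there (there r))

    deep : ∀ {e} → e ∈ climb h 1 → e ∈ ladder
    deep p = there (there (there p))

    q∸h : q ∸ h ≡ suc h
    q∸h = complement {h} (lem h)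
      where
      lem : ∀ h → h + suc h ≡ suc (h * 2)
      lem = solve-∀

    Z : List ℕ
    Z = 0 ∷ zigzag h 1 ++ []

    length-Z : length Z ≡ q
    length-Z = cong suc (length-++ (zigzag h 1) ⟫ cong (_+ 0) (length-zigzag h 1) ⟫ +-identityʳ (h * 2))

    covers-Z : ∀ x → x < q → x ∈ Z
    covers-Z = covers h [] λ x p l → inj₁ (≤-trans (∸-monoʳ-≤ q l) (≤-reflexive (cong (_∸ h) (lem g) ⟫ m+n∸m≡n h h)))
      where
      lem : ∀ g → suc g * 2 ≡ suc g + suc g
      lem = solve-∀

    -- Offsets 1 to `g` carry the sums 2 to `q ∸ 2` and reach all neighbours of the hub except 0,
    -- `h` and `suc h`, which are its neighbours in the ladder.
    offsets : List ℕ
    offsets = map suc (downFrom g)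

    offsets⁺ : ∀ {i} → 0 < i → i < h → i ∈ offsets
    offsets⁺ {suc i} _ (s≤s p) = ∈-map⁺ suc (∈-downFrom⁺ p)

    h≤q : h ≤ q
    h≤q = ≤-trans (m≤m+n h (suc h)) (≤-reflexive (lem h))
      where
      lem : ∀ h → h + suc h ≡ suc (h * 2)
      lem = solve-∀

    1<q : 1 < q
    1<q = s≤s (s≤s z≤n)

    E : List (ℕ × ℕ)
    E = wheels Z offsets ++ ladder

    inLadder : ∀ {a b} → Joins ladder a b → Joins E a b
    inLadder (inj₁ p) = inj₁ (∈-++⁺ʳ (wheels Z offsets) p)
    inLadder (inj₂ p) = inj₂ (∈-++⁺ʳ (wheels Z offsets) p)

    inWheel : ∀ {a b i} → i ∈ offsets → Joins (spokes Z i) a b → Joins E a b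
    inWheel {i = i} m (inj₁ p) = inj₁ (∈-++⁺ˡ (spoke⇒wheels Z offsets i m p))
    inWheel {i = i} m (inj₂ p) = inj₂ (∈-++⁺ˡ (spoke⇒wheels Z offsets i m p))

    sum-q : ∀ a b → b < a → a < q → a + b ≡ q → Joins ladder a b
    sum-q a zero    l p e = ⊥-elim (<-irrefl (sym (+-identityʳ a) ⟫ e) p)
    sum-q a (suc b) l p e = inj₂ (subst (λ z → (suc b , z) ∈ ladder) (complement (+-comm (suc b) a ⟫ e))
      (deep (rung∈ h 1 b (lower-half {n = h} l (+-comm (suc b) a ⟫ e) (n≤1+n _)))))

    sum-1+q : ∀ a b → b < a → a < q → a + b ≡ 1 + q → Joins ladder a b
    sum-1+q a zero          l p e = ⊥-elim (<-irrefl (sym (+-identityʳ a) ⟫ e) (m<n⇒m<1+n p))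
    sum-1+q a (suc zero)    l p e = ⊥-elim (<-irrefl (suc-injective (sym (+-comm a 1) ⟫ e)) p)
    sum-1+q a (suc (suc b)) l p e = inj₁ (subst (λ z → (z , suc (suc b)) ∈ ladder) (complement⁺ (+-comm (suc (suc b)) a ⟫ e))
      (deep (up∈ h 1 b (lower-half {n = h} l (+-comm (suc (suc b)) a ⟫ e) ≤-refl))))

    sum-h2 : ∀ a b → b < a → a < q → a + b ≡ h * 2 → Joins ladder a b
    sum-h2 a zero    l p e = inj₂ (there (there (here (cong (0 ,_) (sym (+-identityʳ a) ⟫ e)))))
    sum-h2 a (suc b) l p e = inj₂ (subst (λ z → (suc b , z) ∈ ladder) (complement (cong suc (+-comm (suc b) a ⟫ e) ))
      (deep (down∈ h 1 b (s≤s (lower-half {n = g} l (+-comm (suc b) a ⟫ e) ≤-refl)))))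

    small : ∀ a b → b < a → a + b ≡ 1 → Joins ladder a b
    small (suc zero)    zero    l e = inj₂ (there (here refl))
    small (suc (suc a)) zero    l ()
    small (suc a) (suc b) l e with sym (+-suc a b) ⟫ suc-injective e
    ... | ()

    cover : ∀ a b → b < a → a < suc q → Joins E a b
    cover a b b<a (s≤s a≤q) with m≤n⇒m<n∨m≡n a≤q
    ... | inj₁ a<q = by-residue ((a + b) % q) refl
      where
      b<q : b < q
      b<q = <-trans b<a a<q
      below : a + b < q + q
      below = +-mono-< a<q b<q
      by-residue : ∀ s → (a + b) % q ≡ s → Joins E a b
      by-residue zero e with below-2q (a + b) 0 below e
      ... | inj₁ p = ⊥-elim (n≮0 (<-≤-trans b<a (≤-trans (m≤m+n a b) (≤-reflexive p))))
      ... | inj₂ p = inLadder (sum-q a b b<a a<q p)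
      by-residue (suc zero) e with below-2q (a + b) 1 below e
      ... | inj₁ p = inLadder (small a b b<a p)
      ... | inj₂ p = inLadder (sum-1+q a b b<a a<q p)
      by-residue (suc (suc s)) e with suc (suc s) <? h * 2
      ... | yes l = inWheel (offsets⁺ 0<i i<h)
          (spokes-join Z (zigzag-odd h (s≤s z≤n) refl) i ε a b (≤-trans (<⇒≤ i<h) h≤q) (s≤s⁻¹ (m%n<n (suc (suc s)) 2))
             (<-≤-trans (m%n<n (suc (suc s)) 2) 1<q) a<q b<q (λ p → <-irrefl (sym p) b<a)
             (e ⟫ m≡m%n+[m/n]*n (suc (suc s)) 2 ⟫ +-comm ε _))
        where
        i ε : ℕ
        i = suc (suc s) / 2
        ε = suc (suc s) % 2
        i<h : i < h
        i<h = *-cancelʳ-< 2 i h (≤-<-trans (m/n*n≤m (suc (suc s)) 2) l)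
        0<i : 0 < i
        0<i = ≮⇒≥ λ { (s≤s p) → <⇒≱ (<-≤-trans (m%n<n (suc (suc s)) 2) (s≤s (s≤s z≤n)))
                (≤-reflexive (m≡m%n+[m/n]*n (suc (suc s)) 2 ⟫ cong (λ z → ε + z * 2) (n≤0⇒n≡0 p) ⟫ +-identityʳ ε)) }
      ... | no ¬l with below-2q (a + b) (h * 2) below (e ⟫ ≤-antisym (s≤s⁻¹ (subst (_< q) e (m%n<n (a + b) q))) (≮⇒≥ ¬l))
      ...   | inj₁ p = inLadder (sum-h2 a b b<a a<q p)
      ...   | inj₂ p = ⊥-elim (<-irrefl p (+-mono-≤-< (s≤s⁻¹ a<q) b<q))
    ... | inj₂ refl = apex b b<a
      where
      last-spoke : ∀ i n x u → (rotate i (q ∸ (x + n)) , q) ∈ consecutive u (map (rotate i) (zigzag (suc n) x ++ [])) q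
      last-spoke i zero    x u rewrite +-identityʳ x = there (there (here refl))
      last-spoke i (suc n) x u rewrite +-suc x n = there (there (last-spoke i n (suc x) (rotate i (q ∸ x))))
      apex : ∀ b → b < q → Joins E q b
      apex zero    l = inLadder (inj₁ (here refl))
      apex (suc b) l with <-cmp (suc b) h
      ... | tri< p _ _ = inWheel (offsets⁺ (s≤s z≤n) p) (inj₁ (here (cong (q ,_) (sym (m<n⇒m%n≡m l)))))
      ... | tri≈ _ refl _ = inLadder (inj₂ (deep (proj₂ (top∈ g 1))))
      ... | tri> _ _ p with m≤n⇒m<n∨m≡n p
      ...   | inj₂ e = inLadder (inj₂ (subst (λ z → (z , q) ∈ ladder) (q∸h ⟫ e) (deep (proj₁ (top∈ g 1)))))
      ...   | inj₁ r = inWheel (offsets⁺ (m<n⇒0<n∸m r) i<h)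
          (inj₂ (there (subst (λ z → (z , q) ∈ consecutive (rotate i 0) (map (rotate i) (zigzag h 1 ++ [])) q)
                  (cong (λ z → (z + i) % q) q∸h ⟫ cong (_% q) (m+[n∸m]≡n (<⇒≤ r)) ⟫ m<n⇒m%n≡m l)
                  (last-spoke i g 1 (rotate i 0)))))
        where
        i : ℕ
        i = suc b ∸ suc h
        i<h : i < h
        i<h = +-cancelˡ-< (suc h) _ _ (subst₂ _<_ (sym (m+[n∸m]≡n (<⇒≤ r))) (lem h) l)
          where
          lem : ∀ h → suc (h * 2) ≡ suc h + h
          lem = solve-∀

  abstract
    walecki-even : ∃ λ Cs → length Cs ≡ g × Hamiltonian (suc q) Cs ×
                   (∀ f → Symmetric f → ∑ (cycleSum f) Cs + edgeSum f ladder ≡ edgeSum f (pairs (downFrom (suc q))))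
    walecki-even = map (wheel Z) offsets , length-map (wheel Z) offsets ⟫ length-offsets ,
      ham offsets bounded ,
      λ f s → cong (_+ edgeSum f ladder) (∑-map (cycleSum f) (wheel Z) offsets ⟫ sym (edgeSum-wheels f Z offsets))
        ⟫ sym (∑-++ (uncurry f) (wheels Z offsets) ladder)
        ⟫ complete (suc q) E cover
            (cong (λ l → l * 2 + suc q) (length-++ (wheels Z offsets) ⟫ cong₂ _+_ (length-wheels Z offsets length-Z ⟫ cong (_* suc q) length-offsets)
                (cong (3 +_) (length-climb g 1))) ⟫ lem g) f s
      where
      length-offsets : length offsets ≡ g
      length-offsets = length-map suc (downFrom g) ⟫ length-downFrom g
      bounded : ∀ {i} → i ∈ offsets → i ≤ q
      bounded p with ∈-map⁻ suc p
      ... | j , r , refl = ≤-trans (s≤s (<⇒≤ (∈-downFrom⁻ r))) h≤q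
      ham : ∀ is → (∀ {i} → i ∈ is → i ≤ q) → Hamiltonian (suc q) (map (wheel Z) is)
      ham []       b = []
      ham (i ∷ is) b = wheel-↭ Z i (b (here refl)) length-Z covers-Z ∷ ham is (b ∘ there)
      lem : ∀ g → (g * suc (suc (suc g * 2)) + (3 + (3 + g * 3))) * 2 + suc (suc (suc g * 2)) ≡ suc (suc (suc g * 2)) * suc (suc (suc g * 2))
      lem = solve-∀

  ladder-vertices : downFrom (suc q) ↭ endpoints ((q , 0) ∷ columnsFrom h 1)
  ladder-vertices = unique-⊆⇒↭ (downFrom⁺ (suc q))
    (λ { (here refl) → here refl ; {v} (there p) → there (subst (λ l → v ∈ 0 ∷ l) (flat h 1) (covers-Z v (∈-downFrom⁻ p))) })
    (≤-reflexive (cong suc (sym (cong (λ l → length (0 ∷ l)) (flat h 1)) ⟫ length-Z ⟫ sym (length-downFrom q))))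
    where
    flat : ∀ n x → zigzag n x ++ [] ≡ endpoints (columnsFrom n x)
    flat zero    x = refl
    flat (suc n) x = cong (λ l → x ∷ (q ∸ x) ∷ l) (flat n (suc x))

-- Complete graphs

record Decomposition (vs : List A) (Ts : List (List ℕ)) : Set where
  field
    factors  : List (List (List A))
    matching : List (A × A)
    edges    : ∀ f → Symmetric f → ∑ (∑ (cycleSum f)) factors + edgeSum f matching ≡ edgeSum f (pairs vs)
    spans    : All (λ F → ∀ g → ∑ (∑ g) F ≡ ∑ g vs) factors
    spansᴹ   : ∀ g → ∑ g (endpoints matching) ≡ ∑ g vs
    types    : Pointwise (λ F T → map length F ↭ T) factors Ts

double : List A → List (A × Bool)
double = concatMap (λ x → (x , false) ∷ (x , true) ∷ [])

vertical : (A × Bool → A × Bool → ℕ) → A → ℕ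
vertical f x = f (x , false) (x , true)

doubled-sym : (f : A × Bool → A × Bool → ℕ) → Symmetric f → Symmetric (doubled f)
doubled-sym f s a b = cong₂ _+_ (cong₂ _+_ (s (a , false) (b , false)) (s (a , false) (b , true))) (cong₂ _+_ (s (a , true) (b , false)) (s (a , true) (b , true)))
  ⟫ interchange (f (b , false) (a , false)) (f (b , true) (a , false)) (f (b , false) (a , true)) (f (b , true) (a , true))

∑-double : (g : A × Bool → ℕ) (xs : List A) → ∑ g (double xs) ≡ ∑ (bothCopies g) xs
∑-double g []       = refl
∑-double g (x ∷ xs) = cong (λ z → g (x , false) + (g (x , true) + z)) (∑-double g xs) ⟫ sym (+-assoc (g (x , false)) _ _)

-- Doubled Hamilton cycles contain no vertical edge. The vertical edges are the 1-factor for an odd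
-- number of columns of copies, and otherwise they make the doubled ladder 7-regular.
edgeSum-double : (f : A × Bool → A × Bool → ℕ) (xs : List A) →
                 edgeSum f (pairs (double xs)) ≡ edgeSum (doubled f) (pairs xs) + ∑ (vertical f) xs
edgeSum-double f []       = refl
edgeSum-double f (x ∷ xs) = edgeSum-pairs f (x , false) ((x , true) ∷ double xs)
  ⟫ cong₂ (λ u v → (vertical f x + u) + v) (∑-double (f (x , false)) xs)
      (edgeSum-pairs f (x , true) (double xs) ⟫ cong₂ _+_ (∑-double (f (x , true)) xs) (edgeSum-double f xs))
  ⟫ lem (vertical f x) (∑ (bothCopies (f (x , false))) xs) (∑ (bothCopies (f (x , true))) xs) (edgeSum (doubled f) (pairs xs)) (∑ (vertical f) xs)
  ⟫ cong (λ w → (w + edgeSum (doubled f) (pairs xs)) + (vertical f x + ∑ (vertical f) xs)) (sym (∑-+ (bothCopies (f (x , false))) (bothCopies (f (x , true))) xs))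
  ⟫ cong (_+ (vertical f x + ∑ (vertical f) xs)) (sym (edgeSum-pairs (doubled f) x xs))
  where
  lem : ∀ v a b e w → (v + a) + (b + (e + w)) ≡ ((a + b) + e) + (v + w)
  lem = solve-∀

sum-double : ∀ rs → sum (map (_* 2) rs) ≡ sum rs * 2
sum-double []       = refl
sum-double (r ∷ rs) = cong (r * 2 +_) (sum-double rs) ⟫ sym (*-distribʳ-+ 2 r (sum rs))

HalfType : ℕ → List ℕ → Set
HalfType m T = ∃ λ rs → T ≡ map (_* 2) rs × All (2 ≤_) rs × sum rs ≡ m

twice : List A → List A
twice = concatMap (λ x → x ∷ x ∷ [])

record Doubles (m : ℕ) (Cs : List (List ℕ)) (Ts : List (List ℕ)) : Set where
  field
    factors : List (List (List (ℕ × Bool)))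
    edges   : ∀ f → Symmetric f → ∑ (∑ (cycleSum f)) factors ≡ ∑ (cycleSum (doubled f)) Cs
    spans   : All (λ F → ∀ g → ∑ (∑ g) F ≡ ∑ g (double (downFrom m))) factors
    types   : Pointwise (λ F T → map length F ↭ T) factors Ts

doubles : ∀ m Cs Us → length Cs ≡ length Us → Hamiltonian m Cs → All (HalfType m) Us → Doubles m Cs (twice Us)
doubles m []       []       e h t = record { factors = [] ; edges = λ _ _ → refl ; spans = [] ; types = [] }
doubles m (C ∷ Cs) (U ∷ Us) e (p ∷ h) ((rs , refl , l , s) ∷ t) = record
  { factors = W.first ∷ W.second ∷ D.factors
  ; edges   = λ f f-sym → sym (+-assoc (∑ (cycleSum f) W.first) _ _) ⟫ cong₂ _+_ (W.edges f f-sym) (D.edges f f-sym)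
  ; spans   = (λ g → W.nodes₁ g ⟫ nodes g) ∷ (λ g → W.nodes₂ g ⟫ nodes g) ∷ D.spans
  ; types   = ↭-reflexive W.type₁ ∷ ↭-reflexive W.type₂ ∷ D.types }
  where
  module D = Doubles (doubles m Cs Us (suc-injective e) h t)
  module W = Twins (twins rs l C (sym (↭-length p) ⟫ length-downFrom m ⟫ sym s))
  nodes : ∀ g → ∑ (bothCopies g) C ≡ ∑ g (double (downFrom m))
  nodes g = sym (∑-↭ (bothCopies g) p) ⟫ sym (∑-double g (downFrom m))

verticals : List A → List ((A × Bool) × (A × Bool))
verticals = map (λ x → (x , false) , (x , true))

decompose-odd : ∀ g Us → length Us ≡ g → All (HalfType (suc (g * 2))) Us → Decomposition (double (downFrom (suc (g * 2)))) (twice Us)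
-- The doubled graph has one vertical edge and nothing else, which is the whole 1-factor.
decompose-odd zero [] refl [] = record
  { factors = [] ; matching = verticals (downFrom 1) ; edges = λ f s → refl ; spans = [] ; spansᴹ = λ g → refl ; types = [] }
decompose-odd (suc g) Us e t with walecki-odd g
... | Cs , l , ham , total = record
  { factors  = D.factors ; matching = verticals vs
  ; edges    = λ f s → cong₂ _+_ (D.edges f s ⟫ total (doubled f) (doubled-sym f s)) (∑-map (uncurry f) _ vs) ⟫ sym (edgeSum-double f vs)
  ; spans    = D.spans
  ; spansᴹ   = λ g → cong (∑ g) (flat vs)
  ; types    = D.types }
  where
  vs : List ℕ
  vs = downFrom (suc (suc g * 2))
  module D = Doubles (doubles (suc (suc g * 2)) Cs Us (l ⟫ sym e) ham t)
  flat : ∀ (xs : List ℕ) → endpoints (verticals xs) ≡ double xs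
  flat []       = refl
  flat (x ∷ xs) = cong (λ z → (x , false) ∷ (x , true) ∷ z) (flat xs)

-- The doubled ladder as a sequence of columns

columnOver : A × A → Column {A × Bool}
columnOver (a , b) = (a , false) , (a , true) , (b , false) , (b , true)

module _ (f : A × Bool → A × Bool → ℕ) where

  columnSum-over : ∀ a b → columnSum f (columnOver (a , b)) ≡ doubled f a b + (vertical f a + vertical f b)
  columnSum-over a b = lem (vertical f a) (vertical f b) (f (a , false) (b , false)) (f (a , false) (b , true)) (f (a , true) (b , false)) (f (a , true) (b , true))
    where
    lem : ∀ v w a b c d → v + (w + (a + (b + (c + (d + 0))))) ≡ ((a + b) + (c + d)) + (v + w)
    lem = solve-∀

  private
    two : ∀ a b c d → f (a , false) (b , false) + (f (a , false) (b , true) + (f (a , true) (b , false) + (f (a , true) (b , true) +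
          (f (c , false) (d , false) + (f (c , false) (d , true) + (f (c , true) (d , false) + (f (c , true) (d , true) + 0)))))))
          ≡ doubled f a b + doubled f c d
    two a b c d = lem (f (a , false) (b , false)) (f (a , false) (b , true)) (f (a , true) (b , false)) (f (a , true) (b , true))
                      (f (c , false) (d , false)) (f (c , false) (d , true)) (f (c , true) (d , false)) (f (c , true) (d , true))
      where
      lem : ∀ a b c d e f g h → a + (b + (c + (d + (e + (f + (g + (h + 0))))))) ≡ ((a + b) + (c + d)) + ((e + f) + (g + h))
      lem = solve-∀

  gapSum-rail : ∀ a b c d → gapSum f rail (columnOver (a , b)) (columnOver (c , d)) ≡ doubled f b c + doubled f a d
  gapSum-rail a b c d = two b c a d

  gapSum-into : ∀ a b c d → gapSum f into-apex (columnOver (a , b)) (columnOver (c , d)) ≡ doubled f b c + doubled f a c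
  gapSum-into a b c d = two b c a c

  gapSum-from : ∀ a b c d → gapSum f from-apex (columnOver (a , b)) (columnOver (c , d)) ≡ doubled f b c + doubled f b d
  gapSum-from a b c d = two b c b d

nodeSum-over : (g : A × Bool → ℕ) (cs : List (A × A)) → ∑ (nodeSum g) (map columnOver cs) ≡ ∑ (bothCopies g) (endpoints cs)
nodeSum-over g []             = refl
nodeSum-over g ((a , b) ∷ cs) = cong (nodeSum g (columnOver (a , b)) +_) (nodeSum-over g cs)
  ⟫ lem (g (a , false)) (g (a , true)) (g (b , false)) (g (b , true)) (∑ (bothCopies g) (endpoints cs))
  where
  lem : ∀ a b c d e → (a + (b + (c + d))) + e ≡ (a + b) + ((c + d) + e)
  lem = solve-∀

module _ (g : ℕ) where

  private
    q : ℕ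
    q = suc (suc g * 2)

  climbSum-over : ∀ f n x → climbSum f (map columnOver (columnsFrom g (suc n) x)) (columnOver (q , 0))
                ≡ edgeSum (doubled f) (climb g (suc n) x) + ∑ (vertical f) (endpoints (columnsFrom g (suc n) x))
  climbSum-over f zero x = cong₂ (λ u v → u + (v + 0)) (columnSum-over f x x′) (gapSum-into f x x′ q 0)
    ⟫ lem (doubled f x x′) (vertical f x) (vertical f x′) (doubled f x′ q) (doubled f x q)
    where
    x′ : ℕ
    x′ = q ∸ x
    lem : ∀ a v w b c → (a + (v + w)) + ((b + c) + 0) ≡ (a + (b + (c + 0))) + (v + (w + 0))
    lem = solve-∀
  climbSum-over f (suc n) x = cong₂ _+_ (columnSum-over f x x′) (cong₂ _+_ (gapSum-rail f x x′ (suc x) (q ∸ suc x)) (climbSum-over f n (suc x)))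
    ⟫ lem (doubled f x x′) (vertical f x) (vertical f x′) (doubled f x′ (suc x)) (doubled f x (q ∸ suc x))
        (edgeSum (doubled f) (climb g (suc n) (suc x))) (∑ (vertical f) (endpoints (columnsFrom g (suc n) (suc x))))
    where
    x′ : ℕ
    x′ = q ∸ x
    lem : ∀ a v w b c d e → (a + (v + w)) + ((b + c) + (d + e)) ≡ (a + (b + (c + d))) + (v + (w + e))
    lem = solve-∀

  ladderSum-over : ∀ f → ladderSum f (columnOver (q , 0)) (map columnOver (columnsFrom g (suc g) 1))
                 ≡ edgeSum (doubled f) (ladder g) + ∑ (vertical f) (downFrom (suc q))
  ladderSum-over f = cong₂ _+_ (columnSum-over f q 0) (cong₂ _+_ (gapSum-from f q 0 1 (q ∸ 1)) (climbSum-over f g 1))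
    ⟫ lem (doubled f q 0) (vertical f q) (vertical f 0) (doubled f 0 1) (doubled f 0 (q ∸ 1))
        (edgeSum (doubled f) (climb g (suc g) 1)) (∑ (vertical f) (endpoints (columnsFrom g (suc g) 1)))
    ⟫ cong (edgeSum (doubled f) (ladder g) +_) (sym (∑-↭ (vertical f) (ladder-vertices g)))
    where
    lem : ∀ a v w b c d e → (a + (v + w)) + ((b + c) + (d + e)) ≡ (a + (b + (c + d))) + (v + (w + e))
    lem = solve-∀

  decompose-even : ∀ T Us → HalfType (suc q) T → length Us ≡ g → All (HalfType (suc q)) Us →
                   Decomposition (double (downFrom (suc q))) (T ∷ T ∷ T ∷ twice Us)
  decompose-even T Us (rs , T≡ , r≥2 , s) e t with walecki-even g
  ... | Cs , l , ham , total = record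
    { factors  = map R.factor colours ++ D.factors ; matching = R.matching
    ; edges    = λ f f-sym → cong (_+ edgeSum f R.matching) (cong (λ d → ∑ (cycleSum f) (R.factor red) + (∑ (cycleSum f) (R.factor green) + (∑ (cycleSum f) (R.factor blue) + d))) (D.edges f f-sym))
        ⟫ lem (∑ (cycleSum f) (R.factor red)) (∑ (cycleSum f) (R.factor green)) (∑ (cycleSum f) (R.factor blue)) (∑ (cycleSum (doubled f)) Cs) (edgeSum f R.matching)
        ⟫ cong (∑ (cycleSum (doubled f)) Cs +_) (R.edges f f-sym ⟫ ladderSum-over f)
        ⟫ sym (+-assoc (∑ (cycleSum (doubled f)) Cs) (edgeSum (doubled f) (ladder g)) _)
        ⟫ cong (_+ ∑ (vertical f) vs) (total (doubled f) (doubled-sym f f-sym))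
        ⟫ sym (edgeSum-double f vs)
    ; spans    = spans red ∷ spans green ∷ spans blue ∷ D.spans
    ; spansᴹ   = λ w → R.spansᴹ w ⟫ nodes w
    ; types    = R.type red ∷ R.type green ∷ R.type blue ∷ D.types }
    where
    vs : List ℕ
    vs = downFrom (suc q)
    module D = Doubles (doubles (suc q) Cs Us (l ⟫ sym e) ham t)
    even≥4 : ∀ {rs} → All (2 ≤_) rs → All Even≥4 (map (_* 2) rs)
    even≥4 []                        = []
    even≥4 (s≤s (s≤s {n = h} _) ∷ p) = (h , refl) ∷ even≥4 p
    length-columns : ∀ n x → length (map columnOver (columnsFrom g n x)) ≡ n
    length-columns zero    x = refl
    length-columns (suc n) x = cong suc (length-columns n (suc x))
    size : sum T ≡ (2 + length (map columnOver (columnsFrom g g 2))) * 4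
    size = cong sum T≡ ⟫ sum-double rs ⟫ cong (_* 2) s ⟫ lem g ⟫ cong (λ k → (2 + k) * 4) (sym (length-columns g 2))
      where
      lem : ∀ g → suc (suc (suc g * 2)) * 2 ≡ (2 + g) * 4
      lem = solve-∀
    module R = Triple (triple (sorted T (subst (All Even≥4) (sym T≡) (even≥4 r≥2))) (columnOver (q , 0))
      (columnOver (1 , q ∸ 1)) (map columnOver (columnsFrom g g 2)) size)
    nodes : ∀ w → ∑ (nodeSum w) (map columnOver ((q , 0) ∷ columnsFrom g (suc g) 1)) ≡ ∑ w (double vs)
    nodes w = nodeSum-over w ((q , 0) ∷ columnsFrom g (suc g) 1) ⟫ sym (∑-↭ (bothCopies w) (ladder-vertices g)) ⟫ sym (∑-double w vs)
    spans : ∀ X w → ∑ (∑ w) (R.factor X) ≡ ∑ w (double vs)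
    spans X w = R.spans X w ⟫ nodes w
    lem : ∀ a b c d e → (a + (b + (c + d))) + e ≡ d + ((a + (b + (c + 0))) + e)
    lem = solve-∀

-- Prescribing the 1-factor

unique-↭ : {xs ys : List A} → xs ↭ ys → Unique xs → Unique ys
unique-↭ p = Unique-resp-↭ (setoid _) (↭⇒↭ₛ p)

record Packing (k : ℕ) (M : List (A × A)) (vs : List A) (Ts : List (List ℕ)) : Set where
  field
    factors : List (List (List A))
    edges   : ∀ f → Symmetric f → ∑ (∑ (cycleSum f)) factors + edgeSum f M ≡ k * edgeSum f (pairs vs)
    spans   : All (λ F → ∀ g → ∑ (∑ g) F ≡ ∑ g vs) factors
    types   : Pointwise (λ F T → map length F ↭ T) factors Ts

module _ (_≟_ : DecidableEquality A) where

  -- The argument `b` is the value away from the list. Bijectivity appears only in `relabel`, as a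
  -- permutation between lists of vertices.
  function-between : B → ∀ (us : List A) (ws : List B) → Unique us → length us ≡ length ws → ∃ λ φ → map φ us ≡ ws
  function-between b []       []       _        e = (λ _ → b) , refl
  function-between b (u ∷ us) (w ∷ ws) (u∉ ∷ uq) e with function-between b us ws uq (suc-injective e)
  ... | φ , p = ψ , cong₂ _∷_ ψu (away us u∉ ⟫ p)
    where
    ψ : A → _
    ψ x with x ≟ u
    ... | yes _ = w
    ... | no  _ = φ x
    ψu : ψ u ≡ w
    ψu with u ≟ u
    ... | yes _ = refl
    ... | no ¬p = ⊥-elim (¬p refl)
    away : ∀ xs → All (λ x → u ≡ x → ⊥) xs → map ψ xs ≡ map φ xs
    away []       []       = refl
    away (x ∷ xs) (n ∷ ns) = cong₂ _∷_ ψx (away xs ns)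
      where
      ψx : ψ x ≡ φ x
      ψx with x ≟ u
      ... | yes p = ⊥-elim (n (sym p))
      ... | no  _ = refl

  matching-map : (φ : A → B) (M : List (A × A)) (M′ : List (B × B)) → map φ (endpoints M) ≡ endpoints M′ →
                 ∀ f → edgeSum f M′ ≡ edgeSum (λ a b → f (φ a) (φ b)) M
  matching-map φ []            []       e f = refl
  matching-map φ ((a , b) ∷ M) ((c , d) ∷ M′) e f with ∷-injective e
  ... | p , e′ with ∷-injective e′
  ...   | q , e″ = cong₂ _+_ (cong₂ f (sym p) (sym q)) (matching-map φ M M′ e″ f)
  matching-map φ [] (_ ∷ _) () f
  matching-map φ (_ ∷ _) [] () f

  -- The endpoints of a perfect matching list every vertex once. Reading those of the old matching
  -- against those of `M`, position by position, defines a renaming that carries one matching to the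
  -- other, and a complete graph is invariant under renaming.
  relabel : B → ∀ {vs : List A} {ws : List B} {Ts} → Unique vs → length vs ≡ length ws → Decomposition vs Ts →
            ∀ M → endpoints M ↭ ws → Packing 1 M ws Ts
  relabel b {vs} {ws} {Ts} uq l D M p
    with function-between b (endpoints (Decomposition.matching D)) (endpoints M)
           (unique-↭ (∑⇒↭ _≟_ vs (endpoints (Decomposition.matching D)) (λ g → sym (Decomposition.spansᴹ D g))) uq)
           (↭-length (∑⇒↭ _≟_ (endpoints (Decomposition.matching D)) vs (Decomposition.spansᴹ D)) ⟫ l ⟫ sym (↭-length p))
  ... | φ , e = record
    { factors = map (map (map φ)) factors
    ; edges   = λ f f-sym → cong₂ _+_ (∑-map (∑ (cycleSum f)) (map (map φ)) factors
                  ⟫ ∑-cong (λ F → ∑-map (cycleSum f) (map φ) F ⟫ ∑-cong (cycleSum-map f φ) F) factors) (matching-map φ matching M e f)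
                ⟫ edges (λ a b → f (φ a) (φ b)) (λ a b → f-sym (φ a) (φ b))
                ⟫ sym (edgeSum-pairs-map f φ vs) ⟫ edgeSum-pairs-↭ f f-sym onto ⟫ sym (+-identityʳ _)
    ; spans   = renamed-spans factors spans
    ; types   = renamed-types factors Ts types }
    where
    open Decomposition D
    onto : map φ vs ↭ ws
    onto = ↭-trans (↭-map⁺ φ (↭-sym (∑⇒↭ _≟_ (endpoints matching) vs spansᴹ))) (↭-trans (↭-reflexive e) p)
    renamed-spans : ∀ Fs → All (λ F → ∀ g → ∑ (∑ g) F ≡ ∑ g vs) Fs → All (λ F → ∀ g → ∑ (∑ g) F ≡ ∑ g ws) (map (map (map φ)) Fs)
    renamed-spans []       []       = []
    renamed-spans (F ∷ Fs) (s ∷ ss) = (λ g → ∑-map (∑ g) (map φ) F ⟫ ∑-cong (∑-map g φ) F ⟫ s (g ∘ φ) ⟫ sym (∑-map g φ vs) ⟫ ∑-↭ g onto)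
      ∷ renamed-spans Fs ss
    lengths : ∀ (F : List (List A)) → map length (map (map φ) F) ≡ map length F
    lengths []      = refl
    lengths (C ∷ F) = cong₂ _∷_ (length-map φ C) (lengths F)
    renamed-types : ∀ Fs Ts → Pointwise (λ F T → map length F ↭ T) Fs Ts → Pointwise (λ F T → map length F ↭ T) (map (map (map φ)) Fs) Ts
    renamed-types []       []       []       = []
    renamed-types (F ∷ Fs) (T ∷ Ts) (r ∷ rs) = ↭-trans (↭-reflexive (lengths F)) r ∷ renamed-types Fs Ts rs

-- Superposing copies of the complete graph

chop : ∀ n m (xs : List A) → length xs ≡ n + m → ∃₂ λ ys zs → xs ≡ ys ++ zs × length ys ≡ n × length zs ≡ m
chop zero    m xs       e = [] , xs , refl , refl , e
chop (suc n) m (x ∷ xs) e with chop n m xs (suc-injective e)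
... | ys , zs , refl , p , q = x ∷ ys , zs , refl , cong suc p , q

record Alternation (T : List ℕ) (vs : List A) : Set where
  field
    cycles       : List (List A)
    first second : List (A × A)
    edges   : ∀ f → ∑ (cycleSum f) cycles ≡ edgeSum f first + edgeSum f second
    spans   : ∀ g → ∑ (∑ g) cycles ≡ ∑ g vs
    spans₁  : ∀ g → ∑ g (endpoints first) ≡ ∑ g vs
    spans₂  : ∀ g → ∑ g (endpoints second) ≡ ∑ g vs
    type    : map length cycles ≡ T

-- The number of edges is even, so the edges in odd position cover `u` and the interior while those
-- in even position cover `w` and the interior. For `w = u` both are perfect matchings of a cycle.
alternate : ∀ r (u : A) xs w → suc (length xs) ≡ r * 2 → ∃₂ λ M₁ M₂ →
            (∀ f → pathSum f u xs w ≡ edgeSum f M₁ + edgeSum f M₂) ×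
            (∀ g → ∑ g (endpoints M₁) ≡ g u + ∑ g xs) × (∀ g → ∑ g (endpoints M₂) ≡ g w + ∑ g xs)
alternate (suc zero) u (x ∷ []) w e = [ u , x ] , [ x , w ] ,
  (λ f → lem (f u x) (f x w)) , (λ g → refl) , (λ g → lem′ (g x) (g w))
  where
  lem : ∀ a b → a + b ≡ (a + 0) + (b + 0)
  lem = solve-∀
  lem′ : ∀ a b → a + (b + 0) ≡ b + (a + 0)
  lem′ = solve-∀
alternate (suc (suc r)) u (x ∷ y ∷ xs) w e with alternate (suc r) y xs w (suc-injective (suc-injective e))
... | M₁ , M₂ , E , N₁ , N₂ = (u , x) ∷ M₁ , (x , y) ∷ M₂ ,
  (λ f → cong (λ z → f u x + (f x y + z)) (E f) ⟫ lem (f u x) (f x y) (edgeSum f M₁) (edgeSum f M₂)) ,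
  (λ g → cong (λ z → g u + (g x + z)) (N₁ g)) ,
  (λ g → cong (λ z → g x + (g y + z)) (N₂ g) ⟫ lem′ (g x) (g y) (g w) (∑ g xs))
  where
  lem : ∀ a b c d → a + (b + (c + d)) ≡ (a + c) + (b + d)
  lem = solve-∀
  lem′ : ∀ a b c d → a + (b + (c + d)) ≡ c + (a + (b + d))
  lem′ = solve-∀
alternate (suc zero)    u []       w ()
alternate (suc zero)    u (x ∷ y ∷ xs) w ()
alternate (suc (suc r)) u []       w ()
alternate (suc (suc r)) u (x ∷ []) w ()
alternate zero u xs w ()

alternation : ∀ rs → All (2 ≤_) rs → ∀ (vs : List A) → length vs ≡ sum rs * 2 → Alternation (map (_* 2) rs) vs
alternation [] [] [] e = record
  { cycles = [] ; first = [] ; second = [] ; edges = λ _ → refl ; spans = λ _ → refl ; spans₁ = λ _ → refl ; spans₂ = λ _ → refl ; type = refl }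
alternation (r ∷ rs) (p ∷ ps) vs e with chop (r * 2) (sum rs * 2) vs (e ⟫ *-distribʳ-+ 2 r (sum rs))
alternation (zero ∷ rs) (() ∷ ps) _ e | _
... | u ∷ xs , ws , refl , l , l′ with alternate r u xs u l
...   | M₁ , M₂ , E , N₁ , N₂ = record
  { cycles = (u ∷ xs) ∷ R.cycles ; first = M₁ ++ R.first ; second = M₂ ++ R.second
  ; edges  = λ f → cong₂ _+_ (E f) (R.edges f) ⟫ lem (edgeSum f M₁) (edgeSum f M₂) (edgeSum f R.first) (edgeSum f R.second)
      ⟫ sym (cong₂ _+_ (∑-++ (uncurry f) M₁ R.first) (∑-++ (uncurry f) M₂ R.second))
  ; spans  = λ g → cong (∑ g (u ∷ xs) +_) (R.spans g) ⟫ sym (∑-++ g (u ∷ xs) ws)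
  ; spans₁ = λ g → append-sums g M₁ R.first (N₁ g) (R.spans₁ g)
  ; spans₂ = λ g → append-sums g M₂ R.second (N₂ g) (R.spans₂ g)
  ; type   = cong₂ _∷_ l R.type }
  where
  module R = Alternation (alternation rs ps ws l′)
  lem : ∀ a b c d → (a + b) + (c + d) ≡ (a + c) + (b + d)
  lem = solve-∀
  append-sums : ∀ g (M N : List (_ × _)) → ∑ g (endpoints M) ≡ ∑ g (u ∷ xs) → ∑ g (endpoints N) ≡ ∑ g ws → ∑ g (endpoints (M ++ N)) ≡ ∑ g ((u ∷ xs) ++ ws)
  append-sums g M N p q = cong (∑ g) (concatMap-++ _ M N) ⟫ ∑-++ g (endpoints M) (endpoints N) ⟫ cong₂ _+_ p q ⟫ sym (∑-++ g (u ∷ xs) ws)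
alternation (suc r ∷ rs) (p ∷ ps) _ e | [] , ws , refl , () , l′
alternation [] [] (_ ∷ _) ()

couples : ∀ k (vs : List A) → length vs ≡ k * 2 → ∃ λ M → endpoints M ≡ vs
couples zero    []           e = [] , refl
couples (suc k) (x ∷ y ∷ vs) e with couples k vs (suc-injective (suc-injective e))
... | M , p = (x , y) ∷ M , cong (λ l → x ∷ y ∷ l) p
couples (suc k) []       ()
couples (suc k) (x ∷ []) ()
couples zero    (x ∷ vs) ()

data Leftover (vs : List A) : ℕ → List (A × A) → Set where
  none    : ∀ k → Leftover vs (k * 2) []
  perfect : ∀ k {M} → endpoints M ↭ vs → Leftover vs (suc (k * 2)) M

module _ (_≟_ : DecidableEquality A) {vs : List A} {m : ℕ} (even : length vs ≡ m * 2)
         {Copy : List (List ℕ) → Set} (pack : ∀ {Ts} → Copy Ts → ∀ M → endpoints M ↭ vs → Packing 1 M vs Ts) where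

  empty : Packing 0 [] vs []
  empty = record { factors = [] ; edges = λ _ _ → refl ; spans = [] ; types = [] }

  -- The alternate edges of a single 2-factor are the leftover matchings of two copies.
  superpose : ∀ {k M S Ts Us Vs} → HalfType m S → Copy Ts → Copy Us → Packing k M vs Vs → Packing (2 + k) M vs (S ∷ Ts ++ Us ++ Vs)
  superpose {k} {M} (rs , refl , r≥2 , s) c d P = record
    { factors = Alt.cycles ∷ P₁.factors ++ P₂.factors ++ P.factors
    ; edges   = λ f f-sym → cong (λ z → (∑ (cycleSum f) Alt.cycles + z) + edgeSum f M)
                    (∑-++ (∑ (cycleSum f)) P₁.factors _ ⟫ cong (∑ (∑ (cycleSum f)) P₁.factors +_) (∑-++ (∑ (cycleSum f)) P₂.factors _))
        ⟫ cong (λ z → (z + (∑ (∑ (cycleSum f)) P₁.factors + (∑ (∑ (cycleSum f)) P₂.factors + ∑ (∑ (cycleSum f)) P.factors))) + edgeSum f M) (Alt.edges f)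
        ⟫ lem (edgeSum f Alt.first) (edgeSum f Alt.second) (∑ (∑ (cycleSum f)) P₁.factors) (∑ (∑ (cycleSum f)) P₂.factors) (∑ (∑ (cycleSum f)) P.factors) (edgeSum f M)
        ⟫ cong₂ _+_ (P₁.edges f f-sym) (cong₂ _+_ (P₂.edges f f-sym) (P.edges f f-sym))
        ⟫ lem′ (edgeSum f (pairs vs)) k
    ; spans   = Alt.spans ∷ All-++⁺ P₁.spans (All-++⁺ P₂.spans P.spans)
    ; types   = ↭-reflexive Alt.type ∷ Pointwise.++⁺ P₁.types (Pointwise.++⁺ P₂.types P.types) }
    where
    module P = Packing P
    module Alt = Alternation (alternation rs r≥2 vs (even ⟫ cong (_* 2) (sym s)))
    module P₁ = Packing (pack c Alt.first (∑⇒↭ _≟_ (endpoints Alt.first) vs Alt.spans₁))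
    module P₂ = Packing (pack d Alt.second (∑⇒↭ _≟_ (endpoints Alt.second) vs Alt.spans₂))
    lem : ∀ a b p q r m → ((a + b) + (p + (q + r))) + m ≡ (p + a) + ((q + b) + (r + m))
    lem = solve-∀
    lem′ : ∀ e k → (1 * e) + ((1 * e) + k * e) ≡ (2 + k) * e
    lem′ = solve-∀

  -- Each type in `Ss` takes up the matchings of two copies, and `k` is the parity of the number of
  -- copies. A last unpaired copy is given an arbitrary perfect matching, which remains as the
  -- 1-factor.
  superpositions : ∀ Bs Ss k → length Bs ≡ k + length Ss * 2 → k ≤ 1 → All Copy Bs → All (HalfType m) Ss →
                   ∃₂ λ M Ts → Packing (length Bs) M vs Ts × Ts ↭ Ss ++ concat Bs × Leftover vs (length Bs) M
  superpositions [] [] zero e k≤1 [] [] = [] , [] , empty , ↭-refl , none 0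
  superpositions (B ∷ []) [] (suc zero) e k≤1 (c ∷ []) [] with couples m vs even
  ... | M , p = M , B , pack c M (↭-reflexive p) , ↭-reflexive (sym (++-identityʳ B)) , perfect 0 (↭-reflexive p)
  superpositions (B ∷ B′ ∷ Bs) (S ∷ Ss) k e k≤1 (c ∷ d ∷ cs) (t ∷ ts)
    with superpositions Bs Ss k (suc-injective (suc-injective (e ⟫ lem k (length Ss)))) k≤1 cs ts
    where
    lem : ∀ k n → k + suc n * 2 ≡ suc (suc (k + n * 2))
    lem = solve-∀
  ... | M , Ts , P , q , L = M , S ∷ B ++ B′ ++ Ts , superpose t c d P ,
      prep S (↭-trans (++⁺ˡ B (++⁺ˡ B′ q))
        (↭-trans (++⁺ˡ B (shifts B′ Ss)) (shifts B Ss)))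
      , step L
    where
    step : ∀ {n M} → Leftover vs n M → Leftover vs (2 + n) M
    step (none k)      = none (suc k)
    step (perfect k p) = perfect (suc k) p
  superpositions [] [] (suc _) () _ _ _
  superpositions [] (_ ∷ _) zero () _ _ _
  superpositions [] (_ ∷ _) (suc _) () _ _ _
  superpositions (B ∷ []) [] zero () _ _ _
  superpositions (B ∷ []) [] (suc (suc _)) () _ _ _
  superpositions (B ∷ []) (S ∷ Ss) zero () _ _ _
  superpositions (B ∷ []) (S ∷ Ss) (suc zero) () _ _ _
  superpositions (B ∷ []) (S ∷ Ss) (suc (suc _)) e (s≤s ()) _ _
  superpositions (B ∷ B′ ∷ Bs) [] zero () _ _ _
  superpositions (B ∷ B′ ∷ Bs) [] (suc zero) () _ _ _
  superpositions (B ∷ B′ ∷ Bs) [] (suc (suc _)) e (s≤s ()) _ _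

-- Splitting multiplicities into singles, pairs and triples

thrice : List A → List A
thrice = concatMap (λ x → x ∷ x ∷ x ∷ [])

replicate-+ : ∀ a b (x : A) → replicate (a + b) x ≡ replicate a x ++ replicate b x
replicate-+ zero    b x = refl
replicate-+ (suc a) b x = cong (x ∷_) (replicate-+ a b x)

replicate-twice : ∀ k (x : A) → replicate (k * 2) x ≡ twice (replicate k x)
replicate-twice zero    x = refl
replicate-twice (suc k) x = cong (λ l → x ∷ x ∷ l) (replicate-twice k x)

-- Splitting a multiplicity repeats the same type in consecutive entries, so the expanded list stays
-- literally equal and the parts α can replace the multiplicities β.
blocks : ∀ parts Tβ → Pointwise (λ p x → sum p ≡ x) parts (map proj₂ Tβ) →
         ∃ λ Tα → expandType Tα ≡ expandType Tβ × map proj₂ Tα ≡ concat parts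
blocks []          []             []          = [] , refl , refl
blocks (p ∷ parts) ((T , _) ∷ Tβ) (refl ∷ ps) with blocks parts Tβ ps
... | Tα , e , e′ = map (T ,_) p ++ Tα ,
  concatMap-++ _ (map (T ,_) p) Tα ⟫ cong₂ _++_ (expand p) e ,
  map-++ proj₂ (map (T ,_) p) Tα ⟫ cong₂ _++_ (sym (map-∘ p) ⟫ map-id p) e′
  where
  expand : ∀ p → expandType (map (T ,_) p) ≡ replicate (sum p) T
  expand []      = refl
  expand (a ∷ p) = cong (replicate a T ++_) (expand p) ⟫ sym (replicate-+ a (sum p) T)

numOdd-even : ∀ k as → numOdd (k * 2 ∷ as) ≡ numOdd as
numOdd-even k as = cong length (filter-reject (λ a → a % 2 ≟ℕ 1) {x = k * 2} {xs = as} λ p → 0≢1 (sym (m*n%n≡0 k 2) ⟫ p))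
  where
  0≢1 : 0 ≡ 1 → ⊥
  0≢1 ()

numOdd-odd : ∀ k as → numOdd (suc (k * 2) ∷ as) ≡ suc (numOdd as)
numOdd-odd k as = cong length (filter-accept (λ a → a % 2 ≟ℕ 1) {x = suc (k * 2)} {xs = as} ([m+kn]%n≡m%n 1 k 2))

numOddGe3-even : ∀ k as → numOddGe3 (k * 2 ∷ as) ≡ numOddGe3 as
numOddGe3-even k as with 3 ≤? k * 2
... | yes p = cong numOdd (filter-accept (3 ≤?_) {x = k * 2} {xs = as} p) ⟫ numOdd-even k (filter (3 ≤?_) as)
... | no ¬p = cong numOdd (filter-reject (3 ≤?_) {x = k * 2} {xs = as} ¬p)

numOddGe3-odd : ∀ k as → numOddGe3 (suc (suc k * 2) ∷ as) ≡ suc (numOddGe3 as)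
numOddGe3-odd k as = cong numOdd (filter-accept (3 ≤?_) {x = suc (suc k * 2)} {xs = as} (s≤s (s≤s (s≤s z≤n)))) ⟫ numOdd-odd (suc k) (filter (3 ≤?_) as)

parity : ∀ a → ∃ λ k → a ≡ k * 2 ⊎ a ≡ suc (k * 2)
parity zero    = 0 , inj₁ refl
parity (suc a) with parity a
... | k , inj₁ p = k , inj₂ (cong suc p)
... | k , inj₂ p = suc k , inj₁ (cong suc p)

prepend-doubles : ∀ k (x : A) {zs} ss us vs → zs ↭ ss ++ twice us ++ vs → replicate (k * 2) x ++ zs ↭ ss ++ twice (replicate k x ++ us) ++ vs
prepend-doubles k x {zs} ss us vs p = ↭-trans (↭-reflexive (cong (_++ zs) (replicate-twice k x)))
  (↭-trans (++⁺ˡ (twice xs) p) (↭-trans (shifts (twice xs) ss)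
    (++⁺ˡ ss (↭-reflexive (sym (cong (_++ vs) (concatMap-++ _ xs us) ⟫ ++-assoc (twice xs) (twice us) vs))))))
  where
  xs : List _
  xs = replicate k x

record Selection (t : ℕ) (Tα : List (TwoFactorType × ℕ)) : Set where
  field
    singles doublets triples : List TwoFactorType
    order        : expandType Tα ↭ singles ++ twice doublets ++ thrice triples
    odd-count    : length singles + t ≡ numOdd (map proj₂ Tα)
    triple-count : length triples ≡ t

-- An odd multiplicity leaves a single factor beside pairs, or a triple while t is positive.
select : ∀ t Tα → t ≤ numOddGe3 (map proj₂ Tα) → Selection t Tα
select zero    []              p = record { singles = [] ; doublets = [] ; triples = [] ; order = ↭-refl ; odd-count = refl ; triple-count = refl }
select t       ((T , a) ∷ Tα)  p with parity a
select t       ((T , _) ∷ Tα)  p | k , inj₁ refl = record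
  { singles = S.singles ; doublets = replicate k T ++ S.doublets ; triples = S.triples
  ; order   = prepend-doubles k T S.singles S.doublets (thrice S.triples) S.order
  ; odd-count = S.odd-count ⟫ sym (numOdd-even k (map proj₂ Tα)) ; triple-count = S.triple-count }
  where module S = Selection (select t Tα (≤-trans p (≤-reflexive (numOddGe3-even k (map proj₂ Tα)))))
select (suc t) ((T , _) ∷ Tα)  p | suc k , inj₂ refl = record
  { singles = S.singles ; doublets = replicate k T ++ S.doublets ; triples = T ∷ S.triples
  ; order   = ↭-trans (prep T (prep T (prep T (prepend-doubles k T S.singles S.doublets (thrice S.triples) S.order))))
                (↭-trans (shifts (T ∷ T ∷ T ∷ []) S.singles) (++⁺ˡ S.singles (shifts (T ∷ T ∷ T ∷ []) (twice (replicate k T ++ S.doublets)))))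
  ; odd-count = +-suc (length S.singles) t ⟫ cong suc S.odd-count ⟫ sym (numOdd-odd (suc k) (map proj₂ Tα))
  ; triple-count = cong suc S.triple-count }
  where module S = Selection (select t Tα (s≤s⁻¹ (≤-trans p (≤-reflexive (numOddGe3-odd k (map proj₂ Tα))))))
select zero    ((T , _) ∷ Tα)  p | k , inj₂ refl = record
  { singles = T ∷ S.singles ; doublets = replicate k T ++ S.doublets ; triples = S.triples
  ; order   = prep T (prepend-doubles k T S.singles S.doublets (thrice S.triples) S.order)
  ; odd-count = cong suc S.odd-count ⟫ sym (numOdd-odd k (map proj₂ Tα)) ; triple-count = S.triple-count }
  where module S = Selection (select 0 Tα z≤n)
-- Multiplicity 1 is odd but too small for a triple and does not count in `numOddGe3`, so the demand
-- for triples is passed on unchanged.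
select (suc t) ((T , _) ∷ Tα)  p | zero , inj₂ refl = record
  { singles = T ∷ S.singles ; doublets = S.doublets ; triples = S.triples ; order = prep T S.order
  ; odd-count = cong suc S.odd-count ; triple-count = S.triple-count }
  where module S = Selection (select (suc t) Tα p)

chunks : ∀ k g d (xs : List A) → length xs ≡ k * g + d →
         ∃₂ λ yss zs → xs ≡ concat yss ++ zs × length yss ≡ k × All (λ ys → length ys ≡ g) yss × length zs ≡ d
chunks zero    g d xs e = [] , xs , refl , refl , [] , e
chunks (suc k) g d xs e with chop g (k * g + d) xs (e ⟫ +-assoc g (k * g) d)
... | ys , zs , refl , l , l′ with chunks k g d zs l′
...   | yss , rs , refl , p , q , r = ys ∷ yss , rs , sym (++-assoc ys (concat yss) rs) , cong suc p , l ∷ q , r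

record Schedule (singles-count k g t : ℕ) (Ts : List TwoFactorType) : Set where
  field
    singles      : List TwoFactorType
    portions     : List (List TwoFactorType)
    triples      : List TwoFactorType
    order        : Ts ↭ singles ++ thrice triples ++ twice (concat portions)
    single-count : length singles ≡ singles-count
    portions-count : length portions ≡ k
    portion-size : All (λ B → length B ≡ g) portions
    triple-count : length triples ≡ t

length-twice : (xs : List A) → length (twice xs) ≡ length xs * 2
length-twice []       = refl
length-twice (x ∷ xs) = cong (2 +_) (length-twice xs)

length-thrice : (xs : List A) → length (thrice xs) ≡ length xs * 3
length-thrice []       = refl
length-thrice (x ∷ xs) = cong (3 +_) (length-thrice xs)

-- The pairs in excess of k * g are broken up into single factors.
schedule : ∀ {t Tα} (S : Selection t Tα) → ∀ k g e → length (Selection.doublets S) * 2 ≡ k * g * 2 + e →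
           Schedule (length (Selection.singles S) + e) k g t (expandType Tα)
schedule {t} S k g e eq with chunks k g d S.doublets doubles-count
  where
  module S = Selection S
  d : ℕ
  d = length S.doublets ∸ k * g
  doubles-count : length S.doublets ≡ k * g + d
  doubles-count = sym (m+[n∸m]≡n (*-cancelʳ-≤ (k * g) (length S.doublets) 2 (≤-trans (m≤m+n (k * g * 2) e) (≤-reflexive (sym eq)))))
... | Bs , Rs , p , b , c , r = record
  { singles = twice Rs ++ S.singles ; portions = Bs ; triples = S.triples
  ; order = ↭-trans S.order (↭-trans (++⁺ˡ S.singles (↭-trans (↭-reflexive (cong (_++ thrice S.triples) (cong twice p ⟫ concatMap-++ _ (concat Bs) Rs)))
              (↭-trans (++⁺ʳ (thrice S.triples) (++-comm (twice (concat Bs)) (twice Rs)))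
              (↭-trans (↭-reflexive (++-assoc (twice Rs) (twice (concat Bs)) (thrice S.triples)))
                (++⁺ˡ (twice Rs) (++-comm (twice (concat Bs)) (thrice S.triples)))))))
              (↭-trans (shifts S.singles (twice Rs)) (↭-reflexive (sym (++-assoc (twice Rs) S.singles _)))))
  ; single-count = length-++ (twice Rs) ⟫ cong (_+ length S.singles) (length-twice Rs ⟫ extra) ⟫ +-comm e _
  ; portions-count = b ; portion-size = c ; triple-count = S.triple-count }
  where
  module S = Selection S
  extra : length Rs * 2 ≡ e
  extra = +-cancelˡ-≡ (k * g * 2) _ _ (sym (*-distribʳ-+ 2 (k * g) (length Rs))
    ⟫ cong (_* 2) (cong (k * g +_) r ⟫ sym doubles-count) ⟫ eq)
    where
    doubles-count : length S.doublets ≡ k * g + (length S.doublets ∸ k * g)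
    doubles-count = sym (m+[n∸m]≡n (*-cancelʳ-≤ (k * g) (length S.doublets) 2 (≤-trans (m≤m+n (k * g * 2) e) (≤-reflexive (sym eq)))))

-- From test functions to edge multiplicities

indicated : {P : A → Set} → Decidable P → A → ℕ
indicated P? x = if does (P? x) then 1 else 0

length-filter-∑ : {P : A → Set} (P? : Decidable P) (xs : List A) → length (filter P? xs) ≡ ∑ (indicated P?) xs
length-filter-∑ P? []       = refl
length-filter-∑ P? (x ∷ xs) with does (P? x)
... | true  = cong suc (length-filter-∑ P? xs)
... | false = length-filter-∑ P? xs

-- The symmetric weight whose sum over an edge list is `mult u v`.
joined : ∀ {n} (u v : Fin n) → Fin n → Fin n → ℕ
joined u v a b = indicated (joins? u v) (a , b)

joined-sym : ∀ {n} (u v : Fin n) → Symmetric (joined u v)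
joined-sym u v a b = cong (if_then 1 else 0)
  (∨-comm (does (a ≟ᶠ u) ∧ does (b ≟ᶠ v)) _ ⟫ cong₂ _∨_ (∧-comm (does (a ≟ᶠ v)) _) (∧-comm (does (a ≟ᶠ u)) _))

module _ {n : ℕ} {u v : Fin n} (u≢v : u ≢ v) where

  private
    elsewhere : Fin n → Set
    elsewhere z = u ≢ z × v ≢ z

  joined-zero : ∀ {a b} → elsewhere b → joined u v a b ≡ 0
  joined-zero {a} {b} (p , q) = cong (if_then 1 else 0) (dec-false (joins? u v (a , b)) λ { (inj₁ (_ , e)) → q (sym e) ; (inj₂ (_ , e)) → p (sym e) })

  ∑-joined-zero : ∀ a {zs} → All elsewhere zs → ∑ (joined u v a) zs ≡ 0
  ∑-joined-zero a []       = refl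
  ∑-joined-zero a (p ∷ ps) = cong₂ _+_ (joined-zero {a} p) (∑-joined-zero a ps)

  edgeSum-joined-zero : ∀ {zs} → All elsewhere zs → edgeSum (joined u v) (pairs zs) ≡ 0
  edgeSum-joined-zero []                 = refl
  edgeSum-joined-zero {z ∷ zs} (p ∷ ps) = edgeSum-pairs (joined u v) z zs ⟫ cong₂ _+_ (∑-joined-zero z ps) (edgeSum-joined-zero ps)

  -- With the vertices rearranged to begin with `u` and `v`, the first pair is the edge in question
  -- and every other pair has its second entry elsewhere.
  joined-once : edgeSum (joined u v) (pairs (allFin n)) ≡ 1
  joined-once with ∈⇒↭ (∈-allFin u)
  ... | ys , p with ∈-resp-↭ p (∈-allFin v)
  ...   | here e = ⊥-elim (u≢v (sym e))
  ...   | there v∈ with ∈⇒↭ v∈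
  ...     | zs , q with ↭-trans p (prep u q)
  ...       | r with unique-↭ r (allFin⁺ n)
  ...         | (_ ∷ u∉) ∷ v∉ ∷ _ = edgeSum-pairs-↭ (joined u v) (joined-sym u v) r
    ⟫ edgeSum-pairs (joined u v) u (v ∷ zs)
    ⟫ cong₂ _+_ (cong₂ _+_ (cong (if_then 1 else 0) (dec-true (joins? u v (u , v)) (inj₁ (refl , refl)))) (∑-joined-zero u away))
        (edgeSum-pairs (joined u v) v zs ⟫ cong₂ _+_ (∑-joined-zero v away) (edgeSum-joined-zero away))
    where
    away : All elsewhere zs
    away = All.zip (u∉ , v∉)

-- Each copy has odd degree, so the total degree has the parity of the number `k` of copies.
oneFactorPart : ∀ {n} m′ {k} {M : List (Edge n)} → Leftover (allFin n) k M → OneFactorPart (k * suc (m′ * 2)) M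
oneFactorPart m′ (none k) with ((k * 2) * suc (m′ * 2)) % 2 | cong (_% 2) (lem k m′) ⟫ m*n%n≡0 (k * suc (m′ * 2)) 2
  where
  lem : ∀ k m → (k * 2) * suc (m * 2) ≡ (k * suc (m * 2)) * 2
  lem = solve-∀
... | .0 | refl = refl
oneFactorPart m′ (perfect k p) with (suc (k * 2) * suc (m′ * 2)) % 2 | cong (_% 2) (lem k m′) ⟫ [m+kn]%n≡m%n 1 (k * suc (m′ * 2) + m′) 2
  where
  lem : ∀ k m → suc (k * 2) * suc (m * 2) ≡ 1 + (k * suc (m * 2) + m) * 2
  lem = solve-∀
... | .1 | refl = p

double-size : (xs : List A) → length (double xs) ≡ length xs * 2
double-size []       = refl
double-size (x ∷ xs) = cong (2 +_) (double-size xs)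

unique-double : {xs : List A} → Unique xs → Unique (double xs)
unique-double []               = []
unique-double {A} {xs = x ∷ xs} (x∉ ∷ uq) = ((λ ()) ∷ away x∉ false) ∷ away x∉ true ∷ unique-double uq
  where
  away : {xs : List A} → All (x ≢_) xs → ∀ b → All ((x , b) ≢_) (double xs)
  away []       b = []
  away (p ∷ ps) b = (p ∘ cong proj₁) ∷ (p ∘ cong proj₁) ∷ away ps b

-- An even length that is at least 3 is at least 4. Here admissibility for the simple complete graph
-- excludes cycles of length 2.
halve-lengths : ∀ T → All (3 ≤_) T → Bipartite2FType T → ∃ λ rs → T ≡ map (_* 2) rs × All (2 ≤_) rs
halve-lengths []      []       []       = [] , refl , []
halve-lengths (c ∷ T) (p ∷ ps) (e ∷ es) with parity c | halve-lengths T ps es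
... | k , inj₂ refl | _ = ⊥-elim (1≢0 (sym ([m+kn]%n≡m%n 1 k 2) ⟫ e))
  where
  1≢0 : 1 ≡ 0 → ⊥
  1≢0 ()
... | suc (suc k) , inj₁ refl | rs , refl , qs = suc (suc k) ∷ rs , refl , s≤s (s≤s z≤n) ∷ qs
halve-lengths (c ∷ T) (() ∷ ps) (e ∷ es) | zero , inj₁ refl | _
halve-lengths (c ∷ T) (s≤s (s≤s ()) ∷ ps) (e ∷ es) | suc zero , inj₁ refl | _

halfType : ∀ m T → Admissible2FType 1 (m * 2) T → Bipartite2FType T → HalfType m T
halfType m T (p , s) e with halve-lengths T p e
... | rs , q , r = rs , q , r , *-cancelʳ-≡ _ _ 2 (sym (sum-double rs) ⟫ cong sum (sym q) ⟫ s)

All-expandType : {P : TwoFactorType → Set} {Tβ : List (TwoFactorType × ℕ)} → All (P ∘ proj₁) Tβ → All P (expandType Tβ)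
All-expandType []                     = []
All-expandType {Tβ = (T , β) ∷ Tβ} (p ∷ ps) = All-++⁺ (replicate⁺ β p) (All-expandType ps)

All-twice⁻ : {P : A → Set} (xs : List A) → All P (twice xs) → All P xs
All-twice⁻ []       []           = []
All-twice⁻ (x ∷ xs) (p ∷ _ ∷ ps) = p ∷ All-twice⁻ xs ps

All-thrice⁻ : {P : A → Set} (xs : List A) → All P (thrice xs) → All P xs
All-thrice⁻ []       []               = []
All-thrice⁻ (x ∷ xs) (p ∷ _ ∷ _ ∷ ps) = p ∷ All-thrice⁻ xs ps

module _ {n m : ℕ} where

  isTwoFactor : ∀ {F T} → HalfType m T → map length F ↭ T → (∀ g → ∑ (∑ g) F ≡ ∑ g (allFin n)) → IsTwoFactor {n} F
  isTwoFactor {F} (rs , refl , r≥2 , _) p s = long F (All-resp-↭ (↭-sym p) (even≥2 r≥2)) ,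
    ∑⇒↭ _≟ᶠ_ (concat F) (allFin n) λ g → ∑-concat g F ⟫ s g
    where
    even≥2 : ∀ {rs} → All (2 ≤_) rs → All (2 ≤_) (map (_* 2) rs)
    even≥2 []             = []
    even≥2 (s≤s q ∷ qs) = s≤s (s≤s z≤n) ∷ even≥2 qs
    long : ∀ F → All (2 ≤_) (map length F) → All (λ C → 2 ≤ length C) F
    long []      []       = []
    long (C ∷ F) (q ∷ qs) = q ∷ long F qs

  fromPacking : ∀ {k M Ts 𝒯} → Packing k M (allFin n) Ts → Ts ↭ 𝒯 → All (HalfType m) 𝒯 → length 𝒯 ≡ degree k n / 2 →
                OneFactorPart (degree k n) M → TwoFactorization k n 𝒯
  fromPacking {k} {M} {Ts} P p t c o = record
    { factors     = factors
    ; oneFactor   = M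
    ; count       = Pointwise-length types ⟫ ↭-length p ⟫ c
    ; areFactors  = all-factors spans types (All-resp-↭ (↭-sym p) t)
    ; oneFactorOK = o
    ; decomposes  = λ u v u≢v → cong₂ _+_ (mults u v factors) (length-filter-∑ (joins? u v) M)
        ⟫ edges (joined u v) (joined-sym u v) ⟫ cong (k *_) (joined-once u≢v) ⟫ *-comm k 1 ⟫ +-identityʳ k
    ; types       = Ts , types , p }
    where
    open Packing P
    all-factors : ∀ {Fs Ts} → All (λ F → ∀ g → ∑ (∑ g) F ≡ ∑ g (allFin n)) Fs → Pointwise (λ F T → map length F ↭ T) Fs Ts →
                  All (HalfType m) Ts → All IsTwoFactor Fs
    all-factors []       []       []       = []
    all-factors (s ∷ ss) (q ∷ qs) (h ∷ hs) = isTwoFactor h q s ∷ all-factors ss qs hs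
    mults : ∀ u v Fs → sum (map (λ F → mult u v (twoFactorEdges F)) Fs) ≡ ∑ (∑ (cycleSum (joined u v))) Fs
    mults u v []       = refl
    mults u v (F ∷ Fs) = cong₂ _+_ (length-filter-∑ (joins? u v) (twoFactorEdges F)
      ⟫ ∑-concatMap _ cycleEdges F ⟫ ∑-cong (edgeSum-cycleEdges (joined u v)) F) (mults u v Fs)

-- Assembling the factorization of the complete multigraph

module _ (m′ : ℕ) where

  private
    m n : ℕ
    m = suc m′
    n = m * 2

  -- The two terms are the two sources of 2-factors: `m′` from each copy, and one from the 1-factors
  -- of every two copies.
  half-degree : ∀ k → degree k n / 2 ≡ k * m′ + k / 2
  half-degree k = cong (_/ 2) (lem k m′) ⟫ +-distrib-/-∣ʳ k (n∣m*n (k * m′)) ⟫ cong (k / 2 +_) (m*n/n≡m (k * m′) 2) ⟫ +-comm (k / 2) _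
    where
    lem : ∀ k m → k * suc (m * 2) ≡ k + (k * m) * 2
    lem = solve-∀

  pack : ∀ {Ts} → Decomposition (double (downFrom m)) Ts → ∀ M → endpoints M ↭ allFin n → Packing 1 M (allFin n) Ts
  pack = relabel (≡-dec _≟ℕ_ _≟ᴮ_) Fin.zero (unique-double (downFrom⁺ m))
    (double-size (downFrom m) ⟫ cong (_* 2) (length-downFrom m) ⟫ sym (length-tabulate {n = n} (λ i → i)))

  fromSchedule : ∀ {k} Bs Ss {𝒯} → length Bs ≡ k → length Ss ≡ k / 2 → 𝒯 ↭ Ss ++ concat Bs → All (HalfType m) 𝒯 → All (HalfType m) Ss →
                 All (Decomposition (double (downFrom m))) Bs → length 𝒯 ≡ degree k n / 2 → TwoFactorization k n 𝒯
  fromSchedule {k} Bs Ss refl l p t ts ds c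
    with superpositions _≟ᶠ_ (length-tabulate {n = n} (λ i → i)) pack Bs Ss (k % 2)
           (m≡m%n+[m/n]*n k 2 ⟫ cong (λ z → k % 2 + z * 2) (sym l)) (s≤s⁻¹ (m%n<n k 2)) ds ts
  ... | M , Ts , P , q , L = fromPacking {m = m} P (↭-trans q (↭-sym p)) t c (oneFactorPart m′ L)

total : ∀ {t Tα} (S : Selection t Tα) → length (expandType Tα) ≡ length (Selection.singles S) + (length (Selection.doublets S) * 2 + t * 3)
total S = ↭-length S.order ⟫ length-++ S.singles ⟫ cong (length S.singles +_)
  (length-++ (twice S.doublets) ⟫ cong₂ _+_ (length-twice S.doublets) (length-thrice S.triples ⟫ cong (_* 3) S.triple-count))
  where module S = Selection S

concat-twice : (Bs : List (List A)) → concat (map twice Bs) ≡ twice (concat Bs)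
concat-twice []       = refl
concat-twice (B ∷ Bs) = cong (twice B ++_) (concat-twice Bs) ⟫ sym (concatMap-++ _ B (concat Bs))

module _ {k : ℕ} (Tα : List (TwoFactorType × ℕ)) where

  -- Every copy takes `g` pairs, one for each Hamilton cycle. The odd parts fill `s` of the `k / 2`
  -- places for single 2-factors, and the remaining `e` places are filled by breaking up pairs; the
  -- total number of 2-factors makes `e` even.
  factorization-odd : ∀ g → All (HalfType (suc (g * 2))) (expandType Tα) → length (expandType Tα) ≡ degree k (suc (g * 2) * 2) / 2 →
                      numOdd (map proj₂ Tα) ≤ k / 2 → TwoFactorization k (suc (g * 2) * 2) (expandType Tα)
  factorization-odd g t c few = fromSchedule (g * 2) (map twice C.portions) C.singles
      (length-map twice C.portions ⟫ C.portions-count) (C.single-count ⟫ fill)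
      (subst (λ l → expandType Tα ↭ C.singles ++ l) (sym (concat-twice C.portions)) order) t (++⁻ˡ C.singles spread)
      (build C.portions C.portion-size (concat⁻ (All-twice⁻ (concat C.portions) (++⁻ʳ C.singles spread)))) c
    where
    S : Selection 0 Tα
    S = select 0 Tα z≤n
    module S = Selection S
    s e : ℕ
    s = length S.singles
    e = k / 2 ∸ s
    fill : s + e ≡ k / 2
    fill = m+[n∸m]≡n (≤-trans (≤-reflexive (sym (+-identityʳ s) ⟫ S.odd-count)) few)
    doubles-size : length S.doublets * 2 ≡ k * g * 2 + e
    doubles-size = +-cancelˡ-≡ s _ _ (cong (s +_) (sym (+-identityʳ _)) ⟫ sym (total S) ⟫ c ⟫ half-degree (g * 2) k
      ⟫ cong (k * (g * 2) +_) (sym fill) ⟫ lem k g s e)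
      where
      lem : ∀ k g s e → k * (g * 2) + (s + e) ≡ s + (k * g * 2 + e)
      lem = solve-∀
    module C = Schedule (schedule S k g e doubles-size)
    no-triples : C.triples ≡ []
    no-triples with C.triples | C.triple-count
    ... | [] | _ = refl
    order : expandType Tα ↭ C.singles ++ twice (concat C.portions)
    order = subst (λ l → expandType Tα ↭ C.singles ++ thrice l ++ twice (concat C.portions)) no-triples C.order
    spread : All (HalfType (suc (g * 2))) (C.singles ++ twice (concat C.portions))
    spread = All-resp-↭ order t
    build : ∀ Bs → All (λ B → length B ≡ g) Bs → All (All (HalfType (suc (g * 2)))) Bs → All (Decomposition (double (downFrom (suc (g * 2))))) (map twice Bs)
    build []       []       []       = []
    build (B ∷ Bs) (l ∷ ls) (h ∷ hs) = decompose-odd g B l h ∷ build Bs ls hs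

  -- Every copy also needs a triple. An odd part of size at least 3 supplies one, so `k` odd parts
  -- are spent on triples, and the bound `k + k / 2` leaves at most `k / 2` of them as singles.
  factorization-even : ∀ g → let m = suc (suc (suc g * 2)) in
                       All (HalfType m) (expandType Tα) → length (expandType Tα) ≡ degree k (m * 2) / 2 →
                       numOdd (map proj₂ Tα) ≤ k + k / 2 → k ≤ numOddGe3 (map proj₂ Tα) → TwoFactorization k (m * 2) (expandType Tα)
  factorization-even g t c few many = fromSchedule (suc (suc g * 2)) (zipWith bundle C.triples C.portions) C.singles
      (length-bundles C.triples C.portions same-length ⟫ C.portions-count) (C.single-count ⟫ fill)
      (↭-trans C.order (++⁺ˡ C.singles (↭-sym (bundles C.triples C.portions same-length)))) t (++⁻ˡ C.singles spread)
      (build C.triples C.portions (All-thrice⁻ C.triples (++⁻ˡ (thrice C.triples) (++⁻ʳ C.singles spread))) C.portion-size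
        (concat⁻ (All-twice⁻ (concat C.portions) (++⁻ʳ (thrice C.triples) (++⁻ʳ C.singles spread))))) c
    where
    m : ℕ
    m = suc (suc (suc g * 2))
    S : Selection k Tα
    S = select k Tα many
    module S = Selection S
    s e : ℕ
    s = length S.singles
    e = k / 2 ∸ s
    fill : s + e ≡ k / 2
    fill = m+[n∸m]≡n (+-cancelˡ-≤ k s (k / 2) (≤-trans (≤-reflexive (+-comm k s ⟫ S.odd-count)) few))
    doubles-size : length S.doublets * 2 ≡ k * g * 2 + e
    doubles-size = +-cancelˡ-≡ (s + k * 3) _ _ (lem₁ s (length S.doublets * 2) (k * 3) ⟫ sym (total S) ⟫ c ⟫ half-degree (suc (suc g * 2)) k
      ⟫ cong (k * suc (suc g * 2) +_) (sym fill) ⟫ lem₂ k g s e)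
      where
      lem₁ : ∀ s d t → (s + t) + d ≡ s + (d + t)
      lem₁ = solve-∀
      lem₂ : ∀ k g s e → k * suc (suc g * 2) + (s + e) ≡ (s + k * 3) + (k * g * 2 + e)
      lem₂ = solve-∀
    module C = Schedule (schedule S k g e doubles-size)
    same-length : length C.triples ≡ length C.portions
    same-length = C.triple-count ⟫ sym C.portions-count
    bundle : TwoFactorType → List TwoFactorType → List TwoFactorType
    bundle V B = V ∷ V ∷ V ∷ twice B
    length-bundles : ∀ Vs Bs → length Vs ≡ length Bs → length (zipWith bundle Vs Bs) ≡ length Bs
    length-bundles []       []       _ = refl
    length-bundles (V ∷ Vs) (B ∷ Bs) l = cong suc (length-bundles Vs Bs (suc-injective l))
    bundles : ∀ Vs Bs → length Vs ≡ length Bs → concat (zipWith bundle Vs Bs) ↭ thrice Vs ++ twice (concat Bs)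
    bundles []       []       _ = ↭-refl
    bundles (V ∷ Vs) (B ∷ Bs) l = prep V (prep V (prep V (↭-trans (++⁺ˡ (twice B) (bundles Vs Bs (suc-injective l)))
      (↭-trans (shifts (twice B) (thrice Vs)) (++⁺ˡ (thrice Vs) (↭-reflexive (sym (concatMap-++ _ B (concat Bs)))))))))
    spread : All (HalfType m) (C.singles ++ thrice C.triples ++ twice (concat C.portions))
    spread = All-resp-↭ C.order t
    build : ∀ Vs Bs → All (HalfType m) Vs → All (λ B → length B ≡ g) Bs → All (All (HalfType m)) Bs →
            All (Decomposition (double (downFrom m))) (zipWith bundle Vs Bs)
    build []       _        _        _        _        = []
    build (V ∷ Vs) []       _        _        _        = []
    build (V ∷ Vs) (B ∷ Bs) (v ∷ vs) (l ∷ ls) (h ∷ hs) = decompose-even g V B v l h ∷ build Vs Bs vs ls hs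

-- Four vertices are too few for the ladder, but there condition (ii) is void: the `k` triples would
-- contain `3 * k` 2-factors, while the degree allows at most `2 * k`.
no-triples-on-four : ∀ {k} Tα → k ≥ 1 → length (expandType Tα) ≡ degree k 4 / 2 → k ≤ numOddGe3 (map proj₂ Tα) → ⊥
no-triples-on-four {suc k} Tα _ c many = <⇒≱ {suc k * 2} {suc k * 3} (lem< k)
  (≤-trans (≤-trans (m≤n+m (suc k * 3) (length S.doublets * 2)) (m≤n+m (length S.doublets * 2 + suc k * 3) (length S.singles)))
    (≤-trans (≤-reflexive (sym (total S₀) ⟫ c ⟫ half-degree 1 (suc k))) (≤-trans (+-monoʳ-≤ (suc k * 1) (m/n≤m (suc k) 2)) (≤-reflexive (lem (suc k))))))
  where
  S₀ : Selection (suc k) Tα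
  S₀ = select (suc k) Tα many
  module S = Selection S₀
  lem : ∀ k → k * 1 + k ≡ k * 2
  lem = solve-∀
  lem< : ∀ k → suc k * 2 < suc k * 3
  lem< k = ≤-trans (m≤m+n (suc (suc k * 2)) k) (≤-reflexive (lem′ k))
    where
    lem′ : ∀ k → suc (suc k * 2) + k ≡ suc k * 3
    lem′ = solve-∀

theorem9p4 : (n λ' : ℕ) → n ≥ 1 → n % 2 ≡ 0 → λ' ≥ 1 →
    (Tβ : List (TwoFactorType × ℕ)) →
    All (λ p → proj₂ p ≥ 1) Tβ →
    All (λ p → Admissible2FType 1 n (proj₁ p) × Bipartite2FType (proj₁ p)) Tβ →
    AdmissibleFactorizationType λ' n (expandType Tβ) →
    BipartiteFactorizationType (expandType Tβ) →
    Σ (List ℕ) (λ αs → All (λ a → a ≥ 1) αs × IsRefinement αs (map proj₂ Tβ) ×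
    ((n % 4 ≡ 2 × numOdd αs ≤ λ' / 2)
    ⊎ (n % 4 ≡ 0 × numOdd αs ≤ λ' + λ' / 2 × numOddGe3 αs ≥ λ'))) →
    TwoFactorization λ' n (expandType Tβ)
theorem9p4 n λ' n≥1 even λ'≥1 Tβ _ adm (c , _) _ (αs , _ , (parts , perm , pw) , conditions)
  with parity n | blocks parts Tβ pw
... | h , inj₂ refl | _ = ⊥-elim (1≢0 (sym ([m+kn]%n≡m%n 1 h 2) ⟫ even))
  where
  1≢0 : 1 ≡ 0 → ⊥
  1≢0 ()
... | h , inj₁ refl | Tα , e , e′ = subst (TwoFactorization λ' (h * 2)) e (cases h n≥1 half count conditions)
  where
  αs-order : map proj₂ Tα ↭ αs
  αs-order = ↭-trans (↭-reflexive e′) perm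
  odd≡ : numOdd (map proj₂ Tα) ≡ numOdd αs
  odd≡ = ↭-length (filter-↭ _ αs-order)
  odd≥3≡ : numOddGe3 (map proj₂ Tα) ≡ numOddGe3 αs
  odd≥3≡ = ↭-length (filter-↭ _ (filter-↭ _ αs-order))
  half : All (HalfType h) (expandType Tα)
  half = subst (All (HalfType h)) (sym e) (All-expandType (All.map (λ {p} (a , b) → halfType h (proj₁ p) a b) adm))
  count : length (expandType Tα) ≡ degree λ' (h * 2) / 2
  count = cong length e ⟫ c
  cases : ∀ h → h * 2 ≥ 1 → All (HalfType h) (expandType Tα) → length (expandType Tα) ≡ degree λ' (h * 2) / 2 →
          (h * 2 % 4 ≡ 2 × numOdd αs ≤ λ' / 2) ⊎ (h * 2 % 4 ≡ 0 × numOdd αs ≤ λ' + λ' / 2 × numOddGe3 αs ≥ λ') →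
          TwoFactorization λ' (h * 2) (expandType Tα)
  -- The parity of `h` is that of half of `n`, so it contradicts one of the two conditions. In the
  -- even case the construction starts at `h = 4`; the values 0 and 2 are excluded separately.
  cases h p t c d with parity h
  cases _ p t c (inj₁ (_ , few)) | g , inj₂ refl = factorization-odd Tα g t c (≤-trans (≤-reflexive odd≡) few)
  cases _ p t c (inj₂ (r , _)) | g , inj₂ refl = ⊥-elim (2≢0 (sym ([m+kn]%n≡m%n 2 g 4) ⟫ cong (_% 4) (lem g) ⟫ r))
    where
    2≢0 : 2 ≡ 0 → ⊥
    2≢0 ()
    lem : ∀ g → 2 + g * 4 ≡ suc (g * 2) * 2
    lem = solve-∀
  cases _ p t c (inj₁ (r , _)) | j , inj₁ refl = ⊥-elim (0≢2 (sym (m*n%n≡0 j 4) ⟫ cong (_% 4) (sym (*-assoc j 2 2)) ⟫ r))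
    where
    0≢2 : 0 ≡ 2 → ⊥
    0≢2 ()
  cases _ () t c _ | zero , inj₁ refl
  cases _ p t c (inj₂ (_ , _ , many)) | suc zero , inj₁ refl =
    ⊥-elim (no-triples-on-four Tα λ'≥1 c (≤-trans many (≤-reflexive (sym odd≥3≡))))
  cases _ p t c (inj₂ (_ , few , many)) | suc (suc g) , inj₁ refl =
    factorization-even Tα g t c (≤-trans (≤-reflexive odd≡) few) (≤-trans many (≤-reflexive (sym odd≥3≡)))
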